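{- Fix a positive integer $k$. If $\Pi_n$ is a uniformly random element of $\mathbf{Iv}_n(123\cdots k(k+1))$, then \[ fp(\Pi_{2n}) \rightarrow_d X_{even} \quad\text{and}\quad fp(\Pi_{2n-1})\rightarrow_d X_{odd},\] where $\mathbb{P}(X_{even}=i)=\binom{k}{i}/2^{k-1}$ if $i$ is even and $0$ if $i$ is odd, and $\mathbb{P}(X_{odd}=i)=\binom{k}{i}/2^{k-1}$ if $i$ is odd and $0$ if $i$ is even (for $i\in\{0,1,\dots,k\}$).
   Context: For a permutation $\pi$, $fp(\pi)$ denotes its number of fixed points. A permutation $\pi$ of $[n]$ contains a pattern $\tau\in S_m$ if there are indices $i_1<\cdots<i_m$ such that $(\pi_{i_1},\dots,\pi_{i_m})$ is in the same relative order as $\tau$; otherwise $\pi$ avoids $\tau$. An involution is a permutation with $\pi^{ -1}=\pi$. $\mathbf{Iv}_n(\tau)$ is the set of $\tau$-avoiding involutions of $[n]$; here $123\cdots k(k+1)$ is the increasing pattern of length $k+1$. $\rightarrow_d$ denotes convergence in distribution as $n\to\infty$. -}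

module Defs where

open import Data.Nat using (ℕ; zero; suc; _+_; _*_; _∸_; _^_; _<ᵇ_)
open import Data.Nat.Combinatorics using (_C_)
open import Data.Bool using (Bool; true; false; _∧_; not; if_then_else_; T)
open import Data.Bool.Properties using (T?)
open import Data.Bool.ListAction using (all; any)
open import Data.Fin using (Fin; toℕ; _≟_)
open import Data.Fin.Properties using ()
open import Data.List using (List; []; _∷_; map; concatMap; length; filter; allFin; _++_)
open import Data.Vec using (Vec; []; _∷_; lookup; toList; tabulate)
open import Data.Integer using (+_)
open import Data.Rational using (ℚ; _/_; 0ℚ)
open import Relation.Nullary.Decidable using (⌊_⌋)
open import Relation.Unary using (Pred)

-- A permutation-like map of [n] is represented as a vector v of length n,
-- π(i) = lookup v i  (positions and values in Fin n, i.e. 0-based).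
Map : ℕ → Set
Map n = Vec (Fin n) n

allVecs : (n m : ℕ) → List (Vec (Fin m) n)
allVecs zero    m = [] ∷ []
allVecs (suc n) m = concatMap (λ x → map (x ∷_) (allVecs n m)) (allFin m)

-- π is an involution: π(π(i)) = i for all i (this also forces bijectivity)
isInvolution : ∀ {n} → Map n → Bool
isInvolution {n} v = all (λ i → ⌊ lookup v (lookup v i) ≟ i ⌋) (allFin n)

subseqs : {A : Set} → List A → List (List A)
subseqs [] = [] ∷ []
subseqs (x ∷ xs) = map (x ∷_) (subseqs xs) ++ subseqs xs

strictlyIncreasing : List ℕ → Bool
strictlyIncreasing [] = true
strictlyIncreasing (x ∷ []) = true
strictlyIncreasing (x ∷ y ∷ xs) = (x <ᵇ y) ∧ strictlyIncreasing (y ∷ xs)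

oneLine : ∀ {n} → Map n → List ℕ
oneLine v = map toℕ (toList v)

-- π contains the pattern 12⋯m iff some subsequence of its one-line notation
-- of length m is in the same relative order as 12⋯m, i.e. strictly increasing
containsIncreasing : ℕ → ∀ {n} → Map n → Bool
containsIncreasing m v =
  any (λ s → ⌊ Data.Nat._≟_ (length s) m ⌋ ∧ strictlyIncreasing s) (subseqs (oneLine v))

-- Iv_n(12⋯k(k+1)) : involutions of [n] avoiding 12⋯(k+1), as a list (without repetition)
Iv : (k n : ℕ) → List (Map n)
Iv k n = filter (λ v → T? (isInvolution v ∧ not (containsIncreasing (suc k) v))) (allVecs n n)

fp : ∀ {n} → Map n → ℕ
fp {n} v = length (filter (λ i → lookup v i ≟ i) (allFin n))

-- a / b as a rational (with the convention a / 0 = 0; only used with b ≠ 0)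
frac : ℕ → ℕ → ℚ
frac a zero    = 0ℚ
frac a (suc b) = (+ a) / suc b

probFp : (k n i : ℕ) → ℚ
probFp k n i = frac (length (filter (λ v → fp v Data.Nat.≟ i) (Iv k n))) (length (Iv k n))

even : ℕ → Bool
even zero = true
even (suc n) = not (even n)

pEven : (k i : ℕ) → ℚ
pEven k i = if even i then frac (k C i) (2 ^ (k ∸ 1)) else 0ℚ

pOdd : (k i : ℕ) → ℚ
pOdd k i = if even i then 0ℚ else frac (k C i) (2 ^ (k ∸ 1))

ConvergesTo : (ℕ → ℚ) → ℚ → Set
ConvergesTo a L = ∀ (ε : ℚ) → 0ℚ Data.Rational.< ε →
  Data.Product.∃ λ N → ∀ n → N Data.Nat.≤ n → Data.Rational.∣ a n Data.Rational.- L ∣ Data.Rational.< ε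
  where import Data.Product

-- convergence in distribution of ℕ-valued random variables with laws
-- (P(Y_n = i))_i to a law (P(X = i))_i: pointwise convergence of the pmfs
ConvergesInDist : (ℕ → ℕ → ℚ) → (ℕ → ℚ) → Set
ConvergesInDist P Q = ∀ i → ConvergesTo (λ n → P n i) (Q i)

-- Involutions are built up by adding a largest fixed point or two-cycle. Beissinger's insertion
-- turns this construction into standard tableaux: the first row is as long as the longest increasing
-- subsequence, and the fixed points are counted by the columns of odd length. Conjugating,
-- avoiding involutions become walks in the Weyl chamber l₁ > ⋯ > l_k ≥ 0 from ρ = (k − 1, …, 0), and
-- fp is the number of odd entries of l − ρ at the end.
--
-- By the reflection principle the number of such walks ending at l is the coefficient of x^l in
-- a p^n, where a = Π_{i<j} (x_i − x_j) and p = x_1 + ⋯ + x_k. In the ℓ¹ norm of coefficients a coupling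
-- argument gives ‖(x_i − x_j) p^m‖ = O(k^m m^(-1/2)), so that ‖(x_i − x_{i+1}) a p^n‖ is at most of
-- order k^n n^(-(K+1)/2), K = k(k − 1)/2, while evaluating a p^n at k points of the unit circle at
-- distances of order n^(-1/2) shows that the total number of walks is at least of order k^n n^(-K/2).
-- Hence flipping two adjacent parities changes the number of walks by a negligible amount: all
-- 2^(k−1) parity vectors compatible with n are asymptotically equally likely, and C(k, i) of
-- them have i odd entries.
module Submission where

open import Data.Bool using (Bool; true; false; if_then_else_; not; _∧_)
open import Data.Empty using (⊥-elim)
open import Data.Fin using (Fin)
open import Data.List using (List; length)
open import Data.Maybe using (Maybe; just; nothing)
open import Data.Nat using (ℕ; zero; suc; z≤n; s≤s)
open import Data.Product using (_×_; _,_; proj₁; proj₂; ∃; ∃₂)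
open import Data.Sum using (_⊎_; inj₁; inj₂)
open import Data.Vec using (Vec)
open import Function using (_∘_; Equivalence)
open import Relation.Nullary using (yes; no)
open import Relation.Binary.PropositionalEquality
open import Data.Integer.Tactic.RingSolver using (solve-∀)
import Data.Nat.Tactic.RingSolver as NatSolver

-- Polynomials never occur as objects. A polynomial is treated as the functional that sends a test
-- function on exponent vectors to the sum of coefficient times value. Multiplication by p or by x_i
-- - x_j then becomes an operator on test functions, and an ℓ¹ bound becomes a bound uniform over
-- bounded test functions. A bound ‖φ‖ ≤ b/c is written `c * ∣ φ l ∣ ≤ b`, which keeps everything in
-- ℕ and ℤ. The comparison of the two bounds is won by a single factor n^(-1/2): the K factors of
-- the Vandermonde product cost the same in both, and only the extra difference x_i - x_{i+1} leaves
-- a gain. Constants depending on k are therefore harmless, but the exponents must be sharp. In the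
-- upper bound each of the K + 1 differences receives its own share, of order n, of the n steps. In
-- the lower bound the evaluation points lie so close to 1 that |p|^n keeps the order k^n, and yet
-- so far apart that the product a keeps the order n^(-K/2).

-- Shift operators on test functions and the coupling bound

module ShiftOperators where
  open import Data.Nat using (_+_; _*_; _^_; _≤_)
  open import Data.Nat.Properties
  open import Data.Integer as ℤ using (ℤ; ∣_∣)
  import Data.Integer.Properties as ℤ
  open import Data.Fin using (zero; suc; punchIn; punchOut)
  open import Data.Fin.Properties using (punchIn-punchOut)
  open import Data.Vec using ([]; _∷_)
  open import Data.List using ([]; _∷_)
  open import Data.List.Relation.Unary.All using (All; []; _∷_)
  open import Data.Product using (uncurry)
  open import Algebra.Properties.CommutativeMonoid.Sum ℤ.+-0-commutativeMonoid public
    using (sum; sum-remove; sum-cong-≗; sum-permute; ∑-comm; ∑-distrib-+)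

  Fun : ℕ → Set
  Fun k = Vec ℕ k → ℤ

  inc : ∀ {k} → Fin k → Vec ℕ k → Vec ℕ k
  inc zero    (a ∷ l) = suc a ∷ l
  inc (suc t) (a ∷ l) = a ∷ inc t l

  inc-comm : ∀ {k} (s t : Fin k) l → inc s (inc t l) ≡ inc t (inc s l)
  inc-comm zero    zero    (a ∷ l) = refl
  inc-comm zero    (suc t) (a ∷ l) = refl
  inc-comm (suc s) zero    (a ∷ l) = refl
  inc-comm (suc s) (suc t) (a ∷ l) = cong (a ∷_) (inc-comm s t l)

  pw : ∀ {k} → Fun k → Fun k
  pw φ l = sum (λ t → φ (inc t l))

  pwⁿ : ∀ {k} → ℕ → Fun k → Fun k
  pwⁿ zero    φ = φ
  pwⁿ (suc n) φ = pw (pwⁿ n φ)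

  dif : ∀ {k} → Fin k → Fin k → Fun k → Fun k
  dif a b φ l = φ (inc a l) ℤ.- φ (inc b l)

  difs : ∀ {k} → List (Fin k × Fin k) → Fun k → Fun k
  difs []            φ = φ
  difs ((a , b) ∷ L) φ = difs L (dif a b φ)

  pw-cong : ∀ {k} {φ ψ : Fun k} → φ ≗ ψ → pw φ ≗ pw ψ
  pw-cong e l = sum-cong-≗ (λ t → e (inc t l))

  pwⁿ-cong : ∀ {k} n {φ ψ : Fun k} → φ ≗ ψ → pwⁿ n φ ≗ pwⁿ n ψ
  pwⁿ-cong zero    e = e
  pwⁿ-cong (suc n) e = pw-cong (pwⁿ-cong n e)

  dif-cong : ∀ {k} (a b : Fin k) {φ ψ : Fun k} → φ ≗ ψ → dif a b φ ≗ dif a b ψ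
  dif-cong a b e l = cong₂ ℤ._-_ (e (inc a l)) (e (inc b l))

  difs-cong : ∀ {k} (L : List (Fin k × Fin k)) {φ ψ : Fun k} → φ ≗ ψ → difs L φ ≗ difs L ψ
  difs-cong []            e = e
  difs-cong ((a , b) ∷ L) e = difs-cong L (dif-cong a b e)

  pwⁿ-+ : ∀ {k} m n (φ : Fun k) → pwⁿ (m + n) φ ≡ pwⁿ m (pwⁿ n φ)
  pwⁿ-+ zero    n φ = refl
  pwⁿ-+ (suc m) n φ = cong pw (pwⁿ-+ m n φ)

  interchange : ∀ a b c d → (a ℤ.+ b) ℤ.- (c ℤ.+ d) ≡ (a ℤ.- c) ℤ.+ (b ℤ.- d)
  interchange = solve-∀

  sum-sub : ∀ {n} (f g : Fin n → ℤ) → sum f ℤ.- sum g ≡ sum (λ t → f t ℤ.- g t)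
  sum-sub {zero}  f g = refl
  sum-sub {suc n} f g = trans (interchange (f zero) (sum (f ∘ suc)) (g zero) (sum (g ∘ suc)))
    (cong (ℤ._+_ (f zero ℤ.- g zero)) (sum-sub (f ∘ suc) (g ∘ suc)))

  dif-pw : ∀ {k} (a b : Fin k) φ → dif a b (pw φ) ≗ pw (dif a b φ)
  dif-pw a b φ l = trans (sum-sub (λ t → φ (inc t (inc a l))) (λ t → φ (inc t (inc b l))))
    (sum-cong-≗ λ t → cong₂ ℤ._-_ (cong φ (inc-comm t a l)) (cong φ (inc-comm t b l)))

  dif-pwⁿ : ∀ {k} n (a b : Fin k) φ → dif a b (pwⁿ n φ) ≗ pwⁿ n (dif a b φ)
  dif-pwⁿ zero    a b φ l = refl
  dif-pwⁿ (suc n) a b φ l = trans (dif-pw a b (pwⁿ n φ) l) (pw-cong (dif-pwⁿ n a b φ) l)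

  sum-bound : ∀ {n} (f : Fin n → ℤ) c b → (∀ t → c * ∣ f t ∣ ≤ b) → c * ∣ sum f ∣ ≤ n * b
  sum-bound {zero}  f c b h = ≤-reflexive (*-zeroʳ c)
  sum-bound {suc n} f c b h = begin
    c * ∣ f zero ℤ.+ sum (f ∘ suc) ∣ ≤⟨ *-monoʳ-≤ c (ℤ.∣i+j∣≤∣i∣+∣j∣ (f zero) _) ⟩
    c * (∣ f zero ∣ + ∣ sum (f ∘ suc) ∣) ≡⟨ *-distribˡ-+ c _ _ ⟩
    c * ∣ f zero ∣ + c * ∣ sum (f ∘ suc) ∣ ≤⟨ +-mono-≤ (h zero) (sum-bound (f ∘ suc) c b (h ∘ suc)) ⟩
    b + n * b ∎
    where open ≤-Reasoning

  pwⁿ-bound : ∀ {k} n (φ : Fun k) c b → (∀ l → c * ∣ φ l ∣ ≤ b) →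
              ∀ l → c * ∣ pwⁿ n φ l ∣ ≤ k ^ n * b
  pwⁿ-bound zero φ c b h l = ≤-trans (h l) (≤-reflexive (sym (*-identityˡ b)))
  pwⁿ-bound {k} (suc n) φ c b h l = ≤-trans
    (sum-bound (λ t → pwⁿ n φ (inc t l)) c _ (λ t → pwⁿ-bound n φ c b h (inc t l)))
    (≤-reflexive (sym (*-assoc k (k ^ n) b)))

  sum-remove₂ : ∀ {n} {i j : Fin (2 + n)} (i≢j : i ≢ j) (f : Fin (2 + n) → ℤ) →
    sum f ≡ f i ℤ.+ (f j ℤ.+ sum (λ t → f (punchIn i (punchIn (punchOut i≢j) t))))
  sum-remove₂ {i = i} {j} i≢j f = trans (sum-remove f) (cong (ℤ._+_ (f i))
    (trans (sum-remove {i = punchOut i≢j} (f ∘ punchIn i))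
           (cong (λ x → f x ℤ.+ sum (λ t → f (punchIn i (punchIn (punchOut i≢j) t)))) (punchIn-punchOut i≢j))))

  incⁿ : ∀ {k} → ℕ → Fin k → Vec ℕ k → Vec ℕ k
  incⁿ zero    t l = l
  incⁿ (suc d) t l = inc t (incⁿ d t l)

  incⁿ-inc : ∀ {k} d (s t : Fin k) l → inc t (incⁿ d s l) ≡ incⁿ d s (inc t l)
  incⁿ-inc zero    s t l = refl
  incⁿ-inc (suc d) s t l = trans (inc-comm t s _) (cong (inc s) (incⁿ-inc d s t l))

  gap : ∀ {k} → Fin k → Fin k → ℕ → Fun k → Fun k
  gap i j d φ l = φ (incⁿ d i l) ℤ.- φ (incⁿ d j l)

  -- (xᵢᵈ⁺¹ − xⱼᵈ⁺¹)(xᵢ + xⱼ) = (xᵢᵈ⁺² − xⱼᵈ⁺²) + xᵢxⱼ(xᵢᵈ − xⱼᵈ): the mirror coupling of two walks.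
  gap-pw : ∀ {n} {i j : Fin (2 + n)} (i≢j : i ≢ j) d φ l →
    gap i j (suc d) (pw φ) l ≡
    gap i j (2 + d) φ l ℤ.+ (gap i j d φ (inc i (inc j l)) ℤ.+
      sum (λ t → gap i j (suc d) φ (inc (punchIn i (punchIn (punchOut i≢j) t)) l)))
  gap-pw {n} {i} {j} i≢j d φ l = begin
    sum f ℤ.- sum g ≡⟨ cong₂ ℤ._-_ (sum-remove₂ i≢j f) (sum-remove₂ i≢j g) ⟩
    (f i ℤ.+ (f j ℤ.+ sum f′)) ℤ.- (g i ℤ.+ (g j ℤ.+ sum g′)) ≡⟨ rearr (f i) (f j) (sum f′) (g i) (g j) (sum g′) ⟩
    (f i ℤ.- g j) ℤ.+ ((f j ℤ.- g i) ℤ.+ (sum f′ ℤ.- sum g′)) ≡⟨ cong₂ (λ x y → (f i ℤ.- g j) ℤ.+ (x ℤ.+ y)) e₁ e₂ ⟩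
    _ ∎
    where
    open ≡-Reasoning
    p : Fin n → Fin (2 + n)
    p t = punchIn i (punchIn (punchOut i≢j) t)
    f g : Fin (2 + n) → ℤ
    f t = φ (inc t (incⁿ (suc d) i l))
    g t = φ (inc t (incⁿ (suc d) j l))
    f′ g′ : Fin n → ℤ
    f′ t = f (p t)
    g′ t = g (p t)
    rearr : ∀ a b c x y z → (a ℤ.+ (b ℤ.+ c)) ℤ.- (x ℤ.+ (y ℤ.+ z)) ≡ (a ℤ.- y) ℤ.+ ((b ℤ.- x) ℤ.+ (c ℤ.- z))
    rearr = solve-∀
    e₁ : f j ℤ.- g i ≡ gap i j d φ (inc i (inc j l))
    e₁ = cong₂ (λ x y → φ x ℤ.- φ y)
      (trans (cong (inc j) (incⁿ-inc d i i l)) (trans (incⁿ-inc d i j _) (cong (incⁿ d i) (inc-comm j i l))))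
      (trans (cong (inc i) (incⁿ-inc d j j l)) (incⁿ-inc d j i _))
    e₂ : sum f′ ℤ.- sum g′ ≡ sum (λ t → gap i j (suc d) φ (inc (p t) l))
    e₂ = trans (sum-sub f′ g′) (sum-cong-≗ λ t →
      cong₂ (λ x y → φ x ℤ.- φ y) (incⁿ-inc (suc d) i (p t) l) (incⁿ-inc (suc d) j (p t) l))

  module _ (κ : ℕ) where
    private
      k = 2 + κ

    -- An upper bound for Σ_{r<m} k^(m-r) ‖(xᵢᵈ − xⱼᵈ) pwʳ‖.
    S : ℕ → ℕ → ℕ
    S zero    d       = 0
    S (suc m) zero    = 0
    S (suc m) (suc d) = 2 * k ^ suc m + (S m (2 + d) + (S m d + κ * S m (suc d)))

    S₀ : ∀ m → S m 0 ≡ 0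
    S₀ zero    = refl
    S₀ (suc m) = refl

    S-crude : ∀ m d → S m d ≤ 2 * m * k ^ m
    S-crude zero    d       = z≤n
    S-crude (suc m) zero    = z≤n
    S-crude (suc m) (suc d) = ≤-trans
      (+-monoʳ-≤ (2 * k ^ suc m)
        (+-mono-≤ (S-crude m (2 + d)) (+-mono-≤ (S-crude m d) (*-monoʳ-≤ κ (S-crude m (suc d))))))
      (≤-reflexive (lem κ m (k ^ m)))
      where
      lem : ∀ κ m p → 2 * ((2 + κ) * p) + (2 * m * p + (2 * m * p + κ * (2 * m * p)))
            ≡ 2 * (1 + m) * ((2 + κ) * p)
      lem = NatSolver.solve-∀

    -- Gambler's ruin. Divided by k^m, `S m d` is twice the expectation of min(m, T), where T is the
    -- time at which a lazy walk from d hits 0, its steps +1 and -1 having probability 1/k each. If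
    -- the walk is also stopped at the barrier d + e, it gets there before 0 with probability d/(d +
    -- e), with at most m steps remaining, and the mean exit time is k d e/2.
    S-bound : ∀ m d e → (d + e) * S m d ≤ k ^ m * (2 * m * d + k * (d + e) * (d * e))
    S-bound m zero e = ≤-trans (≤-reflexive (trans (cong (e *_) (S₀ m)) (*-zeroʳ e))) z≤n
    S-bound m (suc d) zero = ≤-trans (*-monoʳ-≤ (suc d + 0) (S-crude m (suc d)))
      (≤-reflexive (lem (suc d) m (k ^ m) k))
      where
      lem : ∀ d m p k → (d + 0) * (2 * m * p) ≡ p * (2 * m * d + k * (d + 0) * (d * 0))
      lem = NatSolver.solve-∀
    S-bound zero (suc d) (suc e) = ≤-trans (≤-reflexive (*-zeroʳ (suc d + suc e))) z≤n
    S-bound (suc m) (suc d) (suc e) = begin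
      s * (2 * k ^ suc m + (A + (B + κ * C)))
        ≡⟨ lem₁ s κ (2 * k ^ suc m) A B C ⟩
      s * (2 * k ^ suc m) + (s * A + (s * B + κ * (s * C)))
        ≤⟨ +-monoʳ-≤ (s * (2 * k ^ suc m)) (+-mono-≤ hA (+-mono-≤ hB (*-monoʳ-≤ κ hC))) ⟩
      s * (2 * k ^ suc m) + (k ^ m * (2 * m * (2 + d) + k * s * ((2 + d) * e)) +
        (k ^ m * (2 * m * d + k * s * (d * (2 + e))) +
         κ * (k ^ m * (2 * m * suc d + k * s * (suc d * suc e)))))
        -- The slack is the growth of 2m to 2(m + 1). The term 2k^(m+1) is absorbed by the concavity
        -- of the product d e along constant d + e.
        ≤⟨ m≤m+n _ (k ^ m * (2 * k * suc d)) ⟩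
      _ ≡⟨ lem₂ s κ (k ^ m) m d e ⟩
      k ^ suc m * (2 * suc m * suc d + k * s * (suc d * suc e)) ∎
      where
      open ≤-Reasoning
      s = suc d + suc e
      A = S m (2 + d)
      B = S m d
      C = S m (suc d)
      lem₁ : ∀ s κ x a b c → s * (x + (a + (b + κ * c))) ≡ s * x + (s * a + (s * b + κ * (s * c)))
      lem₁ = NatSolver.solve-∀
      lem₂ : ∀ s κ p m d e →
        s * (2 * ((2 + κ) * p)) + (p * (2 * m * (2 + d) + (2 + κ) * s * ((2 + d) * e)) +
        (p * (2 * m * d + (2 + κ) * s * (d * (2 + e))) +
         κ * (p * (2 * m * (1 + d) + (2 + κ) * s * ((1 + d) * (1 + e))))))
         + p * (2 * (2 + κ) * (1 + d))
        ≡ (2 + κ) * p * (2 * (1 + m) * (1 + d) + (2 + κ) * s * ((1 + d) * (1 + e)))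
      lem₂ = NatSolver.solve-∀
      shift₁ : suc (suc d) + e ≡ s
      shift₁ = sym (+-suc (suc d) e)
      hA : s * A ≤ k ^ m * (2 * m * (2 + d) + k * s * ((2 + d) * e))
      hA = subst (λ z → z * A ≤ k ^ m * (2 * m * (2 + d) + k * z * ((2 + d) * e)))
                 shift₁ (S-bound m (2 + d) e)
      hB : s * B ≤ k ^ m * (2 * m * d + k * s * (d * (2 + e)))
      hB = subst (λ z → z * B ≤ k ^ m * (2 * m * d + k * z * (d * (2 + e))))
                 (+-suc d (suc e)) (S-bound m d (2 + e))
      hC : s * C ≤ k ^ m * (2 * m * suc d + k * s * (suc d * suc e))
      hC = S-bound m (suc d) (suc e)

    module _ {i j : Fin k} (i≢j : i ≢ j) where

      -- Markov's inequality for the coupling time: of the `suc m` copies of the gap one is bounded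
      -- trivially and the other m undergo a coupling step, which is the recursion of `S`.
      gap-bound : ∀ m (φ : Fun k) c b → (∀ l → c * ∣ φ l ∣ ≤ b) → ∀ d l →
                  m * c * ∣ gap i j d (pwⁿ m φ) l ∣ ≤ S m d * b
      gap-bound zero φ c b h d l = z≤n
      gap-bound (suc m) φ c b h zero l = ≤-reflexive
        (trans (cong (λ z → suc m * c * ∣ z ∣) (ℤ.+-inverseʳ (pwⁿ (suc m) φ l))) (*-zeroʳ (suc m * c)))
      gap-bound (suc m) φ c b h (suc d) l = begin
        suc m * c * g ≡⟨ lem₁ m c g ⟩
        c * g + m * c * g ≤⟨ +-mono-≤ one rest ⟩
        2 * k ^ suc m * b + (S m (2 + d) * b + (S m d * b + κ * (S m (suc d) * b)))
          ≡⟨ lem₂ (2 * k ^ suc m) (S m (2 + d)) (S m d) κ (S m (suc d)) b ⟩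
        S (suc m) (suc d) * b ∎
        where
        open ≤-Reasoning
        g = ∣ gap i j (suc d) (pwⁿ (suc m) φ) l ∣
        ψ = pwⁿ m φ
        x y : Vec ℕ k
        x = incⁿ (suc d) i l
        y = incⁿ (suc d) j l
        p : Fin κ → Fin k
        p t = punchIn i (punchIn (punchOut i≢j) t)
        lem₁ : ∀ m c g → (1 + m) * c * g ≡ c * g + m * c * g
        lem₁ = NatSolver.solve-∀
        lem₂ : ∀ a s t κ u b → a * b + (s * b + (t * b + κ * (u * b)))
               ≡ (a + (s + (t + κ * u))) * b
        lem₂ = NatSolver.solve-∀
        one : c * g ≤ 2 * k ^ suc m * b
        one = begin
          c * g ≤⟨ *-monoʳ-≤ c (ℤ.∣i-j∣≤∣i∣+∣j∣ (pwⁿ (suc m) φ x) (pwⁿ (suc m) φ y)) ⟩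
          c * (∣ pwⁿ (suc m) φ x ∣ + ∣ pwⁿ (suc m) φ y ∣) ≡⟨ *-distribˡ-+ c ∣ pwⁿ (suc m) φ x ∣ _ ⟩
          c * ∣ pwⁿ (suc m) φ x ∣ + c * ∣ pwⁿ (suc m) φ y ∣
            ≤⟨ +-mono-≤ (pwⁿ-bound (suc m) φ c b h x) (pwⁿ-bound (suc m) φ c b h y) ⟩
          k ^ suc m * b + k ^ suc m * b ≡⟨ dbl (k ^ suc m) b ⟩
          2 * k ^ suc m * b ∎
          where
          dbl : ∀ p b → p * b + p * b ≡ 2 * p * b
          dbl = NatSolver.solve-∀
        rest : m * c * g ≤ S m (2 + d) * b + (S m d * b + κ * (S m (suc d) * b))
        rest = begin
          m * c * g
            ≡⟨ cong (λ z → m * c * ∣ z ∣) (gap-pw i≢j d ψ l) ⟩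
          m * c * ∣ G₁ ℤ.+ (G₂ ℤ.+ sum G₃) ∣
            ≤⟨ *-monoʳ-≤ (m * c) (≤-trans (ℤ.∣i+j∣≤∣i∣+∣j∣ G₁ _) (+-monoʳ-≤ ∣ G₁ ∣ (ℤ.∣i+j∣≤∣i∣+∣j∣ G₂ _))) ⟩
          m * c * (∣ G₁ ∣ + (∣ G₂ ∣ + ∣ sum G₃ ∣))
            ≡⟨ trans (*-distribˡ-+ (m * c) ∣ G₁ ∣ _) (cong (m * c * ∣ G₁ ∣ +_) (*-distribˡ-+ (m * c) ∣ G₂ ∣ _)) ⟩
          m * c * ∣ G₁ ∣ + (m * c * ∣ G₂ ∣ + m * c * ∣ sum G₃ ∣)
            ≤⟨ +-mono-≤ (gap-bound m φ c b h (2 + d) l) (+-mono-≤ (gap-bound m φ c b h d (inc i (inc j l)))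
                 (sum-bound G₃ (m * c) _ (λ t → gap-bound m φ c b h (suc d) (inc (p t) l)))) ⟩
          S m (2 + d) * b + (S m d * b + κ * (S m (suc d) * b)) ∎
          where
          G₁ = gap i j (2 + d) ψ l
          G₂ = gap i j d ψ (inc i (inc j l))
          G₃ : Fin κ → ℤ
          G₃ t = gap i j (suc d) ψ (inc (p t) l)

      -- Distance 1 and barrier s in `S-bound`: the two contributions 2m/s and k s balance at m =
      -- s², where both have order s.
      dif-pwⁿ-bound : ∀ s (φ : Fun k) c b → (∀ l → c * ∣ φ l ∣ ≤ b) →
                  ∀ l → s * c * ∣ dif i j (pwⁿ (s * s) φ) l ∣ ≤ (2 + k) * k ^ (s * s) * b
      dif-pwⁿ-bound zero φ c b h l = z≤n
      dif-pwⁿ-bound (suc s′) φ c b h l = *-cancelˡ-≤ (s * s) (begin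
        s * s * (s * c * g) ≡⟨ lem₁ s c g ⟩
        s * (m * c * g) ≤⟨ *-monoʳ-≤ s (gap-bound m φ c b h 1 l) ⟩
        s * (S m 1 * b) ≡⟨ sym (*-assoc s (S m 1) b) ⟩
        s * S m 1 * b ≤⟨ *-monoˡ-≤ b (S-bound m 1 s′) ⟩
        k ^ m * (2 * m * 1 + k * s * (1 * s′)) * b
          ≤⟨ *-monoˡ-≤ b (*-monoʳ-≤ (k ^ m) (+-monoʳ-≤ (2 * m * 1)
               (*-monoʳ-≤ (k * s) (≤-trans (≤-reflexive (*-identityˡ s′)) (n≤1+n s′))))) ⟩
        k ^ m * (2 * m * 1 + k * s * s) * b ≡⟨ lem₂ (k ^ m) s k b ⟩
        s * s * ((2 + k) * k ^ m * b) ∎)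
        where
        open ≤-Reasoning
        s = suc s′
        m = s * s
        g = ∣ dif i j (pwⁿ m φ) l ∣
        lem₁ : ∀ s c g → s * s * (s * c * g) ≡ s * (s * s * c * g)
        lem₁ = NatSolver.solve-∀
        lem₂ : ∀ p s k b → p * (2 * (s * s) * 1 + k * s * s) * b ≡ s * s * ((2 + k) * p * b)
        lem₂ = NatSolver.solve-∀

    -- The operators commute, so they can be regrouped to give every difference s² steps of its own,
    -- and the gains 1/s multiply. The r leftover steps only contribute k^r.
    difs-pwⁿ-bound : ∀ s (L : List (Fin k × Fin k)) → All (uncurry _≢_) L → ∀ r (φ : Fun k) c b →
      (∀ l → c * ∣ φ l ∣ ≤ b) → ∀ l →
      s ^ length L * c * ∣ difs L (pwⁿ (r + length L * (s * s)) φ) l ∣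
        ≤ (2 + k) ^ length L * k ^ (r + length L * (s * s)) * b
    difs-pwⁿ-bound s [] [] r φ c b h l = begin
      1 * c * ∣ pwⁿ (r + 0) φ l ∣ ≡⟨ cong (_* _) (*-identityˡ c) ⟩
      c * ∣ pwⁿ (r + 0) φ l ∣ ≤⟨ pwⁿ-bound (r + 0) φ c b h l ⟩
      k ^ (r + 0) * b ≡⟨ cong (_* b) (sym (*-identityˡ (k ^ (r + 0)))) ⟩
      1 * k ^ (r + 0) * b ∎
      where open ≤-Reasoning
    difs-pwⁿ-bound s ((i , j) ∷ L) (i≢j ∷ L≢) r φ c b h l = begin
      s * s ^ n * c * ∣ difs L (dif i j (pwⁿ N φ)) l ∣
        ≡⟨ cong₂ (λ x y → x * ∣ y ∣) (lem₁ s (s ^ n) c) (difs-cong L eq l) ⟩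
      s ^ n * (s * c) * ∣ difs L (pwⁿ (r + n * q) φ′) l ∣
        ≤⟨ difs-pwⁿ-bound s L L≢ r φ′ (s * c) _ (dif-pwⁿ-bound i≢j s φ c b h) l ⟩
      (2 + k) ^ n * k ^ (r + n * q) * ((2 + k) * k ^ q * b)
        ≡⟨ lem₂ ((2 + k) ^ n) (k ^ (r + n * q)) (2 + k) (k ^ q) b ⟩
      (2 + k) * (2 + k) ^ n * (k ^ (r + n * q) * k ^ q) * b
        ≡⟨ cong (λ z → (2 + k) * (2 + k) ^ n * z * b) (trans (sym (^-distribˡ-+-* k (r + n * q) q)) (cong (k ^_) (sym N≡))) ⟩
      (2 + k) * (2 + k) ^ n * k ^ N * b ∎
      where
      open ≤-Reasoning
      n = length L
      q = s * s
      N = r + (q + n * q)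
      φ′ = dif i j (pwⁿ q φ)
      N≡ : N ≡ r + n * q + q
      N≡ = trans (cong (r +_) (+-comm q (n * q))) (sym (+-assoc r (n * q) q))
      eq : dif i j (pwⁿ N φ) ≗ pwⁿ (r + n * q) φ′
      eq l = trans (cong (λ f → dif i j f l) (trans (cong (λ z → pwⁿ z φ) N≡) (pwⁿ-+ (r + n * q) q φ)))
                   (dif-pwⁿ (r + n * q) i j (pwⁿ q φ) l)
      lem₁ : ∀ s p c → s * p * c ≡ p * (s * c)
      lem₁ = NatSolver.solve-∀
      lem₂ : ∀ a x b y c → a * x * (b * y * c) ≡ b * a * (x * y) * c
      lem₂ = NatSolver.solve-∀

-- Antisymmetry of the Vandermonde product and reflection in one wall

module Antisymmetry where
  open import Data.Nat as ℕ using (_<ᵇ_; _≡ᵇ_)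
  import Data.Nat.Properties as ℕ
  open import Data.Integer as ℤ using (ℤ; +_; _+_; _-_; -_; 0ℤ)
  import Data.Integer.Properties as ℤ
  open import Data.Bool using (T)
  open import Data.Bool.Properties using (T-≡)
  open import Data.Fin using (zero; suc)
  open import Data.Fin.Permutation using (Permutation′; permutation)
  open import Data.Vec using ([]; _∷_; replicate)
  open import Data.List using ([]; _∷_; map; _++_)
  open import Data.List.Properties using (map-++; map-∘; length-map; ++-assoc)
  open import Data.List.Membership.Propositional using (_∈_)
  open import Data.List.Membership.Propositional.Properties using (∈-map⁺)
  open import Data.List.Relation.Unary.Any using (here; there)
  open import Data.List.Relation.Binary.Permutation.Propositional as ↭ using (_↭_; ↭-trans; ↭-reflexive; prep; swap)
  open import Data.List.Relation.Binary.Permutation.Propositional.Properties using (map⁺; ++⁺; ++⁺ˡ; ++⁺ʳ; shift; ++-comm)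
  open import Function using (_∋_)
  open ShiftOperators

  fins : ∀ k → List (Fin k)
  fins zero    = []
  fins (suc k) = zero ∷ map suc (fins k)

  fins-complete : ∀ {k} (i : Fin k) → i ∈ fins k
  fins-complete zero    = here refl
  fins-complete (suc i) = there (∈-map⁺ suc (fins-complete i))

  length-fins : ∀ k → length (fins k) ≡ k
  length-fins zero    = refl
  length-fins (suc k) = cong suc (trans (length-map suc (fins k)) (length-fins k))

  both : ∀ {A B : Set} → (A → B) → A × A → B × B
  both f (a , b) = f a , f b

  pairs : ∀ k → List (Fin k × Fin k)
  pairs zero    = []
  pairs (suc k) = map (λ j → zero , suc j) (fins k) ++ map (both suc) (pairs k)

  sw : ∀ {n} → Fin n → Vec ℕ (suc n) → Vec ℕ (suc n)
  sw zero    (a ∷ b ∷ l) = b ∷ a ∷ l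
  sw (suc i) (a ∷ l)     = a ∷ sw i l

  sw-invol : ∀ {n} (i : Fin n) l → sw i (sw i l) ≡ l
  sw-invol zero    (a ∷ b ∷ l) = refl
  sw-invol (suc i) (a ∷ l)     = cong (a ∷_) (sw-invol i l)

  τ : ∀ {n} → Fin n → Fin (suc n) → Fin (suc n)
  τ zero    zero          = suc zero
  τ zero    (suc zero)    = zero
  τ zero    (suc (suc j)) = suc (suc j)
  τ (suc i) zero          = zero
  τ (suc i) (suc j)       = suc (τ i j)

  τ-invol : ∀ {n} (i : Fin n) j → τ i (τ i j) ≡ j
  τ-invol zero    zero          = refl
  τ-invol zero    (suc zero)    = refl
  τ-invol zero    (suc (suc j)) = refl
  τ-invol (suc i) zero          = refl
  τ-invol (suc i) (suc j)       = cong suc (τ-invol i j)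

  sw-inc : ∀ {n} (i : Fin n) t l → sw i (inc t l) ≡ inc (τ i t) (sw i l)
  sw-inc zero    zero          (a ∷ b ∷ l) = refl
  sw-inc zero    (suc zero)    (a ∷ b ∷ l) = refl
  sw-inc zero    (suc (suc t)) (a ∷ b ∷ l) = refl
  sw-inc (suc i) zero          (a ∷ l)     = refl
  sw-inc (suc i) (suc t)       (a ∷ l)     = cong (a ∷_) (sw-inc i t l)

  τ-perm : ∀ {n} → Fin n → Permutation′ (suc n)
  τ-perm i = permutation (τ i) (τ i) (τ-invol i) (τ-invol i)

  pw-sw : ∀ {n} (i : Fin n) (φ : Fun (suc n)) → pw (φ ∘ sw i) ≗ pw φ ∘ sw i
  pw-sw i φ l = trans (sum-cong-≗ λ t → cong φ (sw-inc i t l))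
    (sym (sum-permute (λ t → φ (inc t (sw i l))) (τ-perm i)))

  pwⁿ-sw : ∀ {n} m (i : Fin n) (φ : Fun (suc n)) → pwⁿ m (φ ∘ sw i) ≗ pwⁿ m φ ∘ sw i
  pwⁿ-sw zero    i φ l = refl
  pwⁿ-sw (suc m) i φ l = trans (pw-cong (pwⁿ-sw m i φ) l) (pw-sw i (pwⁿ m φ) l)

  difs-sw : ∀ {n} (i : Fin n) L (φ : Fun (suc n)) → difs L (φ ∘ sw i) ≗ difs (map (both (τ i)) L) φ ∘ sw i
  difs-sw i []            φ l = refl
  difs-sw i ((a , b) ∷ L) φ l = trans
    (difs-cong L (λ l′ → cong₂ _-_ (cong φ (sw-inc i a l′)) (cong φ (sw-inc i b l′))) l)
    (difs-sw i L (dif (τ i a) (τ i b) φ) l)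

  dif-comm : ∀ {k} (a b c d : Fin k) φ → dif a b (dif c d φ) ≗ dif c d (dif a b φ)
  dif-comm a b c d φ l
    rewrite inc-comm a c l | inc-comm a d l | inc-comm b c l | inc-comm b d l =
    lem (φ (inc c (inc a l))) (φ (inc d (inc a l))) (φ (inc c (inc b l))) (φ (inc d (inc b l)))
    where
    lem : ∀ x y z w → (x - y) - (z - w) ≡ (x - z) - (y - w)
    lem = solve-∀

  difs-↭ : ∀ {k} {L L′ : List (Fin k × Fin k)} → L ↭ L′ → ∀ φ → difs L φ ≗ difs L′ φ
  difs-↭ ↭.refl φ l = refl
  difs-↭ (prep (a , b) p) φ l = difs-↭ p (dif a b φ) l
  difs-↭ {L = _ ∷ _ ∷ L} (swap (a , b) (c , d) p) φ l =
    trans (difs-cong L (dif-comm c d a b φ) l) (difs-↭ p (dif a b (dif c d φ)) l)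
  difs-↭ (↭.trans p q) φ l = trans (difs-↭ p φ l) (difs-↭ q φ l)

  difs-neg : ∀ {k} (L : List (Fin k × Fin k)) φ → difs L (λ l → - φ l) ≗ λ l → - difs L φ l
  difs-neg []            φ l = refl
  difs-neg ((a , b) ∷ L) φ l = trans (difs-cong L (λ l′ → lem (φ (inc a l′)) (φ (inc b l′))) l) (difs-neg L (dif a b φ) l)
    where
    lem : ∀ x y → (- x) - (- y) ≡ - (x - y)
    lem = solve-∀

  difs-flip : ∀ {k} a b (L : List (Fin k × Fin k)) φ → difs ((b , a) ∷ L) φ ≗ λ l → - difs ((a , b) ∷ L) φ l
  difs-flip a b L φ l = trans (difs-cong L (λ l′ → lem (φ (inc a l′)) (φ (inc b l′))) l) (difs-neg L (dif a b φ) l)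
    where
    lem : ∀ x y → y - x ≡ - (x - y)
    lem = solve-∀

  map-τ-fins : ∀ {n} (i : Fin n) → map (τ i) (fins (suc n)) ↭ fins (suc n)
  map-τ-fins {suc n} zero = swap _ _ (↭-reflexive
    (trans (sym (map-∘ (map suc (fins n)))) (trans (sym (map-∘ (fins n))) (map-∘ (fins n)))))
  map-τ-fins {suc n} (suc i) = prep zero (↭-trans (↭-reflexive
    (trans (sym (map-∘ (fins (suc n)))) (map-∘ (fins (suc n))))) (map⁺ suc (map-τ-fins i)))

  -- A simple transposition permutes the pairs a < b, except that one of them is reversed.
  record Reverses {n} (i : Fin n) : Set where
    field
      a b    : Fin (suc n)
      rest   : List (Fin (suc n) × Fin (suc n))
      before : pairs (suc n) ↭ (a , b) ∷ rest
      after  : map (both (τ i)) (pairs (suc n)) ↭ (b , a) ∷ rest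

  reverses : ∀ {n} (i : Fin n) → Reverses i
  reverses {suc n} zero = record
    -- `A` holds the pairs (0 , j) and `B` the pairs (1 , j) with j ≥ 2. The transposition exchanges
    -- these two blocks, fixes `C` and reverses (0 , 1).
    { a = zero ; b = suc zero ; rest = A ++ (B ++ C)
    ; before = prep (zero , suc zero) (++⁺ˡ A (↭-reflexive (map-++ (both suc) (map (λ j → zero , suc j) (fins n)) _)))
    ; after = prep (suc zero , zero) (↭-trans (↭-reflexive e)
        (↭-trans (↭-reflexive (sym (++-assoc B A C))) (↭-trans (++⁺ʳ C (++-comm B A)) (↭-reflexive (++-assoc A B C)))))
    }
    where
    A B C : List (Fin (2 ℕ.+ n) × Fin (2 ℕ.+ n))
    A = map (λ j → zero , suc j) (map suc (fins n))
    B = map (both suc) (map (λ j → zero , suc j) (fins n))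
    C = map (both suc) (map (both suc) (pairs n))
    f = both (τ {suc n} zero)
    A→B : map f A ≡ B
    A→B = trans (sym (map-∘ (map suc (fins n)))) (trans (sym (map-∘ (fins n))) (map-∘ (fins n)))
    B→A : map f B ≡ A
    B→A = trans (sym (map-∘ (map (λ j → zero , suc j) (fins n)))) (trans (sym (map-∘ (fins n))) (map-∘ (fins n)))
    C→C : map f C ≡ C
    C→C = trans (sym (map-∘ (map (both suc) (pairs n)))) (trans (sym (map-∘ (pairs n))) (map-∘ (pairs n)))
    e : map f (A ++ map (both suc) (map (λ j → zero , suc j) (fins n) ++ map (both suc) (pairs n))) ≡ B ++ (A ++ C)
    e = trans (cong (λ z → map f (A ++ z)) (map-++ (both suc) (map (λ j → zero , suc j) (fins n)) _))
       (trans (map-++ f A (B ++ C)) (cong₂ _++_ A→B (trans (map-++ f B C) (cong₂ _++_ B→A C→C))))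
  reverses {suc n} (suc i) = record
    { a = suc a ; b = suc b ; rest = X ++ map (both suc) rest
    ; before = ↭-trans (++⁺ˡ X (map⁺ (both suc) before)) (shift (suc a , suc b) X _)
    ; after = ↭-trans (↭-reflexive (map-++ f X (map (both suc) (pairs (suc n)))))
        (↭-trans (++⁺ e₁ (↭-trans (↭-reflexive e₂) (map⁺ (both suc) after))) (shift (suc b , suc a) X _))
    }
    where
    open Reverses (reverses i)
    f = both (τ (suc i))
    X = map (λ j → (Fin (2 ℕ.+ n) × Fin (2 ℕ.+ n)) ∋ (zero , suc j)) (fins (suc n))
    e₁ : map f X ↭ X
    e₁ = ↭-trans (↭-reflexive (trans (sym (map-∘ (fins (suc n)))) (map-∘ (fins (suc n))))) (map⁺ _ (map-τ-fins i))
    e₂ : map f (map (both suc) (pairs (suc n))) ≡ map (both suc) (map (both (τ i)) (pairs (suc n)))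
    e₂ = trans (sym (map-∘ (pairs (suc n)))) (map-∘ (pairs (suc n)))

  zeros : ∀ k → Vec ℕ k
  zeros k = replicate k 0

  sw-zeros : ∀ {n} (i : Fin n) → sw i (zeros (suc n)) ≡ zeros (suc n)
  sw-zeros {suc n} zero    = refl
  sw-zeros {suc n} (suc i) = cong (0 ∷_) (sw-zeros i)

  -- The value of the functional a p^n on φ, that is, the sum over l of φ(l) times the coefficient
  -- of x^l in a p^n.
  P : ∀ {k} → ℕ → Fun k → ℤ
  P {k} n φ = difs (pairs k) (pwⁿ n φ) (zeros k)

  P-cong : ∀ {k} n {φ ψ : Fun k} → φ ≗ ψ → P n φ ≡ P n ψ
  P-cong {k} n e = difs-cong (pairs k) (pwⁿ-cong n e) (zeros k)

  P-antisym : ∀ {k} n (i : Fin k) (φ : Fun (suc k)) → P n (φ ∘ sw i) ≡ - P n φ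
  P-antisym {k} n i φ = begin
    difs (pairs (suc k)) (pwⁿ n (φ ∘ sw i)) z           ≡⟨ difs-cong (pairs (suc k)) (pwⁿ-sw n i φ) z ⟩
    difs (pairs (suc k)) (pwⁿ n φ ∘ sw i) z             ≡⟨ difs-sw i (pairs (suc k)) (pwⁿ n φ) z ⟩
    difs (map (both (τ i)) (pairs (suc k))) (pwⁿ n φ) (sw i z)  ≡⟨ cong (difs (map (both (τ i)) (pairs (suc k))) (pwⁿ n φ)) (sw-zeros i) ⟩
    difs (map (both (τ i)) (pairs (suc k))) (pwⁿ n φ) z ≡⟨ difs-↭ after (pwⁿ n φ) z ⟩
    difs ((b , a) ∷ rest) (pwⁿ n φ) z                   ≡⟨ difs-flip a b rest (pwⁿ n φ) z ⟩
    - difs ((a , b) ∷ rest) (pwⁿ n φ) z                 ≡⟨ cong -_ (sym (difs-↭ before (pwⁿ n φ) z)) ⟩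
    - P n φ ∎
    where
    open ≡-Reasoning
    open Reverses (reverses i)
    z = zeros (suc k)

  difs-sub : ∀ {k} (L : List (Fin k × Fin k)) φ ψ → difs L (λ l → φ l - ψ l) ≗ λ l → difs L φ l - difs L ψ l
  difs-sub []            φ ψ l = refl
  difs-sub ((a , b) ∷ L) φ ψ l =
    trans (difs-cong L (λ l′ → lem (φ (inc a l′)) (ψ (inc a l′)) (φ (inc b l′)) (ψ (inc b l′))) l) (difs-sub L (dif a b φ) (dif a b ψ) l)
    where
    lem : ∀ x y z w → (x - y) - (z - w) ≡ (x - z) - (y - w)
    lem = solve-∀

  pwⁿ-sub : ∀ {k} n (φ ψ : Fun k) → pwⁿ n (λ l → φ l - ψ l) ≗ λ l → pwⁿ n φ l - pwⁿ n ψ l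
  pwⁿ-sub zero    φ ψ l = refl
  pwⁿ-sub (suc n) φ ψ l = trans (pw-cong (pwⁿ-sub n φ ψ) l)
    (sym (sum-sub (λ t → pwⁿ n φ (inc t l)) (λ t → pwⁿ n ψ (inc t l))))

  P-sub : ∀ {k} n (φ ψ : Fun k) → P n (λ l → φ l - ψ l) ≡ P n φ - P n ψ
  P-sub {k} n φ ψ = trans (difs-cong (pairs k) (pwⁿ-sub n φ ψ) (zeros k)) (difs-sub (pairs k) (pwⁿ n φ) (pwⁿ n ψ) (zeros k))

  self-neg⇒0 : ∀ x → x ≡ - x → x ≡ 0ℤ
  self-neg⇒0 (+ zero)  e = refl
  self-neg⇒0 (+ suc n) ()
  self-neg⇒0 (ℤ.-[1+ n ]) ()

  -- The difference φ - ψ is symmetric under the swap, hence `P` sends it to its own negative. This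
  -- is the form in which reflection is used: φ may be changed by anything symmetric about one wall.
  P-mod-symmetric : ∀ {k} n (i : Fin k) (φ ψ : Fun (suc k)) →
    (∀ l → φ (sw i l) - ψ (sw i l) ≡ φ l - ψ l) → P n φ ≡ P n ψ
  P-mod-symmetric n i φ ψ e = ℤ.i-j≡0⇒i≡j (P n φ) (P n ψ) (trans (sym (P-sub n φ ψ))
    (self-neg⇒0 _ (trans (sym (P-cong n e)) (P-antisym n i (λ l → φ l - ψ l)))))

  hi lo : ∀ {n} → Fin n → Vec ℕ (suc n) → ℕ
  hi zero    (a ∷ l) = a
  hi (suc i) (a ∷ l) = hi i l
  lo zero    (a ∷ b ∷ l) = b
  lo (suc i) (a ∷ l)     = lo i l

  hi-sw : ∀ {n} (i : Fin n) l → hi i (sw i l) ≡ lo i l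
  hi-sw zero    (a ∷ b ∷ l) = refl
  hi-sw (suc i) (a ∷ l)     = hi-sw i l

  lo-sw : ∀ {n} (i : Fin n) l → lo i (sw i l) ≡ hi i l
  lo-sw zero    (a ∷ b ∷ l) = refl
  lo-sw (suc i) (a ∷ l)     = lo-sw i l

  sw-fixed : ∀ {n} (i : Fin n) l → hi i l ≡ lo i l → sw i l ≡ l
  sw-fixed zero    (a ∷ b ∷ l) refl = refl
  sw-fixed (suc i) (a ∷ l)     e   = cong (a ∷_) (sw-fixed i l e)

  peel : ∀ {n} → Fin n → Fun (suc n) → Fun (suc n)
  peel i φ l = if hi i l ≡ᵇ lo i l then 0ℤ else φ l

  cmp : ∀ {n} → Fin n → Fun (suc n) → Fun (suc n)
  cmp i φ l = if lo i l <ᵇ hi i l then φ l - φ (sw i l) else 0ℤ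

  ≡ᵇ-comm : ∀ m n → (m ≡ᵇ n) ≡ (n ≡ᵇ m)
  ≡ᵇ-comm zero    zero    = refl
  ≡ᵇ-comm zero    (suc n) = refl
  ≡ᵇ-comm (suc m) zero    = refl
  ≡ᵇ-comm (suc m) (suc n) = ≡ᵇ-comm m n

  -- The two functions differ only on the wall, whose points are fixed by the swap.
  P-peel : ∀ {k} n (i : Fin k) φ → P n φ ≡ P n (peel i φ)
  P-peel n i φ = P-mod-symmetric n i φ (peel i φ) go
    where
    go : ∀ l → φ (sw i l) - peel i φ (sw i l) ≡ φ l - peel i φ l
    go l rewrite hi-sw i l | lo-sw i l | ≡ᵇ-comm (lo i l) (hi i l) with hi i l ≡ᵇ lo i l in eq
    ... | true  = cong (λ z → φ z - 0ℤ) (sw-fixed i l (ℕ.≡ᵇ⇒≡ _ _ (Equivalence.from T-≡ eq)))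
    ... | false = trans (ℤ.+-inverseʳ (φ (sw i l))) (sym (ℤ.+-inverseʳ (φ l)))

  -- One side of the wall is folded onto the other: at both points of a reflected pair φ - `cmp i φ`
  -- is the value of φ at the point with `hi` below `lo`.
  P-cmp : ∀ {k} n (i : Fin k) φ → P n φ ≡ P n (cmp i φ)
  P-cmp n i φ = P-mod-symmetric n i φ (cmp i φ) go
    where
    cancel : ∀ x y → x - (x - y) ≡ y - 0ℤ
    cancel = solve-∀
    go : ∀ l → φ (sw i l) - cmp i φ (sw i l) ≡ φ l - cmp i φ l
    go l rewrite hi-sw i l | lo-sw i l | sw-invol i l with lo i l <ᵇ hi i l in p | hi i l <ᵇ lo i l in q
    ... | true  | false = sym (trans (cancel (φ l) (φ (sw i l))) refl)
    ... | false | true  = cancel (φ (sw i l)) (φ l)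
    ... | true  | true  = ⊥-elim (ℕ.<-asym (ℕ.<ᵇ⇒< (lo i l) _ (Equivalence.from T-≡ p)) (ℕ.<ᵇ⇒< (hi i l) _ (Equivalence.from T-≡ q)))
    ... | false | false = cong (λ z → φ z - 0ℤ) (sw-fixed i l (ℕ.≤-antisym
        (ℕ.≮⇒≥ λ h → subst T p (ℕ.<⇒<ᵇ h)) (ℕ.≮⇒≥ λ h → subst T q (ℕ.<⇒<ᵇ h))))

-- Reflection principle and bounds by the number of chamber walks

module ChamberWalks where
  open import Data.Nat as ℕ using (_<ᵇ_; _≡ᵇ_; _<_; _≤_)
  import Data.Nat.Properties as ℕ
  open import Data.Integer as ℤ using (ℤ; +_; _+_; _*_; _-_; -_; ∣_∣; 0ℤ; 1ℤ)
  import Data.Integer.Properties as ℤ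
  open import Data.Bool.Properties using (T-≡)
  open import Data.Fin using (zero; suc)
  open import Data.Vec using ([]; _∷_)
  import Data.Vec as Vec
  open import Data.Vec.Relation.Unary.All using ([]; _∷_) renaming (All to AllV)
  open import Data.List using ([]; _∷_; map; _++_)
  open import Data.List.Membership.Propositional using (_∈_)
  open import Data.List.Relation.Unary.Any using (here; there)
  open import Relation.Nullary using (¬_)
  open ShiftOperators
  open Antisymmetry

  below : Maybe ℕ → ℕ → Bool
  below nothing  _ = true
  below (just a) b = b <ᵇ a

  -- The optional strict bound on the head lets the predicate, and the indicators built like it,
  -- pass to tails.
  dec : ∀ {k} → Maybe ℕ → Vec ℕ k → Bool
  dec m []      = true
  dec m (a ∷ l) = below m a ∧ dec (just a) l

  ∧-true : ∀ {x y} → x ∧ y ≡ true → x ≡ true × y ≡ true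
  ∧-true {true} {true} refl = refl , refl

  <ᵇ-true : ∀ {m n} → (m <ᵇ n) ≡ true → m < n
  <ᵇ-true {m} e = ℕ.<ᵇ⇒< m _ (Equivalence.from T-≡ e)

  true-<ᵇ : ∀ {m n} → m < n → (m <ᵇ n) ≡ true
  true-<ᵇ p = Equivalence.to T-≡ (ℕ.<⇒<ᵇ p)

  dec⇒lo<hi : ∀ {n} m (l : Vec ℕ (suc n)) → dec m l ≡ true → ∀ i → lo i l < hi i l
  dec⇒lo<hi m (a ∷ b ∷ l) e zero    = <ᵇ-true (proj₁ (∧-true (proj₂ (∧-true {below m a} e))))
  dec⇒lo<hi m (a ∷ b ∷ l) e (suc i) = dec⇒lo<hi (just a) (b ∷ l) (proj₂ (∧-true {below m a} e)) i

  lo<hi⇒dec : ∀ {n} (l : Vec ℕ (suc n)) → (∀ i → lo i l < hi i l) → dec nothing l ≡ true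
  lo<hi⇒dec (a ∷ [])    h = refl
  lo<hi⇒dec (a ∷ b ∷ l) h rewrite true-<ᵇ (h zero) = lo<hi⇒dec (b ∷ l) (h ∘ suc)

  dec-weaken : ∀ {k} m (l : Vec ℕ k) → dec m l ≡ true → dec nothing l ≡ true
  dec-weaken m []      e = refl
  dec-weaken m (a ∷ l) e = proj₂ (∧-true {below m a} e)

  dec-head : ∀ {k} a (l : Vec ℕ k) → dec (just a) l ≡ true → k ≤ a
  dec-head a []      e = z≤n
  dec-head a (b ∷ l) e = ℕ.≤-trans (s≤s (dec-head b l (proj₂ (∧-true {b <ᵇ a} e)))) (<ᵇ-true (proj₁ (∧-true e)))

  dec⇒below : ∀ {k} a (l : Vec ℕ k) → dec (just a) l ≡ true → AllV (_< a) l
  dec⇒below a []      e = []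
  dec⇒below a (b ∷ l) e = b<a ∷ go l (dec⇒below b l (proj₂ (∧-true {b <ᵇ a} e)))
    where
    b<a = <ᵇ-true {b} {a} (proj₁ (∧-true e))
    go : ∀ {k} (l : Vec ℕ k) → AllV (_< b) l → AllV (_< a) l
    go []      []      = []
    go (x ∷ l) (p ∷ q) = ℕ.<-trans p b<a ∷ go l q

  below⇒dec : ∀ {k} a (l : Vec ℕ k) → AllV (_< a) l → dec nothing l ≡ true → dec (just a) l ≡ true
  below⇒dec a []      h        e = refl
  below⇒dec a (b ∷ l) (b<a ∷ _) e rewrite true-<ᵇ b<a = e

  res : ∀ {k} → Fun k → Fun k
  res φ l = if dec nothing l then φ l else 0ℤ

  res-cong : ∀ {k} {φ ψ : Fun k} → φ ≗ ψ → res φ ≗ res ψ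
  res-cong e l = cong (λ z → if dec nothing l then z else 0ℤ) (e l)

  -- The transfer operator of the walk killed outside the chamber: a count of walks weighted by φ at
  -- the end point.
  V : ∀ {k} → ℕ → Fun k → Fun k
  V zero    φ = res φ
  V (suc n) φ = res (pw (V n φ))

  ρ : ∀ k → Vec ℕ k
  ρ zero    = []
  ρ (suc k) = k ∷ ρ k

  dec-ρ′ : ∀ k → dec (just k) (ρ k) ≡ true
  dec-ρ′ zero    = refl
  dec-ρ′ (suc k) rewrite true-<ᵇ (ℕ.n<1+n k) = dec-ρ′ k

  dec-ρ : ∀ k → dec nothing (ρ k) ≡ true
  dec-ρ k = dec-weaken (just k) (ρ k) (dec-ρ′ k)

  peels : ∀ {n} → List (Fin n) → Fun (suc n) → Fun (suc n)
  peels []      φ = φ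
  peels (i ∷ L) φ = peels L (peel i φ)

  P-peels : ∀ {k} n (L : List (Fin k)) φ → P n φ ≡ P n (peels L φ)
  P-peels n []      φ = refl
  P-peels n (i ∷ L) φ = trans (P-peel n i φ) (P-peels n L (peel i φ))

  peel-zero : ∀ {n} (i : Fin n) φ l → φ l ≡ 0ℤ → peel i φ l ≡ 0ℤ
  peel-zero i φ l e with hi i l ≡ᵇ lo i l
  ... | true  = refl
  ... | false = e

  peels-zero : ∀ {n} (L : List (Fin n)) φ l → φ l ≡ 0ℤ → peels L φ l ≡ 0ℤ
  peels-zero []      φ l e = e
  peels-zero (i ∷ L) φ l e = peels-zero L (peel i φ) l (peel-zero i φ l e)

  peels-equal : ∀ {n} {L : List (Fin n)} {i} → i ∈ L → ∀ φ l → hi i l ≡ lo i l → peels L φ l ≡ 0ℤ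
  peels-equal {L = i ∷ L} (here refl) φ l e = peels-zero L (peel i φ) l
    (cong (λ b → if b then 0ℤ else φ l) (Equivalence.to T-≡ (ℕ.≡⇒≡ᵇ _ _ e)))
  peels-equal {L = j ∷ L} (there p) φ l e = peels-equal p (peel j φ) l e

  peels-distinct : ∀ {n} (L : List (Fin n)) φ l → (∀ i → hi i l ≢ lo i l) → peels L φ l ≡ φ l
  peels-distinct []      φ l h = refl
  peels-distinct (i ∷ L) φ l h = trans (peels-distinct L (peel i φ) l h) go
    where
    go : peel i φ l ≡ φ l
    go with hi i l ≡ᵇ lo i l in eq
    ... | true  = ⊥-elim (h i (ℕ.≡ᵇ⇒≡ _ _ (Equivalence.from T-≡ eq)))
    ... | false = refl

  sum-zero : ∀ {n} (f : Fin n → ℤ) → (∀ t → f t ≡ 0ℤ) → sum f ≡ 0ℤ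
  sum-zero {zero}  f h = refl
  sum-zero {suc n} f h = cong₂ _+_ (h zero) (sum-zero (f ∘ suc) (h ∘ suc))

  lo-inc : ∀ {n} (i : Fin n) t l → lo i l ≤ lo i (inc t l)
  lo-inc zero    zero          (a ∷ b ∷ l) = ℕ.≤-refl
  lo-inc zero    (suc zero)    (a ∷ b ∷ l) = ℕ.n≤1+n b
  lo-inc zero    (suc (suc t)) (a ∷ b ∷ l) = ℕ.≤-refl
  lo-inc (suc i) zero          (a ∷ l)     = ℕ.≤-refl
  lo-inc (suc i) (suc t)       (a ∷ l)     = lo-inc i t l

  hi-inc : ∀ {n} (i : Fin n) t l → hi i (inc t l) ≤ suc (hi i l)
  hi-inc zero    zero    (a ∷ l) = ℕ.≤-refl
  hi-inc zero    (suc t) (a ∷ l) = ℕ.n≤1+n a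
  hi-inc (suc i) zero    (a ∷ l) = ℕ.n≤1+n (hi i l)
  hi-inc (suc i) (suc t) (a ∷ l) = hi-inc i t l

  any-equal : ∀ {n} (l : Vec ℕ (suc n)) → (∃ λ i → hi i l ≡ lo i l) ⊎ (∀ i → hi i l ≢ lo i l)
  any-equal (a ∷ []) = inj₂ λ ()
  any-equal (a ∷ b ∷ l) with a ℕ.≟ b | any-equal (b ∷ l)
  ... | yes e | _            = inj₁ (zero , e)
  ... | no _  | inj₁ (i , e) = inj₁ (suc i , e)
  ... | no ¬e | inj₂ h       = inj₂ λ { zero → ¬e ; (suc i) → h i }

  -- A point outside the chamber from which the chamber is reached in one step has two equal entries.
  peels-pw-res : ∀ {n} (φ : Fun (suc n)) → peels (fins n) (pw (res φ)) ≗ res (pw (res φ))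
  peels-pw-res {n} φ l with dec nothing l in eq
  ... | true  = peels-distinct (fins n) _ l λ i e → ℕ.<-irrefl (sym e) (dec⇒lo<hi nothing l eq i)
  ... | false with any-equal l
  ...   | inj₁ (i , e) = peels-equal (fins-complete i) _ l e
  ...   | inj₂ h = peels-zero (fins n) _ l (sum-zero (λ t → res φ (inc t l)) λ t →
            cong (λ b → if b then φ (inc t l) else 0ℤ) (out t))
    where
    out : ∀ t → dec nothing (inc t l) ≡ false
    out t with dec nothing (inc t l) in e
    ... | false = refl
    ... | true with () ← trans (sym eq) (lo<hi⇒dec l λ i → ℕ.≤∧≢⇒<
            (ℕ.≤-pred (ℕ.≤-trans (s≤s (lo-inc i t l)) (ℕ.≤-trans (dec⇒lo<hi nothing _ e i) (hi-inc i t l)))) (h i ∘ sym))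

  pwⁿ-suc : ∀ {k} n (φ : Fun k) → pwⁿ (suc n) φ ≡ pwⁿ n (pw φ)
  pwⁿ-suc zero    φ = refl
  pwⁿ-suc (suc n) φ = cong pw (pwⁿ-suc n φ)

  V-suc : ∀ {k} n (φ : Fun k) → V (suc n) φ ≡ V n (pw (res φ))
  V-suc zero    φ = refl
  V-suc (suc n) φ = cong (res ∘ pw) (V-suc n φ)

  difs-++ : ∀ {k} (L M : List (Fin k × Fin k)) φ → difs (L ++ M) φ ≡ difs M (difs L φ)
  difs-++ []            M φ = refl
  difs-++ ((a , b) ∷ L) M φ = difs-++ L M (dif a b φ)

  difs-tail : ∀ {k} (L : List (Fin k × Fin k)) (φ : Fun (suc k)) a t →
    difs (map (both suc) L) φ (a ∷ t) ≡ difs L (λ t → φ (a ∷ t)) t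
  difs-tail []            φ a t = refl
  difs-tail ((i , j) ∷ L) φ a t = difs-tail L (dif (suc i) (suc j) φ) a t

  -- Among the monomials of the product of the x₀ - x_j only the top power of x₀ survives against a
  -- function that vanishes for small heads.
  difs-head : ∀ {k} (J : List (Fin k)) (φ : Fun (suc k)) → (∀ a t → a < length J → φ (a ∷ t) ≡ 0ℤ) →
    ∀ t → difs (map (λ j → zero , suc j) J) φ (0 ∷ t) ≡ φ (length J ∷ t)
  difs-head []      φ h t = refl
  difs-head (j ∷ J) φ h t = trans
    (difs-head J (dif zero (suc j) φ) (λ a t a< → cong₂ _-_ (h (suc a) t (s≤s a<)) (h a (inc j t) (ℕ.m≤n⇒m≤1+n a<))) t)
    (trans (cong (λ z → φ (suc (length J) ∷ t) - z) (h (length J) (inc j t) ℕ.≤-refl)) (ℤ.+-identityʳ _))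

  -- The only monomial of the Vandermonde product with strictly decreasing exponents is x^ρ.
  difs-pairs-res : ∀ k (φ : Fun k) → difs (pairs k) (res φ) (zeros k) ≡ φ (ρ k)
  difs-pairs-res zero    φ = refl
  difs-pairs-res (suc k) φ = begin
    difs (map (λ j → zero , suc j) (fins k) ++ map (both suc) (pairs k)) (res φ) (0 ∷ zeros k)
      ≡⟨ cong (λ f → f (0 ∷ zeros k)) (difs-++ (map (λ j → zero , suc j) (fins k)) (map (both suc) (pairs k)) (res φ)) ⟩
    difs (map (both suc) (pairs k)) (difs (map (λ j → zero , suc j) (fins k)) (res φ)) (0 ∷ zeros k)
      ≡⟨ difs-tail (pairs k) _ 0 (zeros k) ⟩
    difs (pairs k) (λ t → difs (map (λ j → zero , suc j) (fins k)) (res φ) (0 ∷ t)) (zeros k)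
      ≡⟨ difs-cong (pairs k) (difs-head (fins k) (res φ) small) (zeros k) ⟩
    difs (pairs k) (λ t → res φ (length (fins k) ∷ t)) (zeros k)
      ≡⟨ difs-cong (pairs k) (λ t → cong (λ a → res φ (a ∷ t)) (length-fins k)) (zeros k) ⟩
    difs (pairs k) (λ t → res φ (k ∷ t)) (zeros k)
      ≡⟨ difs-cong (pairs k) tail (zeros k) ⟩
    difs (pairs k) (res (λ t → res φ (k ∷ t))) (zeros k)
      ≡⟨ difs-pairs-res k (λ t → res φ (k ∷ t)) ⟩
    res φ (k ∷ ρ k)
      ≡⟨ cong (λ b → if b then φ (k ∷ ρ k) else 0ℤ) (dec-ρ (suc k)) ⟩
    φ (k ∷ ρ k) ∎
    where
    open ≡-Reasoning
    small : ∀ a t → a < length (fins k) → res φ (a ∷ t) ≡ 0ℤ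
    small a t a< with dec (just a) t in e
    ... | false = refl
    ... | true  = ⊥-elim (ℕ.<⇒≱ (subst (a <_) (length-fins k) a<) (dec-head a t e))
    tail : (λ t → res φ (k ∷ t)) ≗ res (λ t → res φ (k ∷ t))
    tail t with dec nothing t in e | dec (just k) t in e′
    ... | true  | _     = refl
    ... | false | false = refl
    ... | false | true with () ← trans (sym e) (dec-weaken (just k) t e′)

  -- The walk is unrolled from its end. A point one step before the chamber that is not inside lies
  -- on a wall, and values on walls can be peeled off without changing `P`. This takes the place of
  -- a sign-reversing involution on paths.
  P-res : ∀ {k} n (φ : Fun (suc k)) → P n (res φ) ≡ V n φ (ρ (suc k))
  P-res {k} zero φ = trans (difs-pairs-res (suc k) φ) (sym (cong (λ b → if b then φ (k ∷ ρ k) else 0ℤ) (dec-ρ (suc k))))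
  P-res {k} (suc n) φ = begin
    P (suc n) (res φ)                     ≡⟨ cong (λ f → difs (pairs (suc k)) f (zeros (suc k))) (pwⁿ-suc n (res φ)) ⟩
    P n (pw (res φ))                      ≡⟨ P-peels n (fins k) (pw (res φ)) ⟩
    P n (peels (fins k) (pw (res φ)))     ≡⟨ P-cong n (peels-pw-res φ) ⟩
    P n (res (pw (res φ)))                ≡⟨ P-res n (pw (res φ)) ⟩
    V n (pw (res φ)) (ρ (suc k))          ≡⟨ cong (λ f → f (ρ (suc k))) (sym (V-suc n φ)) ⟩
    V (suc n) φ (ρ (suc k))               ∎
    where open ≡-Reasoning

  sum-mono : ∀ {n} (f g : Fin n → ℤ) → (∀ t → f t ℤ.≤ g t) → sum f ℤ.≤ sum g
  sum-mono {zero}  f g h = ℤ.≤-refl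
  sum-mono {suc n} f g h = ℤ.+-mono-≤ (h zero) (sum-mono (f ∘ suc) (g ∘ suc) (h ∘ suc))

  V-mono : ∀ {k} n {φ ψ : Fun k} → (∀ l → φ l ℤ.≤ ψ l) → ∀ l → V n φ l ℤ.≤ V n ψ l
  V-mono zero h l with dec nothing l
  ... | true  = h l
  ... | false = ℤ.≤-refl
  V-mono (suc n) h l with dec nothing l
  ... | true  = sum-mono _ _ (λ t → V-mono n h (inc t l))
  ... | false = ℤ.≤-refl

  V-zero : ∀ {k} n l → V {k} n (λ _ → 0ℤ) l ≡ 0ℤ
  V-zero zero l with dec nothing l
  ... | true  = refl
  ... | false = refl
  V-zero (suc n) l with dec nothing l
  ... | true  = sum-zero _ (λ t → V-zero n (inc t l))
  ... | false = refl

  one : ∀ {k} → Fun k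
  one _ = 1ℤ

  ∣sum∣ : ∀ {n} (f g : Fin n → ℤ) M → (∀ t → + ∣ f t ∣ ℤ.≤ + M * g t) → + ∣ sum f ∣ ℤ.≤ + M * sum g
  ∣sum∣ {zero}  f g M h = ℤ.≤-reflexive (sym (ℤ.*-zeroʳ (+ M)))
  ∣sum∣ {suc n} f g M h = ℤ.≤-trans (ℤ.+≤+ (ℤ.∣i+j∣≤∣i∣+∣j∣ (f zero) _))
    (ℤ.≤-trans (ℤ.+-mono-≤ (h zero) (∣sum∣ (f ∘ suc) (g ∘ suc) M (h ∘ suc)))
               (ℤ.≤-reflexive (sym (ℤ.*-distribˡ-+ (+ M) (g zero) _))))

  total-inc : ∀ {k} (t : Fin k) l → Vec.sum (inc t l) ≡ suc (Vec.sum l)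
  total-inc zero    (a ∷ l) = refl
  total-inc (suc t) (a ∷ l) = trans (cong (a ℕ.+_) (total-inc t l)) (ℕ.+-suc a (Vec.sum l))

  total-sw : ∀ {n} (i : Fin n) l → Vec.sum (sw i l) ≡ Vec.sum l
  total-sw zero (a ∷ b ∷ l) = trans (sym (ℕ.+-assoc b a _)) (trans (cong (ℕ._+ Vec.sum l) (ℕ.+-comm b a)) (ℕ.+-assoc a b _))
  total-sw (suc i) (a ∷ l)  = cong (a ℕ.+_) (total-sw i l)

  -- The hypothesis concerns only the level that n steps reach: characters are bounded level by
  -- level, and a function that vanishes on the level can be given M = 0.
  V-bound : ∀ {k} n (φ : Fun k) M l → (∀ l′ → Vec.sum l′ ≡ n ℕ.+ Vec.sum l → ∣ φ l′ ∣ ≤ M) →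
    + ∣ V n φ l ∣ ℤ.≤ + M * V n one l
  V-bound zero φ M l h with dec nothing l
  ... | true  = ℤ.≤-trans (ℤ.+≤+ (h l refl)) (ℤ.≤-reflexive (sym (ℤ.*-identityʳ (+ M))))
  ... | false = ℤ.≤-reflexive (sym (ℤ.*-zeroʳ (+ M)))
  V-bound (suc n) φ M l h with dec nothing l
  ... | true  = ∣sum∣ _ _ M (λ t → V-bound n φ M (inc t l) λ l′ e →
                  h l′ (trans e (trans (cong (n ℕ.+_) (total-inc t l)) (ℕ.+-suc n _))))
  ... | false = ℤ.≤-reflexive (sym (ℤ.*-zeroʳ (+ M)))

  -- Insertion sort as a sequence of adjacent comparators.
  cmps : ∀ {n} → List (Fin n) → Fun (suc n) → Fun (suc n)
  cmps []      φ = φ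
  cmps (i ∷ L) φ = cmps L (cmp i φ)

  net : ∀ n → List (Fin n)
  net zero    = []
  net (suc n) = map suc (net n) ++ fins (suc n)

  P-cmps : ∀ {k} n (L : List (Fin k)) φ → P n φ ≡ P n (cmps L φ)
  P-cmps n []      φ = refl
  P-cmps n (i ∷ L) φ = trans (P-cmp n i φ) (P-cmps n L (cmp i φ))

  cmps-++ : ∀ {n} (L M : List (Fin n)) φ → cmps (L ++ M) φ ≡ cmps M (cmps L φ)
  cmps-++ []      M φ = refl
  cmps-++ (i ∷ L) M φ = cmps-++ L M (cmp i φ)

  cmps-tail : ∀ {n} (L : List (Fin n)) (φ : Fun (2 ℕ.+ n)) a t →
    cmps (map suc L) φ (a ∷ t) ≡ cmps L (λ t → φ (a ∷ t)) t
  cmps-tail []      φ a t = refl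
  cmps-tail (i ∷ L) φ a t = cmps-tail L (cmp (suc i) φ) a t

  cmp-support : ∀ {n} (i : Fin n) φ (Q : Vec ℕ (suc n) → Set) → (∀ l → Q (sw i l) → Q l) →
    (∀ l → φ l ≡ 0ℤ ⊎ Q l) → ∀ l → cmp i φ l ≡ 0ℤ ⊎ Q l
  cmp-support i φ Q inv h l with lo i l <ᵇ hi i l
  ... | false = inj₁ refl
  ... | true with h l | h (sw i l)
  ...   | inj₂ q | _      = inj₂ q
  ...   | inj₁ _ | inj₂ q = inj₂ (inv l q)
  ...   | inj₁ e | inj₁ f = inj₁ (cong₂ _-_ e f)

  cmps-support : ∀ {n} (L : List (Fin n)) φ (Q : Vec ℕ (suc n) → Set) → (∀ i l → Q (sw i l) → Q l) →
    (∀ l → φ l ≡ 0ℤ ⊎ Q l) → ∀ l → cmps L φ l ≡ 0ℤ ⊎ Q l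
  cmps-support []      φ Q inv h = h
  cmps-support (i ∷ L) φ Q inv h = cmps-support L (cmp i φ) Q inv (cmp-support i φ Q (inv i) h)

  All-sw : ∀ {n} {p : ℕ → Set} (i : Fin n) l → AllV p (sw i l) → AllV p l
  All-sw zero    (a ∷ b ∷ l) (q ∷ p ∷ r) = p ∷ q ∷ r
  All-sw (suc i) (a ∷ l)     (p ∷ q)     = p ∷ All-sw i l q

  -- On the support, after the first comparator the head exceeds all other entries. The remaining
  -- comparators only permute the tail, so the head stays the maximum while the tail is sorted
  -- recursively.
  insertion : ∀ n (φ : Fun (suc n)) → (∀ a t → φ (a ∷ t) ≡ 0ℤ ⊎ dec nothing t ≡ true) →
    ∀ l → cmps (fins n) φ l ≡ 0ℤ ⊎ dec nothing l ≡ true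
  insertion zero    φ h (a ∷ []) = inj₂ refl
  insertion (suc n) φ h (a ∷ l) with
      insertion n (λ l → cmp zero φ (a ∷ l)) sorted l
    | cmps-support (fins n) (λ l → cmp zero φ (a ∷ l)) (AllV (_< a)) All-sw bounded l
    where
    sorted : ∀ b t → cmp zero φ (a ∷ b ∷ t) ≡ 0ℤ ⊎ dec nothing t ≡ true
    sorted b t with b <ᵇ a
    ... | false = inj₁ refl
    ... | true with h a (b ∷ t) | h b (a ∷ t)
    ...   | inj₂ e | _      = inj₂ (dec-weaken (just b) t e)
    ...   | inj₁ _ | inj₂ e = inj₂ (dec-weaken (just a) t e)
    ...   | inj₁ e | inj₁ f = inj₁ (cong₂ _-_ e f)
    widen : ∀ {k b} {t : Vec ℕ k} → b < a → AllV (_< b) t → AllV (_< a) t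
    widen b<a []      = []
    widen b<a (p ∷ q) = ℕ.<-trans p b<a ∷ widen b<a q
    bounded : ∀ l → cmp zero φ (a ∷ l) ≡ 0ℤ ⊎ AllV (_< a) l
    bounded (b ∷ t) with b <ᵇ a in eq
    ... | false = inj₁ refl
    ... | true with h a (b ∷ t) | h b (a ∷ t)
    ...   | inj₂ e | _      = inj₂ (<ᵇ-true eq ∷ widen (<ᵇ-true eq) (dec⇒below b t e))
    ...   | inj₁ _ | inj₂ e = inj₂ (<ᵇ-true eq ∷ dec⇒below a t e)
    ...   | inj₁ e | inj₁ f = inj₁ (cong₂ _-_ e f)
  ... | inj₁ e | _      = inj₁ (trans (cmps-tail (fins n) (cmp zero φ) a l) e)
  ... | inj₂ _ | inj₁ e = inj₁ (trans (cmps-tail (fins n) (cmp zero φ) a l) e)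
  ... | inj₂ d | inj₂ b = inj₂ (below⇒dec a l b d)

  sorting : ∀ n (φ : Fun (suc n)) l → cmps (net n) φ l ≡ 0ℤ ⊎ dec nothing l ≡ true
  sorting zero    φ (a ∷ []) = inj₂ refl
  sorting (suc n) φ l rewrite cmps-++ (map suc (net n)) (fins (suc n)) φ =
    insertion (suc n) (cmps (map suc (net n)) φ) sorted l
    where
    sorted : ∀ a t → cmps (map suc (net n)) φ (a ∷ t) ≡ 0ℤ ⊎ dec nothing t ≡ true
    sorted a t rewrite cmps-tail (net n) φ a t = sorting n (λ t → φ (a ∷ t)) t

  cmps-bound : ∀ {n} (L : List (Fin n)) φ M l → (∀ l′ → Vec.sum l′ ≡ Vec.sum l → ∣ φ l′ ∣ ≤ M) →
    ∣ cmps L φ l ∣ ≤ 2 ℕ.^ length L ℕ.* M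
  cmps-bound []      φ M l h = ℕ.≤-trans (h l refl) (ℕ.≤-reflexive (sym (ℕ.*-identityˡ M)))
  cmps-bound (i ∷ L) φ M l h = ℕ.≤-trans (cmps-bound L (cmp i φ) (2 ℕ.* M) l go)
    (ℕ.≤-reflexive (trans (sym (ℕ.*-assoc (2 ℕ.^ length L) 2 M)) (cong (ℕ._* M) (ℕ.*-comm (2 ℕ.^ length L) 2))))
    where
    go : ∀ l′ → Vec.sum l′ ≡ Vec.sum l → ∣ cmp i φ l′ ∣ ≤ 2 ℕ.* M
    go l′ e with lo i l′ <ᵇ hi i l′
    ... | false = z≤n
    ... | true  = ℕ.≤-trans (ℤ.∣i-j∣≤∣i∣+∣j∣ (φ l′) _)
      (ℕ.≤-trans (ℕ.+-mono-≤ (h l′ e) (h (sw i l′) (trans (total-sw i l′) e)))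
        (ℕ.≤-reflexive (cong (M ℕ.+_) (sym (ℕ.+-identityʳ M)))))

  P-supported : ∀ {k} n (φ : Fun (suc k)) → (∀ l → φ l ≡ 0ℤ ⊎ dec nothing l ≡ true) → P n φ ≡ V n φ (ρ (suc k))
  P-supported n φ h = trans (P-cong n go) (P-res n φ)
    where
    go : φ ≗ res φ
    go l with dec nothing l in d | h l
    ... | true  | _      = refl
    ... | false | inj₁ e = e

  -- The sorting network moves φ into the chamber at the cost of a factor 2 per comparator, and
  -- there `P` is a weighted count of walks. Read backwards, any bounded test function with a large
  -- value of `P` proves that there are many walks.
  P-bound : ∀ {k} n (φ : Fun (suc k)) M → (∀ l → Vec.sum l ≡ n ℕ.+ Vec.sum (ρ (suc k)) → ∣ φ l ∣ ≤ M) →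
    + ∣ P n φ ∣ ℤ.≤ + (2 ℕ.^ length (net k) ℕ.* M) * V n one (ρ (suc k))
  P-bound {k} n φ M h = subst (λ z → + ∣ z ∣ ℤ.≤ + (2 ℕ.^ length (net k) ℕ.* M) * V n one (ρ (suc k)))
    (sym (trans (P-cmps n (net k) φ) (P-supported n (cmps (net k) φ) (sorting k φ))))
    (V-bound n (cmps (net k) φ) _ (ρ (suc k)) λ l e → cmps-bound (net k) φ M l λ l′ e′ → h l′ (trans e′ e))

-- Flipping two adjacent parities

module ParityClasses where
  open import Data.Nat as ℕ using (_<ᵇ_; _<_; _≤_)
  import Data.Nat.Properties as ℕ
  open import Data.Integer as ℤ using (ℤ; +_; _+_; _*_; _-_; -_; ∣_∣; 0ℤ; 1ℤ)
  import Data.Integer.Properties as ℤ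
  open import Data.Bool using (_xor_)
  open import Data.Bool.Properties using (∧-zeroʳ; not-involutive)
  open import Data.Fin using (zero; suc; inject₁)
  open import Data.Vec using ([]; _∷_)
  open import Data.List using ([]; _∷_; map; _++_)
  open import Data.List.Relation.Unary.All using (All; []; _∷_)
  open import Data.List.Relation.Unary.All.Properties using (map⁺; ++⁺)
  open import Data.List.Relation.Unary.All using (universal)
  open import Data.Product using (uncurry)
  open ShiftOperators
  open Antisymmetry
  open ChamberWalks

  odd : ℕ → Bool
  odd zero    = false
  odd (suc n) = not (odd n)

  _==_ : Bool → Bool → Bool
  true  == x = x
  false == x = not x

  -- The shape of the chamber point l is l − ρ; its i-th entry has the parity of lᵢ + ρᵢ.
  ind : ∀ {k} → Maybe ℕ → Vec Bool k → Fun k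
  ind m []      []              = 1ℤ
  ind {suc k} m (x ∷ p) (a ∷ l) = if below m a ∧ (odd (a ℕ.+ k) == x) then ind (just a) p l else 0ℤ

  -- Zero where the entry cannot be lowered. With g = `lower (suc i) φ` both φ and `raise i φ` are
  -- shifts of g, so that their difference is a single `dif` of g.
  lower : ∀ {k} → Fin k → Fun k → Fun k
  lower zero    φ (zero ∷ l)  = 0ℤ
  lower zero    φ (suc a ∷ l) = φ (a ∷ l)
  lower (suc j) φ (a ∷ l)     = lower j (λ l → φ (a ∷ l)) l

  lower-inc : ∀ {k} (j : Fin k) φ l → lower j φ (inc j l) ≡ φ l
  lower-inc zero    φ (a ∷ l) = refl
  lower-inc (suc j) φ (a ∷ l) = lower-inc j (λ l → φ (a ∷ l)) l

  lower-bound : ∀ {k} (j : Fin k) φ → (∀ l → ∣ φ l ∣ ≤ 1) → ∀ l → ∣ lower j φ l ∣ ≤ 1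
  lower-bound zero    φ h (zero ∷ l)  = z≤n
  lower-bound zero    φ h (suc a ∷ l) = h (a ∷ l)
  lower-bound (suc j) φ h (a ∷ l)     = lower-bound j _ (λ l → h (a ∷ l)) l

  lower-zero : ∀ {k} (j : Fin k) l → lower j (λ _ → 0ℤ) l ≡ 0ℤ
  lower-zero zero    (zero ∷ l)  = refl
  lower-zero zero    (suc a ∷ l) = refl
  lower-zero (suc j) (a ∷ l)     = lower-zero j l

  lower-nonneg : ∀ {k} (j : Fin k) φ → (∀ l → 0ℤ ℤ.≤ φ l) → ∀ l → 0ℤ ℤ.≤ lower j φ l
  lower-nonneg zero    φ h (zero ∷ l)  = ℤ.≤-refl
  lower-nonneg zero    φ h (suc a ∷ l) = h (a ∷ l)
  lower-nonneg (suc j) φ h (a ∷ l)     = lower-nonneg j _ (λ l → h (a ∷ l)) l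

  ind-nonneg : ∀ {k} m (p : Vec Bool k) l → 0ℤ ℤ.≤ ind m p l
  ind-nonneg m []      []      = ℤ.+≤+ z≤n
  ind-nonneg {suc k} m (x ∷ p) (a ∷ l) with below m a ∧ (odd (a ℕ.+ k) == x)
  ... | true  = ind-nonneg (just a) p l
  ... | false = ℤ.≤-refl

  ind-bound : ∀ {k} m (p : Vec Bool k) l → ∣ ind m p l ∣ ≤ 1
  ind-bound m []      []      = s≤s z≤n
  ind-bound {suc k} m (x ∷ p) (a ∷ l) with below m a ∧ (odd (a ℕ.+ k) == x)
  ... | true  = ind-bound (just a) p l
  ... | false = z≤n

  ind-support : ∀ {k} m (p : Vec Bool k) l → ind m p l ≡ 0ℤ ⊎ dec m l ≡ true
  ind-support m []      []      = inj₂ refl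
  ind-support {suc k} m (x ∷ p) (a ∷ l) with below m a | odd (a ℕ.+ k) == x
  ... | false | _     = inj₁ refl
  ... | true  | false = inj₁ refl
  ... | true  | true  = ind-support (just a) p l

  below-suc : ∀ m a → below m (suc a) ≡ true → below m a ≡ true
  below-suc nothing  a e = refl
  below-suc (just b) a e = true-<ᵇ (ℕ.<-trans (ℕ.n<1+n a) (<ᵇ-true {suc a} {b} e))

  dec-widen : ∀ {k} b (l : Vec ℕ k) → dec (just b) l ≡ true → dec (just (suc b)) l ≡ true
  dec-widen b []      e = refl
  dec-widen b (c ∷ l) e with ∧-true {c <ᵇ b} e
  ... | c<b , d rewrite true-<ᵇ (ℕ.m<n⇒m<1+n (<ᵇ-true {c} {b} c<b)) = d

  ind-widen : ∀ {k} b (p : Vec Bool k) l → ind (just b) p l ℤ.≤ ind (just (suc b)) p l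
  ind-widen b []      []      = ℤ.≤-refl
  ind-widen {suc k} b (x ∷ p) (c ∷ l) with c <ᵇ b in e | odd (c ℕ.+ k) == x
  ... | true  | true  rewrite true-<ᵇ (ℕ.m<n⇒m<1+n (<ᵇ-true {c} {b} e)) = ℤ.≤-refl
  ... | true  | false rewrite ∧-zeroʳ (c <ᵇ suc b) = ℤ.≤-refl
  ... | false | y with (c <ᵇ suc b) ∧ y
  ...   | true  = ind-nonneg (just c) p l
  ...   | false = ℤ.≤-refl

  flip₂ : ∀ {n} → Fin n → Vec Bool (suc n) → Vec Bool (suc n)
  flip₂ zero    (x ∷ y ∷ p) = not x ∷ not y ∷ p
  flip₂ (suc i) (x ∷ p)     = x ∷ flip₂ i p

  ==-not : ∀ x y → (not x == y) ≡ (x == not y)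
  ==-not true  y = refl
  ==-not false y = sym (not-involutive y)

  -- For x in the chamber, x − eᵢ + eᵢ₊₁ either is in the chamber with two flipped parities or lies on or
  -- just behind the wall i, where the reflection makes its coefficient nonpositive.
  raise : ∀ {n} → Fin n → Fun (suc n) → Fun (suc n)
  raise i φ l = lower (suc i) φ (inc (inject₁ i) l)

  cmp-zero : ∀ {n} (i : Fin n) ψ l → ψ l ≡ 0ℤ → ψ (sw i l) ≡ 0ℤ → cmp i ψ l ≡ 0ℤ
  cmp-zero i ψ l e f with lo i l <ᵇ hi i l
  ... | false = refl
  ... | true  = cong₂ _-_ e f

  raise-zero : ∀ {n} (i : Fin n) l → raise i (λ _ → 0ℤ) l ≡ 0ℤ
  raise-zero i l = lower-zero (suc i) (inc (inject₁ i) l)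

  -- If (a + 1, b - 1, ...) is a point of the chamber with parities x and y, then (a, b, ...)
  -- respects the same bounds and has both parities flipped.
  raise-le : ∀ {k} m x y (p : Vec Bool k) a b l → (b <ᵇ a) ≡ true →
    raise zero (ind m (x ∷ y ∷ p)) (a ∷ b ∷ l) ℤ.≤ ind m (not x ∷ not y ∷ p) (a ∷ b ∷ l)
  raise-le m x y p a zero l h = ind-nonneg m (not x ∷ not y ∷ p) (a ∷ zero ∷ l)
  raise-le {k} m x y p a (suc b) l h with below m (suc a) in e
  ... | false = ind-nonneg m (not x ∷ not y ∷ p) (a ∷ suc b ∷ l)
  ... | true rewrite below-suc m a e | ==-not (odd (a ℕ.+ suc k)) x with odd (a ℕ.+ suc k) == not x
  ...   | false = ℤ.≤-refl
  ...   | true rewrite h | ==-not (odd (b ℕ.+ k)) (not y) | not-involutive y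
                     | true-<ᵇ (ℕ.m<n⇒m<1+n (ℕ.<-trans (ℕ.n<1+n b) (<ᵇ-true {suc b} {a} h)))
          with odd (b ℕ.+ k) == y
  ...     | false = ℤ.≤-refl
  ...     | true  = ind-widen b p l

  raise-support₁ : ∀ {k} m (p : Vec Bool (2 ℕ.+ k)) a b l → (b <ᵇ a) ≡ true →
    raise zero (ind m p) (a ∷ b ∷ l) ≡ 0ℤ ⊎ dec m (a ∷ b ∷ l) ≡ true
  raise-support₁ m p a zero l h = inj₁ refl
  raise-support₁ m p a (suc b) l h with ind-support m p (suc a ∷ b ∷ l)
  ... | inj₁ e = inj₁ e
  ... | inj₂ e with ∧-true {below m (suc a)} e
  ...   | e₁ , e₂ rewrite below-suc m a e₁ | h = inj₂ (dec-widen b l (proj₂ (∧-true {b <ᵇ suc a} e₂)))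

  -- That (b + 1, a - 1, ...) decreases although b < a forces a = b + 1, and then it is the point
  -- (a, b, ...) itself.
  raise-support₂ : ∀ {k} m (p : Vec Bool (2 ℕ.+ k)) a b l → (b <ᵇ a) ≡ true →
    raise zero (ind m p) (b ∷ a ∷ l) ≡ 0ℤ ⊎ dec m (a ∷ b ∷ l) ≡ true
  raise-support₂ m p (suc a) b l h with ind-support m p (suc b ∷ a ∷ l)
  ... | inj₁ e = inj₁ e
  ... | inj₂ e with ∧-true {below m (suc b)} e
  ...   | e₁ , e₂ with ∧-true {a <ᵇ suc b} e₂
  ...     | e₃ , e₄ with ℕ.≤-antisym (ℕ.≤-pred (<ᵇ-true {a} e₃)) (ℕ.≤-pred (<ᵇ-true {b} h))
  ...       | refl rewrite e₁ | h = inj₂ e₄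

  cmp-raise-support : ∀ {n} (i : Fin n) m p l → cmp i (raise i (ind m p)) l ≡ 0ℤ ⊎ dec m l ≡ true
  cmp-raise-support zero m p (a ∷ b ∷ l) with b <ᵇ a in e
  ... | false = inj₁ refl
  ... | true with raise-support₁ m p a b l e | raise-support₂ m p a b l e
  ...   | inj₂ d | _      = inj₂ (trans (cong (λ z → below m a ∧ (z ∧ dec (just b) l)) (sym e)) d)
  ...   | inj₁ _ | inj₂ d = inj₂ (trans (cong (λ z → below m a ∧ (z ∧ dec (just b) l)) (sym e)) d)
  ...   | inj₁ f | inj₁ g = inj₁ (cong₂ _-_ f g)
  cmp-raise-support {suc n} (suc i) m (x ∷ p) (a ∷ l) with below m a | odd (a ℕ.+ suc n) == x
  ... | false | _     = inj₁ (cmp-zero i (raise i (λ _ → 0ℤ)) l (raise-zero i l) (raise-zero i (sw i l)))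
  ... | true  | false = inj₁ (cmp-zero i (raise i (λ _ → 0ℤ)) l (raise-zero i l) (raise-zero i (sw i l)))
  ... | true  | true  = cmp-raise-support i (just a) p l

  cmp-raise-le : ∀ {n} (i : Fin n) m p l → cmp i (raise i (ind m p)) l ℤ.≤ ind m (flip₂ i p) l
  cmp-raise-le zero m (x ∷ y ∷ p) (a ∷ b ∷ l) = go (b <ᵇ a) refl
    where
    ψ = raise zero (ind m (x ∷ y ∷ p))
    go : ∀ z → (b <ᵇ a) ≡ z →
      (if z then ψ (a ∷ b ∷ l) - ψ (b ∷ a ∷ l) else 0ℤ) ℤ.≤ ind m (not x ∷ not y ∷ p) (a ∷ b ∷ l)
    go false e = ind-nonneg m (not x ∷ not y ∷ p) (a ∷ b ∷ l)
    -- The reflected term enters with a minus sign and is nonnegative, so it may be dropped.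
    go true  e = ℤ.≤-trans (ℤ.+-monoʳ-≤ (ψ (a ∷ b ∷ l))
        (ℤ.neg-mono-≤ (lower-nonneg (suc zero) _ (ind-nonneg m (x ∷ y ∷ p)) (inc zero (b ∷ a ∷ l)))))
      (ℤ.≤-trans (ℤ.≤-reflexive (ℤ.+-identityʳ _)) (raise-le m x y p a b l e))
  cmp-raise-le {suc n} (suc i) m (x ∷ p) (a ∷ l) with below m a ∧ (odd (a ℕ.+ suc n) == x)
  ... | false = ℤ.≤-reflexive (cmp-zero i (raise i (λ _ → 0ℤ)) l (raise-zero i l) (raise-zero i (sw i l)))
  ... | true  = cmp-raise-le i (just a) p l

  N : ∀ {k} → ℕ → Vec Bool (suc k) → ℤ
  N {k} n p = V n (ind nothing p) (ρ (suc k))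

  inject₁≢suc : ∀ {n} (i : Fin n) → inject₁ i ≢ suc i
  inject₁≢suc zero    ()
  inject₁≢suc (suc i) e = inject₁≢suc i (suc-inj e)
    where
    suc-inj : ∀ {n} {x y : Fin n} → suc x ≡ suc y → x ≡ y
    suc-inj refl = refl

  pairs-≢ : ∀ k → All (uncurry _≢_) (pairs k)
  pairs-≢ zero    = []
  pairs-≢ (suc k) = ++⁺ (map⁺ (universal (λ j ()) (fins k)))
    (map⁺ (Data.List.Relation.Unary.All.map (λ h → h ∘ suc-inj) (pairs-≢ k)))
    where
    suc-inj : ∀ {n} {x y : Fin n} → suc x ≡ suc y → x ≡ y
    suc-inj refl = refl

  module _ {k : ℕ} (n : ℕ) (i : Fin k) (p : Vec Bool (suc k)) where
    private
      φ = ind nothing p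
      g = lower (suc i) φ
      L : List (Fin (suc k) × Fin (suc k))
      L = (inject₁ i , suc i) ∷ pairs (suc k)

    N-flip : N n p ℤ.≤ N n (flip₂ i p) + + ∣ difs L (pwⁿ n g) (zeros (suc k)) ∣
    N-flip = begin
      N n p                                                   ≡⟨ sym (P-supported n φ (ind-support nothing p)) ⟩
      P n φ                                                   ≡⟨ lem (P n (raise i φ)) (P n φ) ⟩
      P n (raise i φ) - (P n (raise i φ) - P n φ)             ≡⟨ cong (λ z → P n (raise i φ) - z) e ⟩
      P n (raise i φ) - D                                     ≤⟨ ℤ.+-monoʳ-≤ (P n (raise i φ)) (neg≤abs D) ⟩
      P n (raise i φ) + + ∣ D ∣                                 ≡⟨ cong (_+ + ∣ D ∣) (P-cmp n i (raise i φ)) ⟩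
      P n (cmp i (raise i φ)) + + ∣ D ∣                         ≡⟨ cong (_+ + ∣ D ∣) (P-supported n _ (cmp-raise-support i nothing p)) ⟩
      V n (cmp i (raise i φ)) (ρ (suc k)) + + ∣ D ∣             ≤⟨ ℤ.+-monoˡ-≤ (+ ∣ D ∣) (V-mono n (cmp-raise-le i nothing p) (ρ (suc k))) ⟩
      N n (flip₂ i p) + + ∣ D ∣                                 ∎
      where
      open ℤ.≤-Reasoning
      D = difs L (pwⁿ n g) (zeros (suc k))
      lem : ∀ x y → y ≡ x - (x - y)
      lem = solve-∀
      neg≤abs : ∀ x → - x ℤ.≤ + ∣ x ∣
      neg≤abs (+ zero)      = ℤ.≤-refl
      neg≤abs (ℤ.+[1+ n ])  = ℤ.-≤+
      neg≤abs (ℤ.-[1+ n ])  = ℤ.≤-refl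
      e : P n (raise i φ) - P n φ ≡ D
      e = trans (sym (P-sub n (raise i φ) φ))
         (trans (P-cong n (λ l → cong (λ z → raise i φ l - z) (sym (lower-inc (suc i) φ l))))
           (difs-cong (pairs (suc k)) (λ l → sym (dif-pwⁿ n (inject₁ i) (suc i) g l)) (zeros (suc k))))

  -- With (1 + |pairs|) t² steps available, every factor of the Vandermonde product, and the one
  -- extra difference of N-flip, gains a factor 1/t.
  N-flip-bound : ∀ {κ} n t r → n ≡ r ℕ.+ suc (length (pairs (2 ℕ.+ κ))) ℕ.* (t ℕ.* t) → ∀ i (p : Vec Bool (2 ℕ.+ κ)) →
    ∃ λ E → t ℕ.^ suc (length (pairs (2 ℕ.+ κ))) ℕ.* E ≤ (4 ℕ.+ κ) ℕ.^ suc (length (pairs (2 ℕ.+ κ))) ℕ.* (2 ℕ.+ κ) ℕ.^ n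
      × N n p ℤ.≤ N n (flip₂ i p) + + E
  N-flip-bound {κ} n t r refl i p = ∣ difs L (pwⁿ n g) z ∣ , b , N-flip n i p
    where
    L : List (Fin (2 ℕ.+ κ) × Fin (2 ℕ.+ κ))
    L = (inject₁ i , suc i) ∷ pairs (2 ℕ.+ κ)
    g : Fun (2 ℕ.+ κ)
    g = lower (suc i) (ind nothing p)
    z = zeros (2 ℕ.+ κ)
    b : t ℕ.^ length L ℕ.* ∣ difs L (pwⁿ n g) z ∣ ≤ (4 ℕ.+ κ) ℕ.^ length L ℕ.* (2 ℕ.+ κ) ℕ.^ n
    b = subst₂ (λ x y → x ℕ.* ∣ difs L (pwⁿ n g) z ∣ ≤ y) (ℕ.*-identityʳ (t ℕ.^ length L)) (ℕ.*-identityʳ ((4 ℕ.+ κ) ℕ.^ length L ℕ.* (2 ℕ.+ κ) ℕ.^ n))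
      (difs-pwⁿ-bound κ t L (inject₁≢suc i ∷ pairs-≢ (2 ℕ.+ κ)) r g 1 1
        (λ l → ℕ.≤-trans (ℕ.≤-reflexive (ℕ.*-identityˡ _)) (lower-bound (suc i) (ind nothing p) (ind-bound nothing p) l)) z)

  -- Entries are cleared from the left by flips of neighbours, which gathers the parity of the whole
  -- vector in the last entry.
  canonical : ∀ {n} → Vec Bool (suc n) → Vec Bool (suc n)
  canonical (x ∷ [])    = x ∷ []
  canonical (x ∷ y ∷ p) = false ∷ canonical ((x xor y) ∷ p)

  -- At most one flip per adjacent pair is used. Applying the one-sided hypothesis before and after
  -- a flip controls the difference in both directions.
  near-canonical : ∀ {n} (F : Vec Bool (suc n) → ℤ) E → (∀ i p → F p ℤ.≤ F (flip₂ i p) + E) →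
    0ℤ ℤ.≤ E → ∀ p → F p ℤ.≤ F (canonical p) + + n * E × F (canonical p) ℤ.≤ F p + + n * E
  near-canonical F E h E≥0 (x ∷ []) = le , le
    where
    le : F (x ∷ []) ℤ.≤ F (x ∷ []) + 0ℤ * E
    le = ℤ.≤-reflexive (trans (sym (ℤ.+-identityʳ _)) (cong (_+_ (F (x ∷ []))) (sym (ℤ.*-zeroˡ E))))
  near-canonical {suc n} F E h E≥0 (false ∷ y ∷ p)
    with near-canonical (F ∘ (false ∷_)) E (λ i → h (suc i) ∘ (false ∷_)) E≥0 (y ∷ p)
  ... | u , v = ℤ.≤-trans u (mono (F (false ∷ canonical (y ∷ p)))) , ℤ.≤-trans v (mono (F (false ∷ y ∷ p)))
    where
    mono : ∀ x → x + + n * E ℤ.≤ x + + suc n * E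
    mono x = ℤ.+-monoʳ-≤ x (subst₂ ℤ._≤_ (ℤ.+-identityˡ _) (sym (ℤ.suc-* (+ n) E)) (ℤ.+-monoˡ-≤ (+ n * E) E≥0))
  near-canonical {suc n} F E h E≥0 (true ∷ y ∷ p)
    with near-canonical (F ∘ (false ∷_)) E (λ i → h (suc i) ∘ (false ∷_)) E≥0 (not y ∷ p)
  ... | u , v = ℤ.≤-trans (h zero (true ∷ y ∷ p)) (ℤ.≤-trans (ℤ.+-monoˡ-≤ E u) (ℤ.≤-reflexive (lem₁ (F (false ∷ canonical (not y ∷ p))))))
              , ℤ.≤-trans v (ℤ.≤-trans (ℤ.+-monoˡ-≤ (+ n * E) (subst (λ z → F (false ∷ not y ∷ p) ℤ.≤ F (true ∷ z ∷ p) + E) (not-involutive y) (h zero (false ∷ not y ∷ p))))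
                        (ℤ.≤-reflexive (lem₂ (F (true ∷ y ∷ p)))))
    where
    lem₁ : ∀ x → x + + n * E + E ≡ x + + suc n * E
    lem₁ x = trans (ring x (+ n * E) E) (cong (_+_ x) (sym (ℤ.suc-* (+ n) E)))
      where
      ring : ∀ x y z → x + y + z ≡ x + (z + y)
      ring = solve-∀
    lem₂ : ∀ x → x + E + + n * E ≡ x + + suc n * E
    lem₂ x = trans (ℤ.+-assoc x E _) (cong (_+_ x) (sym (ℤ.suc-* (+ n) E)))

-- Evaluation at Gaussian integers of equal norm

module CharacterBound where
  open import Data.Nat as ℕ using (_<_; _≤_)
  import Data.Nat.Properties as ℕ
  open import Data.Integer as ℤ using (ℤ; +_; _+_; _*_; _-_; -_; ∣_∣; 0ℤ; 1ℤ)
  import Data.Integer.Properties as ℤ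
  open import Data.Fin using (zero; suc; toℕ)
  open import Data.Fin.Properties using (toℕ<n; toℕ-injective)
  open import Data.Vec using ([]; _∷_)
  import Data.Vec as Vec
  open import Data.List using ([]; _∷_; map; _++_)
  open import Data.List.Properties using (length-map; length-++)
  open ShiftOperators
  open Antisymmetry
  open ChamberWalks

  -- Gaussian integers (real part , imaginary part).
  G : Set
  G = ℤ × ℤ

  infixl 7 _·_
  infixl 6 _⊖_
  _·_ _⊖_ : G → G → G
  (a , b) · (c , d) = a * c - b * d , a * d + b * c
  (a , b) ⊖ (c , d) = a - c , b - d

  oneG : G
  oneG = 1ℤ , 0ℤ

  infixr 8 _^G_
  _^G_ : G → ℕ → G
  z ^G zero  = oneG
  z ^G suc n = z · z ^G n

  nrm : G → ℕ
  nrm (a , b) = ∣ a ∣ ℕ.* ∣ a ∣ ℕ.+ ∣ b ∣ ℕ.* ∣ b ∣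

  sq : ∀ a → + (∣ a ∣ ℕ.* ∣ a ∣) ≡ a * a
  sq (+ zero)     = refl
  sq (ℤ.+[1+ n ]) = refl
  sq (ℤ.-[1+ n ]) = refl

  +nrm : ∀ a b → + nrm (a , b) ≡ a * a + b * b
  +nrm a b = trans (ℤ.pos-+ (∣ a ∣ ℕ.* ∣ a ∣) _) (cong₂ _+_ (sq a) (sq b))

  nrm-· : ∀ x y → nrm (x · y) ≡ nrm x ℕ.* nrm y
  nrm-· (a , b) (c , d) = ℤ.+-injective (begin
    + nrm ((a , b) · (c , d))                                          ≡⟨ +nrm (a * c - b * d) (a * d + b * c) ⟩
    (a * c - b * d) * (a * c - b * d) + (a * d + b * c) * (a * d + b * c) ≡⟨ lem a b c d ⟩
    (a * a + b * b) * (c * c + d * d)                                  ≡⟨ sym (cong₂ _*_ (+nrm a b) (+nrm c d)) ⟩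
    + nrm (a , b) * + nrm (c , d)                                      ≡⟨ sym (ℤ.pos-* (nrm (a , b)) _) ⟩
    + (nrm (a , b) ℕ.* nrm (c , d))                                    ∎)
    where
    open ≡-Reasoning
    lem : ∀ a b c d → (a * c - b * d) * (a * c - b * d) + (a * d + b * c) * (a * d + b * c) ≡ (a * a + b * b) * (c * c + d * d)
    lem = solve-∀

  nrm-^ : ∀ z n → nrm (z ^G n) ≡ nrm z ℕ.^ n
  nrm-^ z zero    = refl
  nrm-^ z (suc n) = trans (nrm-· z (z ^G n)) (cong (nrm z ℕ.*_) (nrm-^ z n))

  ·-assoc : ∀ x y z → (x · y) · z ≡ x · (y · z)
  ·-assoc (a , b) (c , d) (e , f) = cong₂ _,_ (lem₁ a b c d e f) (lem₂ a b c d e f)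
    where
    lem₁ : ∀ a b c d e f → (a * c - b * d) * e - (a * d + b * c) * f ≡ a * (c * e - d * f) - b * (c * f + d * e)
    lem₁ = solve-∀
    lem₂ : ∀ a b c d e f → (a * c - b * d) * f + (a * d + b * c) * e ≡ a * (c * f + d * e) + b * (c * e - d * f)
    lem₂ = solve-∀

  ·-comm : ∀ x y → x · y ≡ y · x
  ·-comm (a , b) (c , d) = cong₂ _,_ (lem₁ a b c d) (lem₂ a b c d)
    where
    lem₁ : ∀ a b c d → a * c - b * d ≡ c * a - d * b
    lem₁ = solve-∀
    lem₂ : ∀ a b c d → a * d + b * c ≡ c * b + d * a
    lem₂ = solve-∀

  ·-one : ∀ x → x · oneG ≡ x
  ·-one (a , b) = cong₂ _,_ (lem₁ a b) (lem₂ a b)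
    where
    lem₁ : ∀ a b → a * 1ℤ - b * 0ℤ ≡ a
    lem₁ = solve-∀
    lem₂ : ∀ a b → a * 0ℤ + b * 1ℤ ≡ b
    lem₂ = solve-∀

  mon : ∀ {k} → (Fin k → G) → Vec ℕ k → G
  mon z []      = oneG
  mon z (a ∷ l) = z zero ^G a · mon (z ∘ suc) l

  mon-inc : ∀ {k} (z : Fin k → G) t l → mon z (inc t l) ≡ z t · mon z l
  mon-inc z zero    (a ∷ l) = ·-assoc (z zero) (z zero ^G a) _
  mon-inc z (suc t) (a ∷ l) = begin
    x · mon (z ∘ suc) (inc t l)   ≡⟨ cong (x ·_) (mon-inc (z ∘ suc) t l) ⟩
    x · (y · m)                   ≡⟨ sym (·-assoc x y m) ⟩
    x · y · m                     ≡⟨ cong (_· m) (·-comm x y) ⟩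
    y · x · m                     ≡⟨ ·-assoc y x m ⟩
    y · (x · m)                   ∎
    where
    open ≡-Reasoning
    x = z zero ^G a
    y = z (suc t)
    m = mon (z ∘ suc) l

  mon-zeros : ∀ {k} (z : Fin k → G) → mon z (zeros k) ≡ oneG
  mon-zeros {zero}  z = refl
  mon-zeros {suc k} z = trans (cong (oneG ·_) (mon-zeros (z ∘ suc))) refl

  sum-linear : ∀ {n} A B (f g : Fin n → ℤ) → sum (λ t → A * f t + B * g t) ≡ A * sum f + B * sum g
  sum-linear {zero}  A B f g = sym (lem A B)
    where
    lem : ∀ A B → A * 0ℤ + B * 0ℤ ≡ 0ℤ
    lem = solve-∀
  sum-linear {suc n} A B f g = trans (cong (_+_ (A * f zero + B * g zero)) (sum-linear A B (f ∘ suc) (g ∘ suc)))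
    (lem A B (f zero) (g zero) (sum (f ∘ suc)) (sum (g ∘ suc)))
    where
    lem : ∀ A B x y s t → A * x + B * y + (A * s + B * t) ≡ A * (x + s) + B * (y + t)
    lem = solve-∀

  sumG : ∀ {k} → (Fin k → G) → G
  sumG z = sum (proj₁ ∘ z) , sum (proj₂ ∘ z)

  prodG : ∀ {k} → (Fin k → G) → List (Fin k × Fin k) → G
  prodG z []            = oneG
  prodG z ((a , b) ∷ L) = (z a ⊖ z b) · prodG z L

  module _ {k} (z : Fin k → G) where

    -- Test functions are integer valued, hence the real part. The free factor c closes the family
    -- under the shift operators, which act by multiplying c.
    R : G → Fun k
    R c l = proj₁ (c · mon z l)

    dif-R : ∀ a b c → dif a b (R c) ≗ R (c · (z a ⊖ z b))
    dif-R a b c l rewrite mon-inc z a l | mon-inc z b l = lem (z a) (z b) c (mon z l)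
      where
      ring : ∀ p q r s e f g h →
        (e * (p * g - q * h) - f * (p * h + q * g)) - (e * (r * g - s * h) - f * (r * h + s * g))
        ≡ (e * (p - r) - f * (q - s)) * g - (e * (q - s) + f * (p - r)) * h
      ring = solve-∀
      lem : ∀ x y c m → proj₁ (c · (x · m)) - proj₁ (c · (y · m)) ≡ proj₁ (c · (x ⊖ y) · m)
      lem (p , q) (r , s) (e , f) (g , h) = ring p q r s e f g h

    difs-R : ∀ L c → difs L (R c) ≗ R (c · prodG z L)
    difs-R [] c l = cong (λ w → R w l) (sym (·-one c))
    difs-R ((a , b) ∷ L) c l = trans (difs-cong L (dif-R a b c) l)
      (trans (difs-R L (c · (z a ⊖ z b)) l) (cong (λ w → R w l) (·-assoc c (z a ⊖ z b) (prodG z L))))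

    pw-R : ∀ c → pw (R c) ≗ R (c · sumG z)
    pw-R c l = trans (sum-cong-≗ λ t → trans (cong (λ w → proj₁ (c · w)) (mon-inc z t l)) (expand (z t)))
      (trans (sum-linear A B (proj₁ ∘ z) (proj₂ ∘ z)) (sym (collect (sumG z))))
      where
      m = mon z l
      A = proj₁ c * proj₁ m - proj₂ c * proj₂ m
      B = - (proj₁ c * proj₂ m + proj₂ c * proj₁ m)
      ring₁ : ∀ e f g h p q → e * (p * g - q * h) - f * (p * h + q * g) ≡ (e * g - f * h) * p + (- (e * h + f * g)) * q
      ring₁ = solve-∀
      ring₂ : ∀ e f g h p q → (e * p - f * q) * g - (e * q + f * p) * h ≡ (e * g - f * h) * p + (- (e * h + f * g)) * q
      ring₂ = solve-∀
      expand : ∀ x → proj₁ (c · (x · m)) ≡ A * proj₁ x + B * proj₂ x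
      expand (p , q) = ring₁ (proj₁ c) (proj₂ c) (proj₁ m) (proj₂ m) p q
      collect : ∀ x → proj₁ (c · x · m) ≡ A * proj₁ x + B * proj₂ x
      collect (p , q) = ring₂ (proj₁ c) (proj₂ c) (proj₁ m) (proj₂ m) p q

    pwⁿ-R : ∀ n c → pwⁿ n (R c) ≗ R (c · sumG z ^G n)
    pwⁿ-R zero    c l = cong (λ w → R w l) (sym (·-one c))
    pwⁿ-R (suc n) c l = trans (pw-cong (pwⁿ-R n c) l) (trans (pw-R (c · sumG z ^G n) l)
      (cong (λ w → R w l) (trans (·-assoc c (sumG z ^G n) (sumG z)) (cong (c ·_) (·-comm (sumG z ^G n) (sumG z))))))

    -- The value of the polynomial a p^n at the point z.
    W : ℕ → G
    W n = sumG z ^G n · prodG z (pairs k)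

    P-R : ∀ n c → P n (R c) ≡ proj₁ (c · W n)
    P-R n c = begin
      P n (R c)                                              ≡⟨ difs-cong (pairs k) (pwⁿ-R n c) (zeros k) ⟩
      difs (pairs k) (R (c · sumG z ^G n)) (zeros k)         ≡⟨ difs-R (pairs k) (c · sumG z ^G n) (zeros k) ⟩
      R (c · sumG z ^G n · prodG z (pairs k)) (zeros k)      ≡⟨ cong (λ w → proj₁ (c · sumG z ^G n · prodG z (pairs k) · w)) (mon-zeros z) ⟩
      proj₁ (c · sumG z ^G n · prodG z (pairs k) · oneG)     ≡⟨ cong proj₁ (·-one (c · sumG z ^G n · prodG z (pairs k))) ⟩
      proj₁ (c · sumG z ^G n · prodG z (pairs k))            ≡⟨ cong proj₁ (·-assoc c (sumG z ^G n) (prodG z (pairs k))) ⟩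
      proj₁ (c · W n)                                        ∎
      where open ≡-Reasoning

  *-^ : ∀ n a b → (a ℕ.* b) ℕ.^ n ≡ a ℕ.^ n ℕ.* b ℕ.^ n
  *-^ zero    a b = refl
  *-^ (suc n) a b = trans (cong (a ℕ.* b ℕ.*_) (*-^ n a b)) (lem a b (a ℕ.^ n) (b ℕ.^ n))
    where
    lem : ∀ a b x y → a ℕ.* b ℕ.* (x ℕ.* y) ≡ a ℕ.* x ℕ.* (b ℕ.* y)
    lem = NatSolver.solve-∀

  nrm-mon : ∀ {k} (z : Fin k → G) D → (∀ a → nrm (z a) ≡ D ℕ.* D) → ∀ l → nrm (mon z l) ≡ D ℕ.^ Vec.sum l ℕ.* D ℕ.^ Vec.sum l
  nrm-mon z D h [] = refl
  nrm-mon z D h (a ∷ l) = begin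
    nrm (z zero ^G a · mon (z ∘ suc) l)              ≡⟨ nrm-· (z zero ^G a) _ ⟩
    nrm (z zero ^G a) ℕ.* nrm (mon (z ∘ suc) l)      ≡⟨ cong₂ ℕ._*_ (trans (nrm-^ (z zero) a) (trans (cong (ℕ._^ a) (h zero)) (*-^ a D D))) (nrm-mon (z ∘ suc) D (h ∘ suc) l) ⟩
    D ℕ.^ a ℕ.* D ℕ.^ a ℕ.* (D ℕ.^ Vec.sum l ℕ.* D ℕ.^ Vec.sum l) ≡⟨ lem (D ℕ.^ a) (D ℕ.^ Vec.sum l) ⟩
    D ℕ.^ a ℕ.* D ℕ.^ Vec.sum l ℕ.* (D ℕ.^ a ℕ.* D ℕ.^ Vec.sum l) ≡⟨ cong₂ ℕ._*_ e e ⟩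
    D ℕ.^ (a ℕ.+ Vec.sum l) ℕ.* D ℕ.^ (a ℕ.+ Vec.sum l) ∎
    where
    open ≡-Reasoning
    e = sym (ℕ.^-distribˡ-+-* D a (Vec.sum l))
    lem : ∀ x y → x ℕ.* x ℕ.* (y ℕ.* y) ≡ x ℕ.* y ℕ.* (x ℕ.* y)
    lem = NatSolver.solve-∀

  sq-cancel-≤ : ∀ x y → x ℕ.* x ≤ y ℕ.* y → x ≤ y
  sq-cancel-≤ x y h with ℕ.≤-<-connex x y
  ... | inj₁ le = le
  ... | inj₂ lt = ⊥-elim (ℕ.<⇒≱ (ℕ.*-mono-< lt lt) h)

  R-bound : ∀ {k} (z : Fin k → G) D → (∀ a → nrm (z a) ≡ D ℕ.* D) → ∀ c → nrm c ≡ 1 → ∀ l → ∣ R z c l ∣ ≤ D ℕ.^ Vec.sum l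
  R-bound z D h c c≡1 l = sq-cancel-≤ _ _ (ℕ.≤-trans (ℕ.m≤m+n _ _) (ℕ.≤-reflexive
    (trans (nrm-· c (mon z l)) (trans (cong₂ ℕ._*_ c≡1 (nrm-mon z D h l)) (ℕ.*-identityˡ _)))))

  length-pairs : ∀ k → length (pairs k) ≡ Vec.sum (ρ k)
  length-pairs zero    = refl
  length-pairs (suc k) = trans (length-++ (map (λ j → zero , suc j) (fins k)))
    (cong₂ ℕ._+_ (trans (length-map _ (fins k)) (length-fins k)) (trans (length-map _ (pairs k)) (length-pairs k)))

  walks : ℕ → ℕ → ℕ
  walks k n = ∣ V n one (ρ k) ∣

  V-nonneg : ∀ {k} n l → 0ℤ ℤ.≤ V {k} n one l
  V-nonneg n l = subst (ℤ._≤ V n one l) (V-zero n l) (V-mono n {λ _ → 0ℤ} (λ _ → ℤ.+≤+ z≤n) l)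

  P-bound′ : ∀ {k} n (φ : Fun (suc k)) M → (∀ l → Vec.sum l ≡ n ℕ.+ Vec.sum (ρ (suc k)) → ∣ φ l ∣ ≤ M) →
    ∣ P n φ ∣ ≤ 2 ℕ.^ length (net k) ℕ.* M ℕ.* walks (suc k) n
  P-bound′ {k} n φ M h = ℤ.drop‿+≤+ (ℤ.≤-trans (P-bound n φ M h) (ℤ.≤-reflexive
    (trans (cong (+ (2 ℕ.^ length (net k) ℕ.* M) *_) (sym (ℤ.0≤i⇒+∣i∣≡i (V-nonneg n (ρ (suc k))))))
           (sym (ℤ.pos-* (2 ℕ.^ length (net k) ℕ.* M) (walks (suc k) n))))))

  -- The factors c = 1 and c = -i recover the real and the imaginary part of the value; each is
  -- bounded by `B`, which gives the two summands.
  W-bound : ∀ {k} (z : Fin (suc k) → G) D → (∀ a → nrm (z a) ≡ D ℕ.* D) → ∀ n →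
    let B = 2 ℕ.^ length (net k) ℕ.* D ℕ.^ (n ℕ.+ length (pairs (suc k))) ℕ.* walks (suc k) n in
    nrm (W z n) ≤ B ℕ.* B ℕ.+ B ℕ.* B
  W-bound {k} z D h n = ℕ.+-mono-≤ (ℕ.*-mono-≤ re re) (ℕ.*-mono-≤ im im)
    where
    B = 2 ℕ.^ length (net k) ℕ.* D ℕ.^ (n ℕ.+ length (pairs (suc k))) ℕ.* walks (suc k) n
    bound : ∀ c → nrm c ≡ 1 → ∣ proj₁ (c · W z n) ∣ ≤ B
    bound c e = subst (λ x → ∣ x ∣ ≤ B) (P-R z n c) (P-bound′ n (R z c) _ λ l e′ →
      subst (λ x → ∣ R z c l ∣ ≤ D ℕ.^ x) (trans e′ (cong (n ℕ.+_) (sym (length-pairs (suc k))))) (R-bound z D h c e l))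
    re : ∣ proj₁ (W z n) ∣ ≤ B
    re = subst (λ x → ∣ x ∣ ≤ B) (lem (proj₁ (W z n)) (proj₂ (W z n))) (bound oneG refl)
      where
      lem : ∀ x y → 1ℤ * x - 0ℤ * y ≡ x
      lem = solve-∀
    im : ∣ proj₂ (W z n) ∣ ≤ B
    im = subst (λ x → ∣ x ∣ ≤ B) (lem (proj₁ (W z n)) (proj₂ (W z n))) (bound (0ℤ , - 1ℤ) refl)
      where
      lem : ∀ x y → 0ℤ * x - (- 1ℤ) * y ≡ y
      lem = solve-∀

  -- The test character l ↦ Π z_a^{l_a}, with z_a = D (s + a i)/(s − a i): k distinct points of the
  -- circle of radius D, at mutual distance of order D/s.
  module Character (s : ℕ) where

    -- A common multiple of the s² + a² for a < k; scaling by it turns the points (s + a i)/(s - a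
    -- i) into Gaussian integers.
    D : ℕ → ℕ
    D zero    = 1
    D (suc k) = (s ℕ.* s ℕ.+ k ℕ.* k) ℕ.* D k

    quotient : ∀ k a → a < k → ∃ λ q → q ℕ.* (s ℕ.* s ℕ.+ a ℕ.* a) ≡ D k
    quotient (suc k) a a<sk with a ℕ.≟ k
    ... | yes refl = D k , ℕ.*-comm (D k) _
    ... | no a≢k with quotient k a (ℕ.≤∧≢⇒< (ℕ.≤-pred a<sk) a≢k)
    ...   | q , e = (s ℕ.* s ℕ.+ k ℕ.* k) ℕ.* q , trans (ℕ.*-assoc (s ℕ.* s ℕ.+ k ℕ.* k) q _) (cong ((s ℕ.* s ℕ.+ k ℕ.* k) ℕ.*_) e)

    module _ {k : ℕ} where
      q : Fin k → ℕ
      q a = proj₁ (quotient k (toℕ a) (toℕ<n a))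

      q-spec : ∀ a → q a ℕ.* (s ℕ.* s ℕ.+ toℕ a ℕ.* toℕ a) ≡ D k
      q-spec a = proj₂ (quotient k (toℕ a) (toℕ<n a))

      private
        A : Fin k → ℤ
        A a = + toℕ a
        Q : Fin k → ℤ
        Q a = + q a
        σ = + s

      -- (s + a i)/(s - a i) = (s + a i)²/(s² + a²), multiplied by D.
      z : Fin k → G
      z a = (σ * σ - A a * A a) * Q a , (σ * A a + σ * A a) * Q a

      private
        Q-spec : ∀ a → Q a * (σ * σ + A a * A a) ≡ + D k
        Q-spec a = trans (cong (Q a *_) (trans (cong₂ _+_ (sym (ℤ.pos-* s s)) (sym (ℤ.pos-* (toℕ a) (toℕ a)))) (sym (ℤ.pos-+ (s ℕ.* s) _))))
          (trans (sym (ℤ.pos-* (q a) _)) (cong +_ (q-spec a)))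

      nrm-z : ∀ a → nrm (z a) ≡ D k ℕ.* D k
      nrm-z a = ℤ.+-injective (trans (+nrm (proj₁ (z a)) (proj₂ (z a)))
        (trans (lem σ (A a) (Q a)) (trans (cong₂ _*_ (Q-spec a) (Q-spec a)) (sym (ℤ.pos-* (D k) (D k))))))
        where
        lem : ∀ s a q → ((s * s - a * a) * q) * ((s * s - a * a) * q) + ((s * a + s * a) * q) * ((s * a + s * a) * q)
          ≡ (q * (s * s + a * a)) * (q * (s * s + a * a))
        lem = solve-∀

      -- The squared distance is the square of the difference of the two radii plus an angular term,
      -- and both radii are D.
      nrm-z⊖z : ∀ a b → nrm (z a ⊖ z b) ≡ 4 ℕ.* (s ℕ.* s) ℕ.* (∣ A a - A b ∣ ℕ.* ∣ A a - A b ∣) ℕ.* (q a ℕ.* q b)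
      nrm-z⊖z a b = ℤ.+-injective (begin
        + nrm (z a ⊖ z b)
          ≡⟨ +nrm (proj₁ (z a ⊖ z b)) (proj₂ (z a ⊖ z b)) ⟩
        _ ≡⟨ lem σ (A a) (A b) (Q a) (Q b) ⟩
        (X - Y) * (X - Y) + (+ 4 * (σ * σ) * ((A a - A b) * (A a - A b)) * (Q a * Q b))
          ≡⟨ cong (λ w → w * w + (+ 4 * (σ * σ) * ((A a - A b) * (A a - A b)) * (Q a * Q b)))
               (trans (cong₂ _-_ (Q-spec a) (Q-spec b)) (ℤ.+-inverseʳ (+ D k))) ⟩
        0ℤ + (+ 4 * (σ * σ) * ((A a - A b) * (A a - A b)) * (Q a * Q b))
          ≡⟨ ℤ.+-identityˡ _ ⟩
        + 4 * (σ * σ) * ((A a - A b) * (A a - A b)) * (Q a * Q b)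
          ≡⟨ cong₂ _*_ (cong₂ _*_ (cong (_*_ (+ 4)) (sym (ℤ.pos-* s s))) (sym (sq (A a - A b)))) (sym (ℤ.pos-* (q a) (q b))) ⟩
        + 4 * + (s ℕ.* s) * + d * + (q a ℕ.* q b)
          ≡⟨ cong (_* + (q a ℕ.* q b)) (trans (cong (_* + d) (sym (ℤ.pos-* 4 (s ℕ.* s)))) (sym (ℤ.pos-* (4 ℕ.* (s ℕ.* s)) d))) ⟩
        + (4 ℕ.* (s ℕ.* s) ℕ.* d) * + (q a ℕ.* q b)
          ≡⟨ sym (ℤ.pos-* (4 ℕ.* (s ℕ.* s) ℕ.* d) (q a ℕ.* q b)) ⟩
        + (4 ℕ.* (s ℕ.* s) ℕ.* d ℕ.* (q a ℕ.* q b)) ∎)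
        where
        open ≡-Reasoning
        d = ∣ A a - A b ∣ ℕ.* ∣ A a - A b ∣
        X = Q a * (σ * σ + A a * A a)
        Y = Q b * (σ * σ + A b * A b)
        lem : ∀ s a b p q →
          ((s * s - a * a) * p - (s * s - b * b) * q) * ((s * s - a * a) * p - (s * s - b * b) * q)
          + ((s * a + s * a) * p - (s * b + s * b) * q) * ((s * a + s * a) * p - (s * b + s * b) * q)
          ≡ (p * (s * s + a * a) - q * (s * s + b * b)) * (p * (s * s + a * a) - q * (s * s + b * b))
            + (+ 4 * (s * s) * ((a - b) * (a - b)) * (p * q))
        lem = solve-∀

      module _ (k≤s : k ≤ s) where
        private
          D≤ : ∀ a → D k ≤ 2 ℕ.* (s ℕ.* s) ℕ.* q a
          D≤ a = begin
            D k                                           ≡⟨ sym (q-spec a) ⟩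
            q a ℕ.* (s ℕ.* s ℕ.+ toℕ a ℕ.* toℕ a)         ≤⟨ ℕ.*-monoʳ-≤ (q a) (ℕ.+-monoʳ-≤ (s ℕ.* s) (ℕ.*-mono-≤ a≤s a≤s)) ⟩
            q a ℕ.* (s ℕ.* s ℕ.+ s ℕ.* s)                 ≡⟨ lem (q a) (s ℕ.* s) ⟩
            2 ℕ.* (s ℕ.* s) ℕ.* q a                       ∎
            where
            open ℕ.≤-Reasoning
            a≤s = ℕ.≤-trans (ℕ.<⇒≤ (toℕ<n a)) k≤s
            lem : ∀ q s → q ℕ.* (s ℕ.+ s) ≡ 2 ℕ.* s ℕ.* q
            lem = NatSolver.solve-∀

        separated : ∀ a b → a ≢ b → D k ℕ.* D k ≤ s ℕ.* s ℕ.* nrm (z a ⊖ z b)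
        separated a b a≢b = begin
          D k ℕ.* D k                                             ≤⟨ ℕ.*-mono-≤ (D≤ a) (D≤ b) ⟩
          2 ℕ.* (s ℕ.* s) ℕ.* q a ℕ.* (2 ℕ.* (s ℕ.* s) ℕ.* q b)   ≡⟨ lem (s ℕ.* s) (q a) (q b) ⟩
          s ℕ.* s ℕ.* (4 ℕ.* (s ℕ.* s) ℕ.* 1 ℕ.* (q a ℕ.* q b))
            ≤⟨ ℕ.*-monoʳ-≤ (s ℕ.* s) (ℕ.*-monoˡ-≤ (q a ℕ.* q b) (ℕ.*-monoʳ-≤ (4 ℕ.* (s ℕ.* s)) (ℕ.*-mono-≤ 1≤d 1≤d))) ⟩
          s ℕ.* s ℕ.* (4 ℕ.* (s ℕ.* s) ℕ.* (∣ A a - A b ∣ ℕ.* ∣ A a - A b ∣) ℕ.* (q a ℕ.* q b)) ≡⟨ cong (s ℕ.* s ℕ.*_) (sym (nrm-z⊖z a b)) ⟩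
          s ℕ.* s ℕ.* nrm (z a ⊖ z b)                             ∎
          where
          open ℕ.≤-Reasoning
          lem : ∀ s p q → 2 ℕ.* s ℕ.* p ℕ.* (2 ℕ.* s ℕ.* q) ≡ s ℕ.* (4 ℕ.* s ℕ.* 1 ℕ.* (p ℕ.* q))
          lem = NatSolver.solve-∀
          1≤d : 1 ≤ ∣ A a - A b ∣
          1≤d = ℕ.n≢0⇒n>0 λ e → a≢b (toℕ-injective (ℤ.+-injective (ℤ.i-j≡0⇒i≡j _ _ (ℤ.∣i∣≡0⇒i≡0 e))))

      -- Re z_a / D = (s² - a²)/(s² + a²) ≥ 1 - 2k²/s². The witness `r` is the exact surplus after
      -- clearing denominators, written with k = a + e so that k² - a² becomes 2ae + e².
      re-z : ∀ u → s ℕ.* s ≡ u ℕ.+ 2 ℕ.* (k ℕ.* k) → ∀ a → + (D k ℕ.* u) ℤ.≤ + (s ℕ.* s) * proj₁ (z a)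
      re-z u h a = subst₂ ℤ._≤_ eq₁ eq₂ (ℤ.i≤i+j (Q a * (σ * σ + A a * A a) * U) (+ r))
        where
        U = + u
        e = k ℕ.∸ toℕ a
        ε = + e
        k≡ : + k ≡ A a + ε
        k≡ = cong +_ (sym (ℕ.m+[n∸m]≡n (ℕ.<⇒≤ (toℕ<n a))))
        r : ℕ
        r = q a ℕ.* (2 ℕ.* (s ℕ.* s) ℕ.* (2 ℕ.* toℕ a ℕ.* e ℕ.+ e ℕ.* e) ℕ.+ 2 ℕ.* (k ℕ.* k) ℕ.* (toℕ a ℕ.* toℕ a))
        U≡ : U ≡ σ * σ - + 2 * ((A a + ε) * (A a + ε))
        U≡ = begin
          U                                                ≡⟨ lem U (+ (2 ℕ.* (k ℕ.* k))) ⟩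
          U + + (2 ℕ.* (k ℕ.* k)) - + (2 ℕ.* (k ℕ.* k))    ≡⟨ cong₂ _-_ (trans (sym (ℤ.pos-+ u _)) (trans (cong +_ (sym h)) (ℤ.pos-* s s)))
                                                              (trans (ℤ.pos-* 2 (k ℕ.* k)) (cong (_*_ (+ 2)) (trans (ℤ.pos-* k k) (cong₂ _*_ k≡ k≡)))) ⟩
          σ * σ - + 2 * ((A a + ε) * (A a + ε))            ∎
          where
          open ≡-Reasoning
          lem : ∀ x y → x ≡ x + y - y
          lem = solve-∀
        eq₁ : Q a * (σ * σ + A a * A a) * U ≡ + (D k ℕ.* u)
        eq₁ = trans (cong (_* U) (Q-spec a)) (sym (ℤ.pos-* (D k) u))
        r≡ : + r ≡ Q a * (+ 2 * (σ * σ) * (+ 2 * A a * ε + ε * ε) + + 2 * ((A a + ε) * (A a + ε)) * (A a * A a))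
        r≡ = trans (ℤ.pos-* (q a) _) (cong (Q a *_) (trans (ℤ.pos-+ (2 ℕ.* (s ℕ.* s) ℕ.* (2 ℕ.* toℕ a ℕ.* e ℕ.+ e ℕ.* e)) _) (cong₂ _+_
          (trans (ℤ.pos-* (2 ℕ.* (s ℕ.* s)) _) (cong₂ _*_ (trans (ℤ.pos-* 2 (s ℕ.* s)) (cong (_*_ (+ 2)) (ℤ.pos-* s s)))
            (trans (ℤ.pos-+ (2 ℕ.* toℕ a ℕ.* e) _) (cong₂ _+_ (trans (ℤ.pos-* (2 ℕ.* toℕ a) e) (cong (_* ε) (ℤ.pos-* 2 (toℕ a)))) (ℤ.pos-* e e)))))
          (trans (ℤ.pos-* (2 ℕ.* (k ℕ.* k)) _) (cong₂ _*_ (trans (ℤ.pos-* 2 (k ℕ.* k)) (cong (_*_ (+ 2)) (trans (ℤ.pos-* k k) (cong₂ _*_ k≡ k≡))))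
            (ℤ.pos-* (toℕ a) (toℕ a)))))))
        eq₂ : Q a * (σ * σ + A a * A a) * U + + r ≡ + (s ℕ.* s) * proj₁ (z a)
        eq₂ = trans (cong₂ (λ x y → Q a * (σ * σ + A a * A a) * x + y) U≡ r≡)
          (trans (lem σ (A a) ε (Q a)) (cong (_* proj₁ (z a)) (sym (ℤ.pos-* s s))))
          where
          lem : ∀ s a e q → q * (s * s + a * a) * (s * s - + 2 * ((a + e) * (a + e)))
            + q * (+ 2 * (s * s) * (+ 2 * a * e + e * e) + + 2 * ((a + e) * (a + e)) * (a * a))
            ≡ s * s * ((s * s - a * a) * q)
          lem = solve-∀

      re-sum : ∀ u → s ℕ.* s ≡ u ℕ.+ 2 ℕ.* (k ℕ.* k) → k ℕ.* (D k ℕ.* u) ≤ s ℕ.* s ℕ.* ∣ proj₁ (sumG z) ∣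
      re-sum u h = ℕ.≤-trans (ℤ.drop‿+≤+ (ℤ.≤-trans (go z (D k ℕ.* u) (s ℕ.* s) (re-z u h)) (abs-≤ (+ (s ℕ.* s) * proj₁ (sumG z)))))
          (ℕ.≤-reflexive (ℤ.abs-* (+ (s ℕ.* s)) (proj₁ (sumG z))))
        where
        abs-≤ : ∀ x → x ℤ.≤ + ∣ x ∣
        abs-≤ (+ n)        = ℤ.≤-refl
        abs-≤ (ℤ.-[1+ n ]) = ℤ.-≤+
        go : ∀ {k} (z : Fin k → G) d w → (∀ a → + d ℤ.≤ + w * proj₁ (z a)) → + (k ℕ.* d) ℤ.≤ + w * proj₁ (sumG z)
        go {zero}  z d w h = ℤ.≤-reflexive (sym (ℤ.*-zeroʳ (+ w)))
        go {suc k} z d w h = ℤ.≤-trans (ℤ.≤-reflexive (ℤ.pos-+ d (k ℕ.* d)))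
          (ℤ.≤-trans (ℤ.+-mono-≤ (h zero) (go (z ∘ suc) d w (h ∘ suc)))
            (ℤ.≤-reflexive (sym (ℤ.*-distribˡ-+ (+ w) (proj₁ (z zero)) _))))

      D>0 : 0 < s → 0 < D k
      D>0 s>0 = go k
        where
        go : ∀ k → 0 < D k
        go zero    = s≤s z≤n
        go (suc k) = ℕ.*-mono-≤ (ℕ.≤-trans (ℕ.*-mono-≤ s>0 s>0) (ℕ.m≤m+n (s ℕ.* s) (k ℕ.* k))) (go k)

-- Lower bound for the number of walks

module LowerBound where
  open import Data.Nat using (_+_; _*_; _^_; _∸_; _<_; _≤_; >-nonZero)
  open import Data.Nat.Properties
  open import Data.Integer using (∣_∣)
  open import Data.Fin using (zero; suc)
  open import Data.List using ([]; _∷_)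
  open import Data.List.Relation.Unary.All as All using (All; []; _∷_)
  open Antisymmetry
  open ChamberWalks
  open ParityClasses using (pairs-≢)
  open CharacterBound

  nrm-prodG : ∀ {k} (z : Fin k → G) d s L → All (λ { (a , b) → d ≤ s * nrm (z a ⊖ z b) }) L →
    d ^ length L ≤ s ^ length L * nrm (prodG z L)
  nrm-prodG z d s [] [] = s≤s z≤n
  nrm-prodG z d s ((a , b) ∷ L) (h ∷ hs) = begin
    d * d ^ length L ≤⟨ *-mono-≤ h (nrm-prodG z d s L hs) ⟩
    s * nrm (z a ⊖ z b) * (s ^ length L * nrm (prodG z L)) ≡⟨ lem s (nrm (z a ⊖ z b)) (s ^ length L) (nrm (prodG z L)) ⟩
    s * s ^ length L * (nrm (z a ⊖ z b) * nrm (prodG z L)) ≡⟨ cong (s * s ^ length L *_) (sym (nrm-· (z a ⊖ z b) (prodG z L))) ⟩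
    s * s ^ length L * nrm ((z a ⊖ z b) · prodG z L) ∎
    where
    open ≤-Reasoning
    lem : ∀ s x t y → s * x * (t * y) ≡ s * t * (x * y)
    lem = NatSolver.solve-∀

  -- Bernoulli's inequality (1 - v/w)^n ≥ 1 - n v/w for w = u + v, multiplied by w^(n+1) and
  -- rearranged.
  bernoulli : ∀ u v n → (u + v) ^ suc n ≤ (u + v) * u ^ n + n * v * (u + v) ^ n
  bernoulli u v zero = m≤m+n _ 0
  bernoulli u v (suc n) = begin
    w * w ^ suc n ≤⟨ *-monoʳ-≤ w (bernoulli u v n) ⟩
    w * (w * u ^ n + n * v * w ^ n) ≡⟨ lem₁ u v n (u ^ n) (w ^ n) ⟩
    w * (u * u ^ n) + (v * (w * u ^ n) + n * v * (w * w ^ n))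
      ≤⟨ +-monoʳ-≤ (w * (u * u ^ n)) (+-monoˡ-≤ _ (*-monoʳ-≤ v (*-monoʳ-≤ w (^-monoˡ-≤ n (m≤m+n u v))))) ⟩
    w * (u * u ^ n) + (v * (w * w ^ n) + n * v * (w * w ^ n)) ≡⟨ lem₂ w (u * u ^ n) v (w * w ^ n) n ⟩
    w * (u * u ^ n) + suc n * v * (w * w ^ n) ∎
    where
    open ≤-Reasoning
    w = u + v
    lem₁ : ∀ u v n p q → (u + v) * ((u + v) * p + n * v * q)
      ≡ (u + v) * (u * p) + (v * ((u + v) * p) + n * v * ((u + v) * q))
    lem₁ = NatSolver.solve-∀
    lem₂ : ∀ w p v q n → w * p + (v * q + n * v * q) ≡ w * p + (1 + n) * v * q
    lem₂ = NatSolver.solve-∀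

  half-power : ∀ u v n → 0 < u + v → 2 * (n * v) ≤ u + v → (u + v) ^ n ≤ 2 * u ^ n
  half-power u v n w>0 h = *-cancelˡ-≤ w ⦃ >-nonZero w>0 ⦄ (+-cancelʳ-≤ (w * w ^ n) _ _ (begin
    w * w ^ n + w * w ^ n ≡⟨ lem₀ (w * w ^ n) ⟩
    2 * (w * w ^ n) ≤⟨ *-monoʳ-≤ 2 (bernoulli u v n) ⟩
    2 * (w * u ^ n + n * v * w ^ n) ≡⟨ lem₁ w (u ^ n) n v (w ^ n) ⟩
    w * (2 * u ^ n) + 2 * (n * v) * w ^ n ≤⟨ +-monoʳ-≤ (w * (2 * u ^ n)) (*-monoˡ-≤ (w ^ n) h) ⟩
    w * (2 * u ^ n) + w * w ^ n ∎))
    where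
    open ≤-Reasoning
    w = u + v
    lem₀ : ∀ x → x + x ≡ 2 * x
    lem₀ = NatSolver.solve-∀
    lem₁ : ∀ w p n v q → 2 * (w * p + n * v * q) ≡ w * (2 * p) + 2 * (n * v) * q
    lem₁ = NatSolver.solve-∀

  square : ∀ n x → x ^ n * x ^ n ≡ (x * x) ^ n
  square n x = sym (*-^ n x x)

  -- With s of order √n this is a lower bound of order kⁿ n^(-K/2), K = k(k − 1)/2.
  walks-lower : ∀ k n s → k < s → let k′ = suc k in 4 * (k′ * k′) * suc n ≤ s * s →
    k′ ^ n ≤ 3 * (s ^ length (pairs k′) * 2 ^ length (net k)) * walks k′ n
  -- Squares are compared, since the modulus of a Gaussian integer is accessible through its square;
  -- the common factor E², with E = D^(n + K), is cancelled.
  walks-lower k₀ n s k≤s big = sq-cancel-≤ _ _ (*-cancelˡ-≤ (E * E) ⦃ >-nonZero (*-mono-≤ E>0 E>0) ⦄ (begin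
    E * E * (k ^ n * k ^ n)
      ≡⟨ cong (λ x → x * x * (k ^ n * k ^ n)) (^-distribˡ-+-* d n K) ⟩
    d ^ n * d ^ K * (d ^ n * d ^ K) * (k ^ n * k ^ n)
      ≡⟨ lem₁ (d ^ n) (d ^ K) (k ^ n) ⟩
    d ^ K * d ^ K * (k ^ n * d ^ n * (k ^ n * d ^ n))
      ≡⟨ cong₂ (λ x y → x * (y * y)) (square K d) (sym (*-^ n k d)) ⟩
    (d * d) ^ K * ((k * d) ^ n * (k * d) ^ n)
      ≤⟨ *-mono-≤ prod-lower (*-mono-≤ power-lower power-lower) ⟩
    (s * s) ^ K * Π * (2 * y ^ n * (2 * y ^ n))
      ≡⟨ lem₂ ((s * s) ^ K) (Π) (y ^ n) ⟩
    4 * (s * s) ^ K * (y ^ n * y ^ n * Π)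
      ≤⟨ *-monoʳ-≤ (4 * (s * s) ^ K) (*-monoˡ-≤ (Π) y-nrm) ⟩
    4 * (s * s) ^ K * (Z ^ n * Π)
      ≡⟨ cong₂ (λ x w → 4 * x * w) (sym (square K s)) (trans (cong (_* Π) (sym (nrm-^ (sumG ζ) n))) (sym (nrm-· (sumG ζ ^G n) (prodG ζ (pairs k))))) ⟩
    4 * (s ^ K * s ^ K) * nrm (W ζ n)
      ≤⟨ *-monoʳ-≤ (4 * (s ^ K * s ^ K)) (W-bound ζ d nrm-z n) ⟩
    4 * (s ^ K * s ^ K) * (B * B + B * B)
      -- The constant 4 · 2 = 8 is rounded up to 9 = 3² to have a square root: 4 comes from the two
      -- uses of `power-lower`, 2 from the real and imaginary parts.
      ≤⟨ m≤m+n (4 * (s ^ K * s ^ K) * (B * B + B * B)) (s ^ K * s ^ K * (B * B)) ⟩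
    4 * (s ^ K * s ^ K) * (B * B + B * B) + s ^ K * s ^ K * (B * B)
      ≡⟨ lem₃ (s ^ K) c E T ⟩
    E * E * (3 * (s ^ K * c) * T * (3 * (s ^ K * c) * T)) ∎))
    where
    open ≤-Reasoning
    open Character s
    k = suc k₀
    d = D k
    K = length (pairs k)
    E = d ^ (n + K)
    c = 2 ^ length (net k₀)
    T = walks k n
    B = c * E * T
    ζ : Fin k → G
    ζ = z
    Π = nrm (prodG ζ (pairs k))
    Z = nrm (sumG ζ)
    y = ∣ proj₁ (sumG ζ) ∣
    s>0 : 0 < s
    s>0 = ≤-trans (s≤s z≤n) k≤s
    E>0 : 0 < E
    E>0 = m^n>0 d ⦃ >-nonZero (D>0 {k} s>0) ⦄ (n + K)
    -- The successor in `suc n` makes this available for n = 0 as well, where 4k²n would say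
    -- nothing.
    small : 2 * (k * k) ≤ s * s
    small = ≤-trans (≤-trans (*-monoˡ-≤ (k * k) (s≤s (s≤s (z≤n {2})))) (m≤m*n (4 * (k * k)) (suc n))) big
    u = s * s ∸ 2 * (k * k)
    s²≡ : s * s ≡ u + 2 * (k * k)
    s²≡ = sym (m∸n+n≡m small)
    prod-lower : (d * d) ^ K ≤ (s * s) ^ K * Π
    prod-lower = nrm-prodG ζ (d * d) (s * s) (pairs k) (All.map (λ {ab} → separated k≤s (proj₁ ab) (proj₂ ab)) (pairs-≢ k))
    power-lower : (k * d) ^ n ≤ 2 * y ^ n
    power-lower = *-cancelˡ-≤ ((s * s) ^ n) ⦃ >-nonZero (m^n>0 (s * s) ⦃ >-nonZero (*-mono-≤ s>0 s>0) ⦄ n) ⦄ (begin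
      (s * s) ^ n * (k * d) ^ n ≤⟨ *-monoˡ-≤ ((k * d) ^ n) (subst (λ x → x ^ n ≤ 2 * u ^ n) (sym s²≡)
                                                     (half-power u (2 * (k * k)) n (subst (0 <_) s²≡ (*-mono-≤ s>0 s>0)) (subst (2 * (n * (2 * (k * k))) ≤_) s²≡ n-small))) ⟩
      2 * u ^ n * (k * d) ^ n ≡⟨ trans (*-assoc 2 (u ^ n) _) (cong (2 *_) (trans (sym (*-^ n u (k * d))) (cong (_^ n) (lem u k d)))) ⟩
      2 * (k * (d * u)) ^ n ≤⟨ *-monoʳ-≤ 2 (^-monoˡ-≤ n (re-sum {k} u s²≡)) ⟩
      2 * (s * s * y) ^ n ≡⟨ trans (cong (2 *_) (*-^ n (s * s) y)) (lem′ ((s * s) ^ n) (y ^ n)) ⟩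
      (s * s) ^ n * (2 * y ^ n) ∎)
      where
      lem : ∀ u k d → u * (k * d) ≡ k * (d * u)
      lem = NatSolver.solve-∀
      lem′ : ∀ x y → 2 * (x * y) ≡ x * (2 * y)
      lem′ = NatSolver.solve-∀
      n-small : 2 * (n * (2 * (k * k))) ≤ s * s
      n-small = ≤-trans (≤-reflexive (lem″ n (k * k))) (≤-trans (*-monoʳ-≤ (4 * (k * k)) (n≤1+n n)) big)
        where
        lem″ : ∀ n x → 2 * (n * (2 * x)) ≡ 4 * x * n
        lem″ = NatSolver.solve-∀
    y-nrm : y ^ n * y ^ n ≤ Z ^ n
    y-nrm = ≤-trans (≤-reflexive (square n y)) (^-monoˡ-≤ n (m≤m+n (y * y) (∣ proj₂ (sumG ζ) ∣ * ∣ proj₂ (sumG ζ) ∣)))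
    lem₁ : ∀ a b c → a * b * (a * b) * (c * c) ≡ b * b * (c * a * (c * a))
    lem₁ = NatSolver.solve-∀
    lem₂ : ∀ a b c → a * b * (2 * c * (2 * c)) ≡ 4 * a * (c * c * b)
    lem₂ = NatSolver.solve-∀
    lem₃ : ∀ p c e t → 4 * (p * p) * (c * e * t * (c * e * t) + c * e * t * (c * e * t))
      + p * p * (c * e * t * (c * e * t))
      ≡ e * e * (3 * (p * c) * t * (3 * (p * c) * t))
    lem₃ = NatSolver.solve-∀

-- Equidistribution of the parity vectors and the count of odd columns

module Equidistribution where
  open import Data.Nat using (_+_; _*_; _^_; _/_; >-nonZero; _<_; _≤_; _≡ᵇ_)
  open import Data.Nat.Properties
  open import Data.Nat.DivMod using (m/n*n≤m; m*n/n≡m; /-monoˡ-≤)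
  open import Data.Nat.Combinatorics using (_C_; nCn≡1; nCk≡nC[n∸k]; nCk+nC[k+1]≡[n+1]C[k+1])
  open import Data.Integer as ℤ using (ℤ; +_; ∣_∣; 0ℤ; 1ℤ)
  import Data.Integer.Properties as ℤ
  open import Data.Bool using (_xor_)
  open import Data.Bool.Properties using (not-involutive; T-≡)
  open import Data.Fin using (zero; suc)
  open import Data.Vec using ([]; _∷_)
  import Data.Vec as Vec
  open ShiftOperators
  open Antisymmetry
  open ChamberWalks
  open ParityClasses
  open CharacterBound
  open LowerBound

  -- Provides the t² steps for each of L differences; the strict upper bound says that t still has
  -- order √n.
  division-by-squares : ∀ L n → 0 < L → ∃₂ λ t r → n ≡ r + L * (t * t) × n < L * (suc t * suc t)
  division-by-squares L zero    L>0 = 0 , 0 , sym (*-zeroʳ L) , *-mono-≤ L>0 (s≤s (z≤n {0}))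
  division-by-squares L (suc n) L>0 with division-by-squares L n L>0
  ... | t , r , e , n< with m≤n⇒m<n∨m≡n n<
  ...   | inj₁ lt = t , suc r , cong suc e , lt
  ...   | inj₂ eq = suc t , 0 , eq , subst (_< L * (suc (suc t) * suc (suc t))) (sym eq)
          (*-monoʳ-< L ⦃ >-nonZero L>0 ⦄ (*-mono-< (n<1+n (suc t)) (n<1+n (suc t))))

  -- The lower bound with a very large s already excludes 0, because k^n is positive.
  walks>0 : ∀ k n → 0 < walks (suc k) n
  walks>0 k n = n≢0⇒n>0 λ e → <⇒≱ (m^n>0 (suc k) n)
    (≤-trans (walks-lower k n s k<s big) (≤-reflexive (trans (cong (3 * (s ^ length (pairs (suc k)) * 2 ^ length (net k)) *_) e) (*-zeroʳ (3 * (s ^ length (pairs (suc k)) * 2 ^ length (net k)))))))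
    where
    m = suc k
    s = 4 * (m * m) * suc n
    1≤s : 1 ≤ s
    1≤s = *-mono-≤ {1} {4 * (m * m)} (*-mono-≤ {1} {4} (s≤s z≤n) (s≤s z≤n)) (s≤s z≤n)
    k<s : k < s
    k<s = ≤-trans (≤-trans (m≤m*n m m) (m≤n*m (m * m) 4)) (m≤m*n (4 * (m * m)) (suc n))
    big : s ≤ s * s
    big = ≤-trans (≤-reflexive (sym (*-identityʳ s))) (*-monoʳ-≤ s 1≤s)

  -- Comparing the two bounds: t^(K+1) E = O(kⁿ) and kⁿ = O(t^K T).
  module Comparison (k K c R : ℕ) (k>0 : 0 < k) (c>0 : 0 < c) where
    -- `s = α * t` is admissible in the lower bound, because 4k²(n + 1) ≤ 4k²L(t + 1)² ≤ (4kLt)² for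
    -- t ≥ 1. Eliminating k^n and t^K from the two bounds leaves t E ≤ M T, so t ≥ M R yields R E ≤
    -- T; the successor in `MR` also forces t > 0.
    L α M MR : ℕ
    L = suc K
    α = 4 * k * L
    M = (2 + k) ^ L * (3 * (α ^ K * c))
    MR = suc (M * R)

    α>0 : 0 < α
    α>0 = *-mono-≤ (*-mono-≤ {1} {4} (s≤s z≤n) k>0) (s≤s (z≤n {K}))

    M>0 : 0 < M
    M>0 = *-mono-≤ (m^n>0 (2 + k) L)
      (*-mono-≤ {1} {3} (s≤s z≤n) (*-mono-≤ (m^n>0 α ⦃ >-nonZero α>0 ⦄ K) c>0))

    module _ (T n t E : ℕ) (n< : n < L * (suc t * suc t)) (n≥ : L * (MR * MR) ≤ n)
      (upper : t ^ L * E ≤ (2 + k) ^ L * k ^ n)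
      (lower : ∀ s → k ≤ s → 4 * (k * k) * suc n ≤ s * s → k ^ n ≤ 3 * (s ^ K * c) * T) where
      open ≤-Reasoning

      MR≤t : MR ≤ t
      MR≤t with ≤-<-connex MR t
      ... | inj₁ h = h
      ... | inj₂ h = ⊥-elim (<⇒≱ n< (≤-trans (*-monoʳ-≤ L (*-mono-≤ h h)) n≥))

      t>0 : 0 < t
      t>0 = ≤-trans (s≤s z≤n) MR≤t

      s : ℕ
      s = α * t

      k≤s : k ≤ s
      k≤s = begin
        k ≤⟨ m≤m*n k (4 * L) ⟩
        k * (4 * L) ≡⟨ lem k L ⟩
        α * 1 ≤⟨ *-monoʳ-≤ α t>0 ⟩
        s ∎
        where
        lem : ∀ k L → k * (4 * L) ≡ 4 * k * L * 1
        lem = NatSolver.solve-∀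

      big : 4 * (k * k) * suc n ≤ s * s
      big = begin
        4 * (k * k) * suc n ≤⟨ *-monoʳ-≤ (4 * (k * k)) n< ⟩
        4 * (k * k) * (L * (suc t * suc t)) ≤⟨ *-monoʳ-≤ (4 * (k * k)) (*-monoʳ-≤ L (*-mono-≤ (+-monoˡ-≤ t t>0) (+-monoˡ-≤ t t>0))) ⟩
        4 * (k * k) * (L * ((t + t) * (t + t))) ≤⟨ *-monoʳ-≤ (4 * (k * k)) (*-monoˡ-≤ ((t + t) * (t + t)) (m≤m*n L L)) ⟩
        4 * (k * k) * (L * L * ((t + t) * (t + t))) ≡⟨ lem k L t ⟩
        s * s ∎
        where
        lem : ∀ k L t → 4 * (k * k) * (L * L * ((t + t) * (t + t))) ≡ 4 * k * L * t * (4 * k * L * t)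
        lem = NatSolver.solve-∀

      main : t ^ K * (t * E) ≤ t ^ K * (M * T)
      main = begin
        t ^ K * (t * E) ≡⟨ lem₁ (t ^ K) t E ⟩
        t ^ L * E ≤⟨ upper ⟩
        (2 + k) ^ L * k ^ n ≤⟨ *-monoʳ-≤ ((2 + k) ^ L) (lower s k≤s big) ⟩
        (2 + k) ^ L * (3 * (s ^ K * c) * T) ≡⟨ cong (λ x → (2 + k) ^ L * (3 * (x * c) * T)) (*-^ K α t) ⟩
        (2 + k) ^ L * (3 * (α ^ K * t ^ K * c) * T) ≡⟨ lem₂ ((2 + k) ^ L) (α ^ K) (t ^ K) c T ⟩
        t ^ K * (M * T) ∎
        where
        lem₁ : ∀ x t e → x * (t * e) ≡ t * x * e
        lem₁ = NatSolver.solve-∀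
        lem₂ : ∀ u a x c t → u * (3 * (a * x * c) * t) ≡ x * (u * (3 * (a * c)) * t)
        lem₂ = NatSolver.solve-∀

      small : R * E ≤ T
      small = *-cancelˡ-≤ M ⦃ >-nonZero M>0 ⦄ (begin
        M * (R * E) ≡⟨ sym (*-assoc M R E) ⟩
        M * R * E ≤⟨ *-monoˡ-≤ E (≤-trans (n≤1+n _) MR≤t) ⟩
        t * E ≤⟨ *-cancelˡ-≤ (t ^ K) ⦃ >-nonZero (m^n>0 t ⦃ >-nonZero t>0 ⦄ K) ⦄ main ⟩
        M * T ∎)

  flip-small : ∀ κ R → ∃ λ N₀ → ∀ n → N₀ ≤ n → ∀ i (p : Vec Bool (2 + κ)) →
    ∃ λ E → R * E ≤ walks (2 + κ) n × N n p ℤ.≤ N n (flip₂ i p) ℤ.+ + E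
  flip-small κ R = L * (MR * MR) , λ n n≥ i p →
    let t , r , e , n< = division-by-squares L n (s≤s z≤n)
        E , upper , le = N-flip-bound n t r e i p
    in E , small (walks (2 + κ) n) n t E n< n≥ upper (walks-lower (suc κ) n) , le
    where
    open Comparison (2 + κ) (length (pairs (2 + κ))) (2 ^ length (net (suc κ))) R (s≤s z≤n) (m^n>0 2 (length (net (suc κ))))

  parity : ∀ {k} → Vec Bool k → Bool
  parity []      = false
  parity (x ∷ p) = x xor parity p

  last-bit : ∀ {n} → Bool → Vec Bool (suc n)
  last-bit {zero}  b = b ∷ []
  last-bit {suc n} b = false ∷ last-bit b

  canonical-parity : ∀ {n} (p : Vec Bool (suc n)) → canonical p ≡ last-bit (parity p)
  canonical-parity (x ∷ []) = cong (_∷ []) (sym (xor-false x))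
    where
    xor-false : ∀ x → x xor false ≡ x
    xor-false true  = refl
    xor-false false = refl
  canonical-parity (x ∷ y ∷ p) = cong (false ∷_) (trans (canonical-parity ((x xor y) ∷ p)) (cong last-bit (assoc x y (parity p))))
    where
    assoc : ∀ x y z → (x xor y) xor z ≡ x xor (y xor z)
    assoc true  true  z = sym (not-involutive z)
    assoc true  false z = refl
    assoc false y     z = refl

  abs-diff : ∀ x y m → x ℤ.≤ y ℤ.+ + m → y ℤ.≤ x ℤ.+ + m → ∣ x ℤ.- y ∣ ≤ m
  abs-diff x y m h₁ h₂ with ℤ.+∣i∣≡i⊎+∣i∣≡-i (x ℤ.- y)
  ... | inj₁ e = ℤ.drop‿+≤+ (ℤ.≤-trans (ℤ.≤-reflexive e) (ℤ.≤-trans (ℤ.+-monoˡ-≤ (ℤ.- y) h₁) (ℤ.≤-reflexive (lem y (+ m)))))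
    where
    lem : ∀ y m → y ℤ.+ m ℤ.- y ≡ m
    lem = solve-∀
  ... | inj₂ e = ℤ.drop‿+≤+ (ℤ.≤-trans (ℤ.≤-reflexive (trans e (lem₁ x y))) (ℤ.≤-trans (ℤ.+-monoˡ-≤ (ℤ.- x) h₂) (ℤ.≤-reflexive (lem x (+ m)))))
    where
    lem : ∀ y m → y ℤ.+ m ℤ.- y ≡ m
    lem = solve-∀
    lem₁ : ∀ x y → ℤ.- (x ℤ.- y) ≡ y ℤ.- x
    lem₁ = solve-∀

  -- The hypothesis allows a different error for every i and p. All of them are at most T / (R + 1),
  -- which serves as the common `E`; the successor keeps the divisor nonzero.
  near-parity-class : ∀ {k} (F : Vec Bool (suc k) → ℤ) T R →
    (∀ i p → ∃ λ E → suc R * E ≤ T × F p ℤ.≤ F (flip₂ i p) ℤ.+ + E) →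
    ∃ λ E → R * E ≤ T × (∀ p → ∣ F p ℤ.- F (last-bit (parity p)) ∣ ≤ k * E)
  near-parity-class {k} F T R h = E , R*E≤T , close
    where
    E : ℕ
    E = T / suc R
    R*E≤T : R * E ≤ T
    R*E≤T = ≤-trans (*-monoˡ-≤ E (n≤1+n R)) (≤-trans (≤-reflexive (*-comm (suc R) E)) (m/n*n≤m T (suc R)))
    step : ∀ i q → F q ℤ.≤ F (flip₂ i q) ℤ.+ + E
    step i q with h i q
    ... | E′ , small , le = ℤ.≤-trans le (ℤ.+-monoʳ-≤ (F (flip₂ i q)) (ℤ.+≤+
      (subst (_≤ E) (trans (cong (_/ suc R) (*-comm (suc R) E′)) (m*n/n≡m E′ (suc R))) (/-monoˡ-≤ (suc R) small))))
    close : ∀ p → ∣ F p ℤ.- F (last-bit (parity p)) ∣ ≤ k * E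
    close p = subst (λ q → ∣ F p ℤ.- F q ∣ ≤ k * E) (canonical-parity p) (abs-diff (F p) (F (canonical p)) (k * E)
      (subst (λ x → F p ℤ.≤ F (canonical p) ℤ.+ x) (sym (ℤ.pos-* k E)) (proj₁ near))
      (subst (λ x → F (canonical p) ℤ.≤ F p ℤ.+ x) (sym (ℤ.pos-* k E)) (proj₂ near)))
      where
      near = near-canonical F (+ E) step (ℤ.+≤+ z≤n) p

  equidistribution : ∀ k R → ∃ λ N₀ → ∀ n → N₀ ≤ n → ∃ λ E → R * E ≤ walks (suc k) n ×
    (∀ (p : Vec Bool (suc k)) → ∣ N {k} n p ℤ.- N {k} n (last-bit (parity p)) ∣ ≤ k * E)
  -- With a single column there is no adjacent pair to flip.
  equidistribution zero    R = 0 , λ n _ → near-parity-class (N n) (walks 1 n) R λ ()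
  equidistribution (suc κ) R = proj₁ (flip-small κ (suc R)) , λ n n≥ →
    near-parity-class (N n) (walks (2 + κ) n) R (proj₂ (flip-small κ (suc R)) n n≥)

  ΣB : ∀ {k} → (Vec Bool k → ℤ) → ℤ
  ΣB {zero}  f = f []
  ΣB {suc k} f = ΣB (f ∘ (false ∷_)) ℤ.+ ΣB (f ∘ (true ∷_))

  ΣB-cong : ∀ {k} {f g : Vec Bool k → ℤ} → (∀ p → f p ≡ g p) → ΣB f ≡ ΣB g
  ΣB-cong {zero}  h = h []
  ΣB-cong {suc k} h = cong₂ ℤ._+_ (ΣB-cong (h ∘ (false ∷_))) (ΣB-cong (h ∘ (true ∷_)))

  ΣB-zero : ∀ {k} {f : Vec Bool k → ℤ} → (∀ p → f p ≡ 0ℤ) → ΣB f ≡ 0ℤ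
  ΣB-zero {zero}  h = h []
  ΣB-zero {suc k} h = cong₂ ℤ._+_ (ΣB-zero (h ∘ (false ∷_))) (ΣB-zero (h ∘ (true ∷_)))

  _∣_ : ∀ {A : Set} → (A → Bool) → (A → ℤ) → A → ℤ
  (χ ∣ f) p = if χ p then f p else 0ℤ

  size : ∀ {k} → (Vec Bool k → Bool) → ℕ
  size {zero}  χ = if χ [] then 1 else 0
  size {suc k} χ = size (χ ∘ (false ∷_)) + size (χ ∘ (true ∷_))

  size-cong : ∀ {k} {χ ψ : Vec Bool k → Bool} → (∀ p → χ p ≡ ψ p) → size χ ≡ size ψ
  size-cong {zero}  h = cong (if_then 1 else 0) (h [])
  size-cong {suc k} h = cong₂ _+_ (size-cong (h ∘ (false ∷_))) (size-cong (h ∘ (true ∷_)))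

  ΣB-near : ∀ {k} (χ : Vec Bool k → Bool) f c e → (∀ p → χ p ≡ true → ∣ f p ℤ.- c ∣ ≤ e) →
    ∣ ΣB (χ ∣ f) ℤ.- + size χ ℤ.* c ∣ ≤ size χ * e
  ΣB-near {zero} χ f c e h with χ [] in eq
  ... | true  = subst₂ _≤_ (cong (λ x → ∣ f [] ℤ.- x ∣) (sym (ℤ.*-identityˡ c))) (sym (*-identityˡ e)) (h [] eq)
  ... | false = ≤-reflexive (cong (λ x → ∣ 0ℤ ℤ.- x ∣) (ℤ.*-zeroˡ c))
  ΣB-near {suc k} χ f c e h = begin
    ∣ (X ℤ.+ Y) ℤ.- + (m + n) ℤ.* c ∣ ≡⟨ cong ∣_∣ (trans (cong (λ z → X ℤ.+ Y ℤ.- z ℤ.* c) (ℤ.pos-+ m n)) (lem X Y (+ m) (+ n) c)) ⟩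
    ∣ (X ℤ.- + m ℤ.* c) ℤ.+ (Y ℤ.- + n ℤ.* c) ∣ ≤⟨ ℤ.∣i+j∣≤∣i∣+∣j∣ (X ℤ.- + m ℤ.* c) _ ⟩
    ∣ X ℤ.- + m ℤ.* c ∣ + ∣ Y ℤ.- + n ℤ.* c ∣ ≤⟨ +-mono-≤ (ΣB-near (χ ∘ (false ∷_)) (f ∘ (false ∷_)) c e (h ∘ (false ∷_)))
                                                               (ΣB-near (χ ∘ (true ∷_)) (f ∘ (true ∷_)) c e (h ∘ (true ∷_))) ⟩
    m * e + n * e ≡⟨ sym (*-distribʳ-+ e m n) ⟩
    (m + n) * e ∎
    where
    open ≤-Reasoning
    m = size (χ ∘ (false ∷_))
    n = size (χ ∘ (true ∷_))
    X = ΣB ((χ ∘ (false ∷_)) ∣ (f ∘ (false ∷_)))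
    Y = ΣB ((χ ∘ (true ∷_)) ∣ (f ∘ (true ∷_)))
    lem : ∀ X Y m n c → X ℤ.+ Y ℤ.- (m ℤ.+ n) ℤ.* c ≡ (X ℤ.- m ℤ.* c) ℤ.+ (Y ℤ.- n ℤ.* c)
    lem = solve-∀

  pop : ∀ {k} → Vec Bool k → ℕ
  pop []          = 0
  pop (false ∷ p) = pop p
  pop (true ∷ p)  = suc (pop p)

  size-empty : ∀ {k} → size {k} (λ _ → false) ≡ 0
  size-empty {zero}  = refl
  size-empty {suc k} = cong₂ _+_ (size-empty {k}) (size-empty {k})

  size-pop : ∀ k i → size {k} (λ p → pop p ≡ᵇ i) ≡ k C i
  size-pop zero    zero    = refl
  size-pop zero    (suc i) = refl
  size-pop (suc k) zero    = trans (cong₂ _+_ (size-pop k 0) (size-empty {k})) (trans (+-identityʳ _) (trans (nC0≡1 k) (sym (nC0≡1 (suc k)))))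
    where
    nC0≡1 : ∀ n → n C 0 ≡ 1
    nC0≡1 n = trans (nCk≡nC[n∸k] {0} {n} z≤n) (nCn≡1 n)
  size-pop (suc k) (suc i) = trans (cong₂ _+_ (size-pop k (suc i)) (size-pop k i))
    (trans (+-comm (k C suc i) (k C i)) (nCk+nC[k+1]≡[n+1]C[k+1] k i))

  size-parity : ∀ k b → size {suc k} (λ p → parity p == b) ≡ 2 ^ k
  size-parity zero    true  = refl
  size-parity zero    false = refl
  size-parity (suc k) b = trans (cong₂ _+_ (size-parity k b) (trans (size-cong {suc k} (λ p → ==-not (parity p) b)) (size-parity k (not b))))
    (cong (_+_ (2 ^ k)) (sym (+-identityʳ _)))

  parity-pop : ∀ {k} (p : Vec Bool k) → parity p ≡ odd (pop p)
  parity-pop []          = refl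
  parity-pop (false ∷ p) = parity-pop p
  parity-pop (true ∷ p)  = cong not (parity-pop p)

  odd-+ : ∀ m n → odd (m + n) ≡ odd m xor odd n
  odd-+ zero    n = refl
  odd-+ (suc m) n = trans (cong not (odd-+ m n)) (not-xor (odd m) (odd n))
    where
    not-xor : ∀ x y → not (x xor y) ≡ not x xor y
    not-xor true  y = not-involutive y
    not-xor false y = refl

  par : ∀ {k} → Vec ℕ k → Vec Bool k
  par []              = []
  par {suc k} (a ∷ l) = odd (a + k) ∷ par l

  parity-par : ∀ {k} (l : Vec ℕ k) → parity (par l) ≡ odd (Vec.sum l + Vec.sum (ρ k))
  parity-par [] = refl
  parity-par {suc k} (a ∷ l) = begin
    odd (a + k) xor parity (par l) ≡⟨ cong (odd (a + k) xor_) (parity-par l) ⟩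
    odd (a + k) xor odd (Vec.sum l + Vec.sum (ρ k)) ≡⟨ sym (odd-+ (a + k) _) ⟩
    odd (a + k + (Vec.sum l + Vec.sum (ρ k))) ≡⟨ cong odd (lem a k (Vec.sum l) (Vec.sum (ρ k))) ⟩
    odd (a + Vec.sum l + (k + Vec.sum (ρ k))) ∎
    where
    open ≡-Reasoning
    lem : ∀ a k x y → a + k + (x + y) ≡ a + x + (k + y)
    lem = NatSolver.solve-∀

  restrict-0 : ∀ {A : Set} (χ : A → Bool) p → (χ ∣ (λ _ → 0ℤ)) p ≡ 0ℤ
  restrict-0 χ p with χ p
  ... | true  = refl
  ... | false = refl

  -- A chamber point has exactly one parity vector, so the class indicators partition the chamber.
  ΣB-ind : ∀ {k} m (χ : Vec Bool k → Bool) l →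
    ΣB (χ ∣ (λ p → ind m p l)) ≡ (if dec m l then (if χ (par l) then 1ℤ else 0ℤ) else 0ℤ)
  ΣB-ind m χ [] = refl
  ΣB-ind {suc k} m χ (a ∷ l) with below m a | odd (a + k)
  ... | false | _     = cong₂ ℤ._+_ (ΣB-zero (restrict-0 (χ ∘ (false ∷_)))) (ΣB-zero (restrict-0 (χ ∘ (true ∷_))))
  ... | true  | true  = trans (cong₂ ℤ._+_ (ΣB-zero (restrict-0 (χ ∘ (false ∷_)))) (ΣB-ind (just a) (χ ∘ (true ∷_)) l)) (ℤ.+-identityˡ _)
  ... | true  | false = trans (cong₂ ℤ._+_ (ΣB-ind (just a) (χ ∘ (false ∷_)) l) (ΣB-zero (restrict-0 (χ ∘ (true ∷_))))) (ℤ.+-identityʳ _)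

  V-cong-res : ∀ {k} n {φ ψ : Fun k} → res φ ≗ res ψ → V n φ ≗ V n ψ
  V-cong-res zero    h = h
  V-cong-res (suc n) h = res-cong (pw-cong (V-cong-res n h))

  V-+ : ∀ {k} n (φ ψ : Fun k) → V n (λ l → φ l ℤ.+ ψ l) ≗ λ l → V n φ l ℤ.+ V n ψ l
  V-+ zero φ ψ l with dec nothing l
  ... | true  = refl
  ... | false = refl
  V-+ (suc n) φ ψ l with dec nothing l
  ... | true  = trans (pw-cong (V-+ n φ ψ) l) (∑-distrib-+ (λ t → V n φ (inc t l)) (λ t → V n ψ (inc t l)))
  ... | false = refl

  V-ΣB : ∀ {k j} n (φ : Vec Bool j → Fun k) → V n (λ l → ΣB (λ p → φ p l)) ≗ λ l → ΣB (λ p → V n (φ p) l)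
  V-ΣB {j = zero}  n φ l = refl
  V-ΣB {j = suc j} n φ l = trans (V-+ n (λ l → ΣB (λ p → φ (false ∷ p) l)) (λ l → ΣB (λ p → φ (true ∷ p) l)) l)
    (cong₂ ℤ._+_ (V-ΣB n (φ ∘ (false ∷_)) l) (V-ΣB n (φ ∘ (true ∷_)) l))

  count : ∀ {k} → ℕ → (Vec Bool k → Bool) → ℤ
  count {k} n χ = V n (λ l → if χ (par l) then 1ℤ else 0ℤ) (ρ k)

  count-N : ∀ {k} n (χ : Vec Bool (suc k) → Bool) → count n χ ≡ ΣB (χ ∣ N n)
  count-N {k} n χ = begin
    V n (λ l → if χ (par l) then 1ℤ else 0ℤ) r ≡⟨ V-cong-res n same r ⟩
    V n (λ l → ΣB (χ ∣ (λ p → ind nothing p l))) r ≡⟨ V-ΣB n (λ p l → (χ ∣ (λ p → ind nothing p l)) p) r ⟩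
    ΣB (λ p → V n (λ l → (χ ∣ (λ p → ind nothing p l)) p) r) ≡⟨ ΣB-cong pull ⟩
    ΣB (χ ∣ N n) ∎
    where
    open ≡-Reasoning
    r = ρ (suc k)
    same : ∀ l → res (λ l → if χ (par l) then 1ℤ else 0ℤ) l ≡ res (λ l → ΣB (χ ∣ (λ p → ind nothing p l))) l
    same l rewrite ΣB-ind nothing χ l with dec nothing l
    ... | true  = refl
    ... | false = refl
    pull : ∀ p → V n (λ l → (χ ∣ (λ p → ind nothing p l)) p) r ≡ (χ ∣ N n) p
    pull p with χ p
    ... | true  = refl
    ... | false = V-zero n r

  ==⇒≡ : ∀ x y → (x == y) ≡ true → x ≡ y
  ==⇒≡ true  true  e = refl
  ==⇒≡ false false e = refl

  ≡⇒== : ∀ x y → x ≡ y → (x == y) ≡ true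
  ≡⇒== true  .true  refl = refl
  ≡⇒== false .false refl = refl

  ind-par : ∀ {k} m (p : Vec Bool k) l → ind m p l ≡ 0ℤ ⊎ par l ≡ p
  ind-par m [] [] = inj₂ refl
  ind-par {suc k} m (x ∷ p) (a ∷ l) with below m a | odd (a + k) == x in e
  ... | false | _     = inj₁ refl
  ... | true  | false = inj₁ refl
  ... | true  | true with ind-par (just a) p l
  ...   | inj₁ z = inj₁ z
  ...   | inj₂ r = inj₂ (cong₂ _∷_ (==⇒≡ _ x e) r)

  -- After n steps from ρ the entries sum to n plus the sum of ρ, and ρ is added once more in the
  -- parity vector; so its parity is that of n. `V-bound` with M = 0 turns the lack of end points
  -- into a vanishing count.
  N-parity : ∀ {k} n (p : Vec Bool (suc k)) → parity p ≢ odd n → N n p ≡ 0ℤ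
  N-parity {k} n p ne = ℤ.∣i∣≡0⇒i≡0 (n≤0⇒n≡0 (ℤ.drop‿+≤+ (ℤ.≤-trans (V-bound n (ind nothing p) 0 (ρ (suc k)) vanish) (ℤ.≤-reflexive (ℤ.*-zeroˡ (V n one (ρ (suc k))))))))
    where
    vanish : ∀ l → Vec.sum l ≡ n + Vec.sum (ρ (suc k)) → ∣ ind nothing p l ∣ ≤ 0
    vanish l e with ind-par nothing p l
    ... | inj₁ z = ≤-reflexive (cong ∣_∣ z)
    ... | inj₂ refl = ⊥-elim (ne (trans (parity-par l) (trans (cong (λ x → odd (x + Vec.sum (ρ (suc k)))) e) even)))
      where
      xor-self : ∀ x → x xor x ≡ false
      xor-self true  = refl
      xor-self false = refl
      xor-false : ∀ x → x xor false ≡ x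
      xor-false true  = refl
      xor-false false = refl
      σ = Vec.sum (ρ (suc k))
      even : odd (n + σ + σ) ≡ odd n
      even = trans (cong odd (+-assoc n σ σ)) (trans (odd-+ n (σ + σ))
        (trans (cong (odd n xor_) (trans (odd-+ σ σ) (xor-self (odd σ)))) (xor-false (odd n))))

  walks-N : ∀ k n → + walks (suc k) n ≡ ΣB ((λ p → parity p == odd n) ∣ N {k} n)
  walks-N k n = begin
    + walks (suc k) n ≡⟨ ℤ.0≤i⇒+∣i∣≡i (V-nonneg n (ρ (suc k))) ⟩
    count n (λ _ → true) ≡⟨ count-N {k} n (λ _ → true) ⟩
    ΣB (N {k} n) ≡⟨ ΣB-cong {suc k} restrict ⟩
    ΣB ((λ p → parity p == odd n) ∣ N {k} n) ∎
    where
    open ≡-Reasoning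
    restrict : ∀ (p : Vec Bool (suc k)) → N n p ≡ ((λ p → parity p == odd n) ∣ N n) p
    restrict p with parity p == odd n in e
    ... | true  = refl
    ... | false = N-parity n p λ h → contra (trans (sym (≡⇒== _ _ h)) e)
      where
      contra : true ≢ false
      contra ()

  odd-count : ∀ {k} → ℕ → ℕ → ℤ
  odd-count {k} n i = count {k} n (λ p → pop p ≡ᵇ i)

  odd-count-wrong-parity : ∀ {k} n i → odd i ≢ odd n → odd-count {suc k} n i ≡ 0ℤ
  odd-count-wrong-parity {k} n i ne = trans (count-N {k} n (λ p → pop p ≡ᵇ i)) (ΣB-zero {suc k} vanish)
    where
    vanish : ∀ (p : Vec Bool (suc k)) → ((λ p → pop p ≡ᵇ i) ∣ N n) p ≡ 0ℤ
    vanish p with pop p ≡ᵇ i in e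
    ... | false = refl
    ... | true  = N-parity n p λ h → ne (trans (cong odd (sym (≡ᵇ⇒≡ (pop p) i (Equivalence.from T-≡ e)))) (trans (sym (parity-pop p)) h))

  -- Both counts are compared with multiples of `c`, the value of `N` at the canonical vector.
  -- Cross-multiplying by the two class sizes cancels `c`, whose size is thus never estimated, and
  -- leaves two errors of at most m b k E each: this is the factor in `R′`.
  odd-count-concentrates : ∀ k i R → ∃ λ N₀ → ∀ n → N₀ ≤ n → odd i ≡ odd n →
    R * ∣ + (2 ^ k) ℤ.* odd-count {suc k} n i ℤ.- + (suc k C i) ℤ.* + walks (suc k) n ∣ ≤ walks (suc k) n
  odd-count-concentrates k i R = proj₁ eq , λ n n≥ par≡ → let E , small , near = proj₂ eq n n≥ in bound n par≡ E small near
    where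
    m = 2 ^ k
    b = suc k C i
    R′ = R * (2 * (m * b * k))
    eq = equidistribution k R′
    bound : ∀ n → odd i ≡ odd n → ∀ E → R′ * E ≤ walks (suc k) n →
      (∀ (p : Vec Bool (suc k)) → ∣ N {k} n p ℤ.- N {k} n (last-bit (parity p)) ∣ ≤ k * E) →
      R * ∣ + m ℤ.* odd-count {suc k} n i ℤ.- + b ℤ.* + walks (suc k) n ∣ ≤ walks (suc k) n
    bound n par≡ E small near = begin
      R * ∣ + m ℤ.* A ℤ.- + b ℤ.* T ∣ ≡⟨ cong (λ x → R * ∣ x ∣) (lem₁ (+ m) (+ b) A T c) ⟩
      R * ∣ + m ℤ.* (A ℤ.- + b ℤ.* c) ℤ.- + b ℤ.* (T ℤ.- + m ℤ.* c) ∣ ≤⟨ *-monoʳ-≤ R (ℤ.∣i-j∣≤∣i∣+∣j∣ (+ m ℤ.* (A ℤ.- + b ℤ.* c)) _) ⟩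
      R * (∣ + m ℤ.* (A ℤ.- + b ℤ.* c) ∣ + ∣ + b ℤ.* (T ℤ.- + m ℤ.* c) ∣)
        ≡⟨ cong₂ (λ x y → R * (x + y)) (ℤ.abs-* (+ m) (A ℤ.- + b ℤ.* c)) (ℤ.abs-* (+ b) (T ℤ.- + m ℤ.* c)) ⟩
      R * (m * ∣ A ℤ.- + b ℤ.* c ∣ + b * ∣ T ℤ.- + m ℤ.* c ∣) ≤⟨ *-monoʳ-≤ R (+-mono-≤ (*-monoʳ-≤ m hA) (*-monoʳ-≤ b hT)) ⟩
      R * (m * (b * (k * E)) + b * (m * (k * E))) ≡⟨ lem₂ R m b k E ⟩
      R′ * E ≤⟨ small ⟩
      walks (suc k) n ∎
      where
      open ≤-Reasoning
      A = odd-count {suc k} n i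
      T = + walks (suc k) n
      c = N {k} n (last-bit (odd n))
      lem₁ : ∀ m b A T c → m ℤ.* A ℤ.- b ℤ.* T ≡ m ℤ.* (A ℤ.- b ℤ.* c) ℤ.- b ℤ.* (T ℤ.- m ℤ.* c)
      lem₁ = solve-∀
      lem₂ : ∀ R m b k E → R * (m * (b * (k * E)) + b * (m * (k * E))) ≡ R * (2 * (m * b * k)) * E
      lem₂ = NatSolver.solve-∀
      near′ : ∀ p → parity p ≡ odd n → ∣ N n p ℤ.- c ∣ ≤ k * E
      near′ p e = subst (λ x → ∣ N n p ℤ.- N n (last-bit x) ∣ ≤ k * E) e (near p)
      hA : ∣ A ℤ.- + b ℤ.* c ∣ ≤ b * (k * E)
      hA = subst₂ (λ x y → ∣ x ℤ.- + y ℤ.* c ∣ ≤ y * (k * E)) (sym (count-N n (λ p → pop p ≡ᵇ i))) (size-pop (suc k) i)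
        (ΣB-near (λ p → pop p ≡ᵇ i) (N n) c (k * E) λ p e → near′ p
          (trans (parity-pop p) (trans (cong odd (≡ᵇ⇒≡ (pop p) i (Equivalence.from T-≡ e))) par≡)))
      hT : ∣ T ℤ.- + m ℤ.* c ∣ ≤ m * (k * E)
      hT = subst₂ (λ x y → ∣ x ℤ.- + y ℤ.* c ∣ ≤ y * (k * E)) (sym (walks-N k n)) (size-parity k (odd n))
        (ΣB-near (λ p → parity p == odd n) (N n) c (k * E) λ p e → near′ p (==⇒≡ _ _ e))

-- Codes of involutions and lattice words

module LatticeWords where
  open import Data.Nat using (pred; _<_; _≤_; _+_; _≟_; >-nonZero)
  open import Data.Nat.Properties
  open import Data.Integer using (+_)
  open import Data.Fin using (toℕ; fromℕ<)
  open import Data.Fin.Properties using (toℕ-fromℕ<; toℕ-injective; toℕ≤pred[n])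
  open import Data.List using ([]; _∷_; _++_; take; drop; _∷ʳ_; initLast; _∷ʳ′_; [_])
  open import Data.List.Properties using (length-++; take++drop≡id; ∷-injective; ∷ʳ-injective; ++-assoc; length-take)
  open import Data.Unit using (⊤; tt)

  -- An involution of [n + 1] or [n + 2] is built by adding a largest fixed point or
  -- a two-cycle (i , n + 1).
  data Code : ℕ → Set where
    empty : Code 0
    fix   : ∀ {n} → Code n → Code (suc n)
    cyc   : ∀ {n} → Fin (suc n) → Code n → Code (suc (suc n))

  -- Row insertion on lattice words (t ↦ row of the entry t): the first letter s becomes s + 1,
  -- the next letter s + 1 becomes s + 2, and so on; the last carry C yields a new cell in row C,
  -- below which the largest element is put in row C + 1.
  bump : ℕ → List ℕ → List ℕ
  bump s []      = suc s ∷ []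
  bump s (a ∷ v) with a ≟ s
  ... | yes _ = suc s ∷ bump (suc s) v
  ... | no _  = a ∷ bump s v

  word : ∀ {n} → Code n → List ℕ
  word empty     = []
  word (fix c)   = word c ∷ʳ 0
  word (cyc i c) = take (toℕ i) (word c) ++ 0 ∷ bump 0 (drop (toℕ i) (word c))

  length-bump : ∀ s v → length (bump s v) ≡ suc (length v)
  length-bump s [] = refl
  length-bump s (a ∷ v) with a ≟ s
  ... | yes _ = cong suc (length-bump (suc s) v)
  ... | no _  = cong suc (length-bump s v)

  length-word : ∀ {n} (c : Code n) → length (word c) ≡ n
  length-word empty = refl
  length-word (fix c) = trans (length-++ (word c)) (trans (+-comm _ 1) (cong suc (length-word c)))
  length-word {suc (suc n)} (cyc i c) = begin
    length (u ++ 0 ∷ bump 0 v)            ≡⟨ length-++ u ⟩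
    length u + suc (length (bump 0 v))    ≡⟨ cong (λ x → length u + suc x) (length-bump 0 v) ⟩
    length u + suc (suc (length v))       ≡⟨ trans (+-suc (length u) _) (cong suc (+-suc (length u) _)) ⟩
    suc (suc (length u + length v))       ≡⟨ cong (suc ∘ suc) (sym (length-++ u)) ⟩
    suc (suc (length (u ++ v)))           ≡⟨ cong (suc ∘ suc ∘ length) (take++drop≡id (toℕ i) (word c)) ⟩
    suc (suc (length (word c)))           ≡⟨ cong (suc ∘ suc) (length-word c) ⟩
    suc (suc n)                           ∎
    where
    open ≡-Reasoning
    u = take (toℕ i) (word c)
    v = drop (toℕ i) (word c)

  bump-nonempty : ∀ s v → bump s v ≢ []
  bump-nonempty s v e with trans (sym (length-bump s v)) (cong length e)
  ... | ()

  -- The carry can be recovered from right to left, since a letter is equal to the carry after it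
  -- exactly when it was bumped.
  bump-injective : ∀ s v s′ v′ → bump s v ≡ bump s′ v′ → s ≡ s′ × v ≡ v′
  bump-injective s [] s′ [] refl = refl , refl
  bump-injective s [] s′ (a ∷ v′) e with a ≟ s′
  ... | yes _ = ⊥-elim (bump-nonempty (suc s′) v′ (sym (proj₂ (∷-injective e))))
  ... | no _  = ⊥-elim (bump-nonempty s′ v′ (sym (proj₂ (∷-injective e))))
  bump-injective s (a ∷ v) s′ [] e with a ≟ s
  ... | yes _ = ⊥-elim (bump-nonempty (suc s) v (proj₂ (∷-injective e)))
  ... | no _  = ⊥-elim (bump-nonempty s v (proj₂ (∷-injective e)))
  bump-injective s (a ∷ v) s′ (a′ ∷ v′) e with a ≟ s | a′ ≟ s′
  ... | yes refl | yes refl with bump-injective (suc s) v (suc s′) v′ (proj₂ (∷-injective e))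
  ...   | refl , refl = refl , refl
  bump-injective s (a ∷ v) s′ (a′ ∷ v′) e | yes p | no ¬q with bump-injective (suc s) v s′ v′ (proj₂ (∷-injective e))
  ...   | refl , _ = ⊥-elim (¬q (sym (proj₁ (∷-injective e))))
  bump-injective s (a ∷ v) s′ (a′ ∷ v′) e | no ¬p | yes q with bump-injective s v (suc s′) v′ (proj₂ (∷-injective e))
  ...   | refl , _ = ⊥-elim (¬p (proj₁ (∷-injective e)))
  bump-injective s (a ∷ v) s′ (a′ ∷ v′) e | no ¬p | no ¬q with bump-injective s v s′ v′ (proj₂ (∷-injective e))
  ...   | refl , refl = refl , cong (_∷ v) (proj₁ (∷-injective e))

  -- Read from the right, both sides show the same carry, and right after the inserted 0 this carry
  -- is 0. A bump leaves a letter equal to the carry after it only if the letter was raised, hence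
  -- positive; so it cannot produce this 0.
  bump-no-insertion : ∀ s v r v′ → bump s v ≢ r ++ 0 ∷ bump 0 v′
  bump-no-insertion s []      (x ∷ [])    v′ ()
  bump-no-insertion s []      (x ∷ y ∷ r) v′ ()
  bump-no-insertion s (a ∷ v) []      v′ e with a ≟ s
  ... | no ¬p with ∷-injective e
  ...   | refl , t = ¬p (sym (proj₁ (bump-injective s v 0 v′ t)))
  bump-no-insertion s (a ∷ v) (x ∷ r) v′ e with a ≟ s
  ... | yes _ = bump-no-insertion (suc s) v r v′ (proj₂ (∷-injective e))
  ... | no _  = bump-no-insertion s v r v′ (proj₂ (∷-injective e))

  insertion-injective : ∀ u v u′ v′ → u ++ 0 ∷ bump 0 v ≡ u′ ++ 0 ∷ bump 0 v′ → u ≡ u′ × v ≡ v′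
  insertion-injective []      v []       v′ e = refl , proj₂ (bump-injective 0 v 0 v′ (proj₂ (∷-injective e)))
  insertion-injective []      v (x ∷ u′) v′ e = ⊥-elim (bump-no-insertion 0 v u′ v′ (proj₂ (∷-injective e)))
  insertion-injective (x ∷ u) v []       v′ e = ⊥-elim (bump-no-insertion 0 v′ u v (sym (proj₂ (∷-injective e))))
  insertion-injective (x ∷ u) v (y ∷ u′) v′ e with ∷-injective e
  ... | refl , t with insertion-injective u v u′ v′ t
  ...   | refl , q = refl , q

  bump-last : ∀ s v → ∃₂ λ y C → bump s v ≡ y ∷ʳ suc C
  bump-last s [] = [] , s , refl
  bump-last s (a ∷ v) with a ≟ s
  ... | yes _ = let y , C , e = bump-last (suc s) v in suc s ∷ y , C , cong (suc s ∷_) e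
  ... | no _  = let y , C , e = bump-last s v in a ∷ y , C , cong (a ∷_) e

  insertion-last : ∀ u v w → u ++ 0 ∷ bump 0 v ≢ w ∷ʳ 0
  insertion-last u v w e with bump-last 0 v
  ... | y , C , e′ with ∷ʳ-injective (u ++ 0 ∷ y) w (trans (++-assoc u (0 ∷ y) (suc C ∷ [])) (trans (cong (λ x → u ++ 0 ∷ x) (sym e′)) e))
  ...   | _ , ()

  -- The last letter tells the constructors apart: `fix` ends in 0 and an insertion in a positive
  -- letter.
  word-injective : ∀ {n} (c c′ : Code n) → word c ≡ word c′ → c ≡ c′
  word-injective empty empty e = refl
  word-injective (fix c) (fix c′) e = cong fix (word-injective c c′ (proj₁ (∷ʳ-injective (word c) (word c′) e)))
  word-injective (fix c) (cyc i′ c′) e = ⊥-elim (insertion-last (take (toℕ i′) (word c′)) (drop (toℕ i′) (word c′)) (word c) (sym e))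
  word-injective (cyc i c) (fix c′) e = ⊥-elim (insertion-last (take (toℕ i) (word c)) (drop (toℕ i) (word c)) (word c′) e)
  word-injective {suc (suc n)} (cyc i c) (cyc i′ c′) e
    with insertion-injective (take (toℕ i) (word c)) (drop (toℕ i) (word c)) (take (toℕ i′) (word c′)) (drop (toℕ i′) (word c′)) e
  ... | eu , ev = cong₂ cyc
    (toℕ-injective (trans (sym (size i c)) (trans (cong length eu) (size i′ c′))))
    (word-injective c c′ (trans (sym (take++drop≡id (toℕ i) (word c))) (trans (cong₂ _++_ eu ev) (take++drop≡id (toℕ i′) (word c′)))))
    where
    size : ∀ (i : Fin (suc n)) c → length (take (toℕ i) (word c)) ≡ toℕ i
    size i c = trans (length-take (toℕ i) (word c)) (m≤n⇒m⊓n≡m (subst (toℕ i ≤_) (sym (length-word c)) (toℕ≤pred[n] i)))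

  -- Row lengths; a word is a lattice word from the state m if all its prefixes give partitions.
  add : ℕ → (ℕ → ℕ) → ℕ → ℕ
  add r m x with x ≟ r
  ... | yes _ = suc (m x)
  ... | no _  = m x

  add-same : ∀ r m → add r m r ≡ suc (m r)
  add-same r m with r ≟ r
  ... | yes _ = refl
  ... | no ¬p = ⊥-elim (¬p refl)

  add-other : ∀ r m {x} → x ≢ r → add r m x ≡ m x
  add-other r m {x} ne with x ≟ r
  ... | yes p = ⊥-elim (ne p)
  ... | no _  = refl

  add-≤ : ∀ r m x → m x ≤ add r m x
  add-≤ r m x with x ≟ r
  ... | yes _ = n≤1+n (m x)
  ... | no _  = ≤-refl

  add-cong : ∀ r {m m′} → m ≗ m′ → add r m ≗ add r m′
  add-cong r e x with x ≟ r
  ... | yes _ = cong suc (e x)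
  ... | no _  = e x

  add-comm : ∀ r s m → add r (add s m) ≗ add s (add r m)
  add-comm r s m x with x ≟ r in p | x ≟ s in q
  ... | yes _ | yes _ rewrite p | q = refl
  ... | yes _ | no _  rewrite p | q = refl
  ... | no _  | yes _ rewrite p | q = refl
  ... | no _  | no _  rewrite p | q = refl

  Legal : (ℕ → ℕ) → ℕ → Set
  Legal m zero    = ⊤
  Legal m (suc r) = m (suc r) < m r

  Partition : (ℕ → ℕ) → Set
  Partition m = ∀ r → m (suc r) ≤ m r

  data Yam : (ℕ → ℕ) → List ℕ → Set where
    []  : ∀ {m} → Yam m []
    _∷_ : ∀ {m r w} → Legal m r → Yam (add r m) w → Yam m (r ∷ w)

  Legal-cong : ∀ {m m′} r → m ≗ m′ → Legal m r → Legal m′ r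
  Legal-cong zero    e l = tt
  Legal-cong (suc r) e l = subst₂ _<_ (e (suc r)) (e r) l

  Yam-cong : ∀ {m m′ w} → m ≗ m′ → Yam m w → Yam m′ w
  Yam-cong e []            = []
  Yam-cong e (_∷_ {r = r} l y) = Legal-cong r e l ∷ Yam-cong (add-cong r e) y

  suc≢ : ∀ {x} → suc x ≢ x
  suc≢ = 1+n≢n

  add-partition : ∀ {m} r → Partition m → Legal m r → Partition (add r m)
  add-partition {m} r P l x with suc x ≟ r
  ... | no ¬p = ≤-trans (P x) (add-≤ r m x)
  ... | yes refl = ≤-trans l (add-≤ r m x)

  Legal-bump : ∀ {m m′} s → Partition m → m′ ≗ add s m → Legal m′ (suc s)
  Legal-bump {m} {m′} s P e = begin-strict
    m′ (suc s)     ≡⟨ trans (e (suc s)) (add-other s m suc≢) ⟩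
    m (suc s)      ≤⟨ P s ⟩
    m s            <⟨ n<1+n (m s) ⟩
    suc (m s)      ≡⟨ sym (trans (e s) (add-same s m)) ⟩
    m′ s           ∎
    where open ≤-Reasoning

  Legal-add : ∀ {m} s r → r ≢ s → Legal m r → Legal (add s m) r
  Legal-add {m} s zero    ne l = tt
  Legal-add {m} s (suc r) ne l = subst (_< add s m r) (sym (add-other s m ne)) (≤-trans l (add-≤ s m r))

  -- The new rows are the old ones with a surplus cell in row s, the carry. This cell makes the
  -- letter s + 1 legal, and when the old letter s is read the surplus moves on to row s + 1.
  Yam-bump : ∀ {m m′} s v → Partition m → m′ ≗ add s m → Yam m v → Yam m′ (bump s v)
  Yam-bump s [] P e [] = Legal-bump s P e ∷ []
  Yam-bump {m} {m′} s (a ∷ v) P e (l ∷ y) with a ≟ s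
  ... | yes refl = Legal-bump s P e ∷ Yam-bump (suc s) v (add-partition s P l) (add-cong (suc s) e) y
  ... | no ¬p = Legal-cong a (sym ∘ e) (Legal-add s a ¬p l)
              ∷ Yam-bump s v (add-partition a P l) (λ x → trans (add-cong a e x) (add-comm a s m x)) y

  Yam-insert : ∀ {m} u v → Partition m → Yam m (u ++ v) → Yam m (u ++ 0 ∷ bump 0 v)
  Yam-insert []      v P y       = tt ∷ Yam-bump 0 v P (λ _ → refl) y
  Yam-insert (a ∷ u) v P (l ∷ y) = l ∷ Yam-insert u v (add-partition a P l) y

  Yam-∷ʳ0 : ∀ {m w} → Yam m w → Yam m (w ∷ʳ 0)
  Yam-∷ʳ0 []      = tt ∷ []
  Yam-∷ʳ0 (l ∷ y) = l ∷ Yam-∷ʳ0 y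

  none : ℕ → ℕ
  none _ = 0

  Yam-word : ∀ {n} (c : Code n) → Yam none (word c)
  Yam-word empty     = []
  Yam-word (fix c)   = Yam-∷ʳ0 (Yam-word c)
  Yam-word (cyc i c) = Yam-insert (take (toℕ i) (word c)) _ (λ _ → z≤n)
    (subst (Yam none) (sym (take++drop≡id (toℕ i) (word c))) (Yam-word c))

  sub : ℕ → (ℕ → ℕ) → ℕ → ℕ
  sub r m x with x ≟ r
  ... | yes _ = pred (m x)
  ... | no _  = m x

  add-sub : ∀ r m → 0 < m r → m ≗ add r (sub r m)
  add-sub r m pos x with x ≟ r in p
  ... | yes refl rewrite p = sym (suc-pred (m x) ⦃ >-nonZero pos ⦄)
  ... | no _ rewrite p = refl

  add-injective : ∀ r {m m′} → add r m ≗ add r m′ → m ≗ m′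
  add-injective r {m} {m′} e x with x ≟ r | e x
  ... | yes _ | q = suc-injective q
  ... | no _  | q = q

  sub-partition : ∀ {m} s → Partition m → m (suc s) < m s → Partition (sub s m)
  sub-partition {m} s P h r with suc r ≟ s | r ≟ s
  ... | yes _ | yes refl = ≤-trans pred[n]≤n (<⇒≤pred h)
  ... | yes _ | no _     = ≤-trans pred[n]≤n (P r)
  ... | no _  | yes refl = <⇒≤pred h
  ... | no _  | no _     = P r

  Legal-sub : ∀ {m} s → Partition m → 0 < m s → Legal (sub s m) s
  Legal-sub zero    P pos = tt
  Legal-sub {m} (suc s) P pos with suc s ≟ suc s | s ≟ suc s
  ... | _      | yes e = ⊥-elim (suc≢ (sym e))
  ... | no ¬p  | _     = ⊥-elim (¬p refl)
  ... | yes _  | no _  = ≤-trans (≤-reflexive (suc-pred (m (suc s)) ⦃ >-nonZero pos ⦄)) (P s)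

  -- The result of undoing the insertion on a suffix: either the carry is still s, or the inserted
  -- letter has been met.
  Unbumped : (ℕ → ℕ) → List ℕ → Set
  Unbumped m′ y =
    (∃ λ s → ∃ λ m → ∃ λ v → m′ ≗ add s m × Partition m × Yam m v × bump s v ≡ y)
    ⊎ (∃₂ λ u v → y ≡ u ++ 0 ∷ bump 0 v × Yam m′ (u ++ v))

  bump-hit : ∀ s v → bump s (s ∷ v) ≡ suc s ∷ bump (suc s) v
  bump-hit s v with s ≟ s
  ... | yes _ = refl
  ... | no ¬p = ⊥-elim (¬p refl)

  bump-miss : ∀ {a} s v → a ≢ s → bump s (a ∷ v) ≡ a ∷ bump s v
  bump-miss {a} s v ne with a ≟ s
  ... | yes p = ⊥-elim (ne p)
  ... | no _  = refl

  -- Induction from the right end: the last letter C + 1 gives the carry C. A letter equal to the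
  -- carry s was raised from s - 1, or is the inserted 0 when s = 0; every other letter was passed
  -- over.
  unbump : ∀ {m′} y C → Partition m′ → Yam m′ (y ∷ʳ suc C) → Unbumped m′ (y ∷ʳ suc C)
  unbump {m′} [] C P (l ∷ []) = inj₁ (C , sub C m′ , [] , add-sub C m′ (≤-trans (s≤s z≤n) l) , sub-partition C P l , [] , refl)
  unbump {m′} (a ∷ y) C P (l ∷ ys) with unbump y C (add-partition a P l) ys
  ... | inj₂ (u , v , e , yam) = inj₂ (a ∷ u , v , cong (a ∷_) e , l ∷ yam)
  ... | inj₁ (s , m , v , eq , Pm , yam , e) with a ≟ s
  ...   | yes refl = hit a l eq e
    where
    hit : ∀ a → Legal m′ a → add a m′ ≗ add a m → bump a v ≡ y ∷ʳ suc C → Unbumped m′ (a ∷ y ∷ʳ suc C)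
    hit zero    l eq e = inj₂ ([] , v , cong (0 ∷_) (sym e) , Yam-cong (sym ∘ add-injective 0 eq) yam)
    hit (suc b) l eq e = inj₁ (b , sub b m′ , b ∷ v , m′≗ , sub-partition b P l
        , Legal-sub b P pos ∷ Yam-cong (λ x → trans (sym (add-injective (suc b) eq x)) (m′≗ x)) yam
        , trans (bump-hit b v) (cong (suc b ∷_) e))
      where
      pos : 0 < m′ b
      pos = ≤-trans (s≤s z≤n) l
      m′≗ = add-sub b m′ pos
  ...   | no a≢s = inj₁ (s , sub s m′ , a ∷ v , m′≗ , sub-partition s P strict , legal a a≢s l eq ∷ Yam-cong m≗ yam
        , trans (bump-miss s v a≢s) (cong (a ∷_) e))
    where
    m′s : m′ s ≡ suc (m s)
    m′s = trans (sym (add-other a m′ (a≢s ∘ sym))) (trans (eq s) (add-same s m))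
    pos : 0 < m′ s
    pos = ≤-trans (s≤s z≤n) (≤-reflexive (sym m′s))
    m′≗ = add-sub s m′ pos
    m≗ : m ≗ add a (sub s m′)
    m≗ = add-injective s (λ x → trans (sym (eq x)) (trans (add-cong a m′≗ x) (add-comm a s (sub s m′) x)))
    strict : m′ (suc s) < m′ s
    strict = begin-strict
      m′ (suc s)        ≤⟨ add-≤ a m′ (suc s) ⟩
      add a m′ (suc s)  ≡⟨ trans (eq (suc s)) (add-other s m suc≢) ⟩
      m (suc s)         ≤⟨ Pm s ⟩
      m s               <⟨ n<1+n (m s) ⟩
      suc (m s)         ≡⟨ sym m′s ⟩
      m′ s              ∎
      where open ≤-Reasoning
    legal : ∀ a → a ≢ s → Legal m′ a → add a m′ ≗ add s m → Legal (sub s m′) a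
    legal zero    ne l eq = tt
    legal (suc b) ne l eq with suc b ≟ s | b ≟ s
    ... | yes p | _        = ⊥-elim (ne p)
    ... | no _  | no _     = l
    -- The removed cell lies in row a - 1, the one case in which it can affect the legality of a;
    -- the room left comes from `m` being a partition.
    ... | no _  | yes refl = begin-strict
      m′ (suc b)              <⟨ n<1+n (m′ (suc b)) ⟩
      suc (m′ (suc b))        ≡⟨ sym (add-same (suc b) m′) ⟩
      add (suc b) m′ (suc b)  ≡⟨ trans (eq (suc b)) (add-other b m suc≢) ⟩
      m (suc b)               ≤⟨ Pm b ⟩
      m b                     ≡⟨ cong pred (sym m′s) ⟩
      pred (m′ b)             ∎
      where open ≤-Reasoning

  Yam-init : ∀ {m} w {x} → Yam m (w ∷ʳ x) → Yam m w
  Yam-init []      y       = []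
  Yam-init (a ∷ w) (l ∷ y) = l ∷ Yam-init w y

  word-surjective : ∀ n w → length w ≡ n → Yam none w → ∃ λ (c : Code n) → word c ≡ w
  word-surjective zero [] e y = empty , refl
  word-surjective (suc n) w e y with initLast w
  ... | w′ ∷ʳ′ zero with word-surjective n w′ (suc-injective (trans (sym (trans (length-++ w′) (+-comm _ 1))) e)) (Yam-init w′ y)
  ...   | c , refl = fix c , refl
  word-surjective (suc n) .(w′ ∷ʳ suc C) e y | w′ ∷ʳ′ suc C with unbump w′ C (λ _ → z≤n) y
  -- The empty state has no surplus cell, so the inserted 0 must have been met.
  ...   | inj₁ (s , m , _ , eq , _) with () ← trans (eq s) (add-same s m)
  ...   | inj₂ (u , v , eq , yam) = go n (trans (sym e) (trans (cong length eq) (trans (length-++ u) (cong (_+_ (length u)) (cong suc (length-bump 0 v))))))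
    where
    go : ∀ n → suc n ≡ length u + suc (suc (length v)) → ∃ λ (c : Code (suc n)) → word c ≡ w′ ∷ʳ suc C
    go zero e with () ← trans e (trans (+-suc (length u) _) (cong suc (+-suc (length u) _)))
    go (suc n) e with word-surjective n (u ++ v) len yam
      where
      len = sym (suc-injective (suc-injective (trans e (trans (+-suc (length u) _) (cong suc (trans (+-suc (length u) _) (cong suc (sym (length-++ u)))))))))
    ... | c , e′ = cyc (fromℕ< u<) c , trans (cong (λ i → take i (word c) ++ 0 ∷ bump 0 (drop i (word c))) (toℕ-fromℕ< u<))
        (trans (cong (λ w → take (length u) w ++ 0 ∷ bump 0 (drop (length u) w)) e′)
          (trans (cong₂ (λ x y → x ++ 0 ∷ bump 0 y) (take-++ u v) (drop-++ u v)) (sym eq)))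
      where
      u< : length u < suc n
      u< = s≤s (≤-trans (m≤m+n (length u) (length v)) (≤-reflexive (trans (sym (length-++ u)) (trans (cong length (sym e′)) (length-word c)))))
      take-++ : ∀ (u v : List ℕ) → take (length u) (u ++ v) ≡ u
      take-++ []      v = refl
      take-++ (x ∷ u) v = cong (x ∷_) (take-++ u v)
      drop-++ : ∀ (u v : List ℕ) → drop (length u) (u ++ v) ≡ v
      drop-++ []      v = refl
      drop-++ (x ∷ u) v = drop-++ u v

-- Involutions from codes and their longest increasing subsequences

module IncreasingChains where
  open import Data.Nat using (pred; _<_; _≤_; _+_; _⊔_; _≟_; _<?_; _≤?_)
  open import Data.Nat.Properties
  open import Data.Integer using (+_)
  open import Data.Fin using (toℕ; fromℕ<)
  open import Data.Fin.Properties using (toℕ-fromℕ<; toℕ-injective; toℕ≤pred[n])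
  open import Data.List using ([]; _∷_; _++_; take; drop; _∷ʳ_)
  open import Data.List.Properties using (take++drop≡id; length-take)
  open import Relation.Nullary using (¬_)
  open LatticeWords

  -- `up i` enumerates ℕ without i in increasing order and `down i` is its left inverse. On strict
  -- upper bounds the two are adjoint: up i q < y exactly when q < down i y.
  up down : ℕ → ℕ → ℕ
  up i x with x <? i
  ... | yes _ = x
  ... | no _  = suc x
  down i x with x ≤? i
  ... | yes _ = x
  ... | no _  = pred x

  down-up : ∀ i x → down i (up i x) ≡ x
  down-up i x with x <? i
  ... | yes x<i with x ≤? i
  ...   | yes _ = refl
  ...   | no ¬p = ⊥-elim (¬p (<⇒≤ x<i))
  down-up i x | no x≮i with suc x ≤? i
  ...   | yes p = ⊥-elim (x≮i p)
  ...   | no _  = refl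

  up-down : ∀ i {x} → x ≢ i → up i (down i x) ≡ x
  up-down i {x} ne with x ≤? i
  ... | yes p with x <? i
  ...   | yes _ = refl
  ...   | no ¬q = ⊥-elim (ne (≤-antisym p (≮⇒≥ ¬q)))
  up-down i {zero}  ne | no ¬p = ⊥-elim (¬p z≤n)
  up-down i {suc x} ne | no ¬p with x <? i
  ...   | yes q = ⊥-elim (¬p q)
  ...   | no _  = refl

  up≢ : ∀ i x → up i x ≢ i
  up≢ i x e with x <? i
  ... | yes p = <-irrefl e p
  ... | no ¬p = ¬p (≤-reflexive e)

  up-≤ : ∀ i x → up i x ≤ suc x
  up-≤ i x with x <? i
  ... | yes _ = n≤1+n x
  ... | no _  = ≤-refl

  down-small : ∀ i {x} → x ≤ i → down i x ≡ x
  down-small i {x} le with x ≤? i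
  ... | yes _ = refl
  ... | no ¬p = ⊥-elim (¬p le)

  down-large : ∀ i {x} → i ≤ x → down i (suc x) ≡ x
  down-large i {x} le with suc x ≤? i
  ... | yes p = ⊥-elim (<⇒≱ p le)
  ... | no _  = refl

  up<⇒<down : ∀ i q y → up i q < y → q < down i y
  up<⇒<down i q y h with q <? i | y ≤? i
  ... | yes _   | yes _ = h
  ... | yes q<i | no ¬p = ≤-trans q<i (<⇒≤pred (≰⇒> ¬p))
  ... | no q≮i  | yes p = ⊥-elim (q≮i (≤-trans (<⇒≤ h) p))
  ... | no _    | no _  = <⇒≤pred h

  <down⇒up< : ∀ i q y → q < down i y → up i q < y
  <down⇒up< i q y h with q <? i | y ≤? i
  ... | yes _   | yes _ = h
  ... | yes q<i | no ¬p = <-trans q<i (≰⇒> ¬p)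
  ... | no q≮i  | yes p = ⊥-elim (q≮i (≤-trans h p))
  <down⇒up< i q zero    h | no _ | no _ = ⊥-elim (n≮0 h)
  <down⇒up< i q (suc y) h | no _ | no _ = s≤s h

  down-< : ∀ {i p x} → p ≢ i → p < x → down i p < down i x
  down-< {i} {p} {x} ne h = up<⇒<down i (down i p) x (subst (_< x) (sym (up-down i ne)) h)

  fn : ∀ {n} → Code n → ℕ → ℕ
  fn empty p = p
  fn (fix {n} c) p with p ≟ n
  ... | yes _ = n
  ... | no _  = fn c p
  fn (cyc {n} i c) p with p ≟ suc n | p ≟ toℕ i
  ... | yes _ | _     = toℕ i
  ... | no _  | yes _ = suc n
  ... | no _  | no _  = up (toℕ i) (fn c (down (toℕ i) p))

  module _ {n} (c : Code n) where

    fn-fix-top : fn (fix c) n ≡ n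
    fn-fix-top with n ≟ n
    ... | yes _ = refl
    ... | no ¬p = ⊥-elim (¬p refl)

    fn-fix-old : ∀ {p} → p ≢ n → fn (fix c) p ≡ fn c p
    fn-fix-old {p} ne with p ≟ n
    ... | yes e = ⊥-elim (ne e)
    ... | no _  = refl

    module _ (i : Fin (suc n)) where

      i≤n : toℕ i ≤ n
      i≤n = toℕ≤pred[n] i

      fn-cyc-top : fn (cyc i c) (suc n) ≡ toℕ i
      fn-cyc-top with suc n ≟ suc n
      ... | yes _ = refl
      ... | no ¬p = ⊥-elim (¬p refl)

      fn-cyc-i : fn (cyc i c) (toℕ i) ≡ suc n
      fn-cyc-i with toℕ i ≟ suc n | toℕ i ≟ toℕ i
      ... | yes e | _     = e
      ... | no _  | yes _ = refl
      ... | no _  | no ¬p = ⊥-elim (¬p refl)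

      fn-cyc-old : ∀ {p} → p ≢ suc n → p ≢ toℕ i → fn (cyc i c) p ≡ up (toℕ i) (fn c (down (toℕ i) p))
      fn-cyc-old {p} ne₁ ne₂ with p ≟ suc n | p ≟ toℕ i
      ... | yes e | _     = ⊥-elim (ne₁ e)
      ... | no _  | yes e = ⊥-elim (ne₂ e)
      ... | no _  | no _  = refl

  Involutive : ℕ → (ℕ → ℕ) → Set
  Involutive n f = ∀ p → p < n → f p < n × f (f p) ≡ p

  fn-involutive : ∀ {n} (c : Code n) → Involutive n (fn c)
  fn-involutive (fix {n} c) p p< with p ≟ n
  ... | yes refl = n<1+n n , fn-fix-top c
  ... | no ne = let b , e = fn-involutive c p (≤∧≢⇒< (≤-pred p<) ne) in
    m<n⇒m<1+n b , trans (fn-fix-old c (<⇒≢ b)) e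
  fn-involutive (cyc {n} i c) p p< with p ≟ suc n | p ≟ toℕ i
  ... | yes refl | _ = s≤s (m≤n⇒m≤1+n (i≤n c i)) , fn-cyc-i c i
  ... | no _ | yes refl = ≤-refl , fn-cyc-top c i
  ... | no ne | no ne′ = m<n⇒m<1+n r< , trans (fn-cyc-old c i (<⇒≢ r<) (up≢ _ _))
      (trans (cong (up (toℕ i) ∘ fn c) (down-up (toℕ i) _)) (trans (cong (up (toℕ i)) (proj₂ ih)) (up-down (toℕ i) ne′)))
    where
    q< : down (toℕ i) p < n
    q< = subst (down (toℕ i) p <_) (down-large (toℕ i) (i≤n c i)) (down-< ne′ (≤∧≢⇒< (≤-pred p<) ne))
    ih = fn-involutive c (down (toℕ i) p) q<
    r< : up (toℕ i) (fn c (down (toℕ i) p)) < suc n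
    r< = s≤s (≤-trans (up-≤ (toℕ i) _) (proj₁ ih))

  fn-surjective : ∀ n f → Involutive n f → ∃ λ (c : Code n) → ∀ p → p < n → fn c p ≡ f p
  fn-surjective zero f inv = empty , λ p ()
  fn-surjective (suc m) f inv with f m ≟ m
  ... | yes e with fn-surjective m f (λ p p< →
          ≤∧≢⇒< (≤-pred (proj₁ (inv p (m<n⇒m<1+n p<))))
            (λ e′ → <⇒≢ p< (trans (sym (proj₂ (inv p (m<n⇒m<1+n p<)))) (trans (cong f e′) e)))
          , proj₂ (inv p (m<n⇒m<1+n p<)))
  ...   | c , h = fix c , agree
    where
    agree : ∀ p → p < suc m → fn (fix c) p ≡ f p
    agree p p< with p ≟ m
    ... | yes refl = sym e
    ... | no ne    = h p (≤∧≢⇒< (≤-pred p<) ne)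
  fn-surjective (suc m) f inv | no ne = go m ne inv
    where
    go : ∀ m → f m ≢ m → Involutive (suc m) f → ∃ λ (c : Code (suc m)) → ∀ p → p < suc m → fn c p ≡ f p
    go zero ne inv = ⊥-elim (ne (n<1⇒n≡0 (proj₁ (inv 0 ≤-refl))))
    go (suc n) ne inv = cyc i′ (proj₁ ih) , agree
      where
      i = f (suc n)
      i< : i < suc n
      i< = ≤∧≢⇒< (≤-pred (proj₁ (inv (suc n) ≤-refl))) ne
      i′ = fromℕ< i<
      f-i : f i ≡ suc n
      f-i = proj₂ (inv (suc n) ≤-refl)
      g : ℕ → ℕ
      g = down i ∘ f ∘ up i
      old : ∀ p → p < suc n → p ≢ i → f p ≢ i × f p < suc n
      old p p< p≢i = (λ e → <⇒≢ p< (trans (sym (proj₂ iv)) (trans (cong f e) f-i)))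
        , ≤∧≢⇒< (≤-pred (proj₁ iv)) (λ e → p≢i (trans (sym (proj₂ iv)) (cong f e)))
        where iv = inv p (m<n⇒m<1+n p<)
      up< : ∀ p → p < n → up i p < suc n
      up< p p< = s≤s (≤-trans (up-≤ i p) p<)
      g-inv : Involutive n g
      g-inv p p< = subst (g p <_) (down-large i (≤-pred i<)) (down-< (proj₁ o) (proj₂ o))
        , trans (cong (down i ∘ f) (up-down i (proj₁ o))) (trans (cong (down i) (proj₂ (inv (up i p) (m<n⇒m<1+n (up< p p<))))) (down-up i p))
        where o = old (up i p) (up< p p<) (up≢ i p)
      ih = fn-surjective n g g-inv
      agree : ∀ p → p < suc (suc n) → fn (cyc i′ (proj₁ ih)) p ≡ f p
      agree p p< with p ≟ suc n | p ≟ toℕ i′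
      ... | yes refl | _ = toℕ-fromℕ< i<
      ... | no _ | yes e = sym (trans (cong f (trans e (toℕ-fromℕ< i<))) f-i)
      ... | no ne₁ | no ne₂ = trans (cong (λ j → up j (fn (proj₁ ih) (down j p))) (toℕ-fromℕ< i<))
            (trans (cong (up i) (proj₂ ih (down i p) q<)) (trans (cong (up i ∘ down i ∘ f) (up-down i p≢i)) (up-down i (proj₁ (old p p<′ p≢i)))))
        where
        p≢i = λ e → ne₂ (trans e (sym (toℕ-fromℕ< i<)))
        p<′ = ≤∧≢⇒< (≤-pred p<) ne₁
        q< : down i p < n
        q< = subst (down i p <_) (down-large i (≤-pred i<)) (down-< p≢i p<′)

  fn-injective : ∀ {n} (c c′ : Code n) → (∀ p → p < n → fn c p ≡ fn c′ p) → c ≡ c′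
  fn-injective empty empty h = refl
  fn-injective (fix {n} c) (fix c′) h = cong fix (fn-injective c c′ λ p p< →
    trans (sym (fn-fix-old c (<⇒≢ p<))) (trans (h p (m<n⇒m<1+n p<)) (fn-fix-old c′ (<⇒≢ p<))))
  fn-injective (fix c) (cyc {n} i c′) h = ⊥-elim (<⇒≢ (s≤s (i≤n c′ i)) (sym (trans (sym (fn-fix-top c)) (trans (h (suc n) ≤-refl) (fn-cyc-top c′ i)))))
  fn-injective (cyc {n} i c) (fix c′) h = ⊥-elim (<⇒≢ (s≤s (i≤n c i)) (trans (sym (fn-cyc-top c i)) (trans (h (suc n) ≤-refl) (fn-fix-top c′))))
  fn-injective (cyc {n} i c) (cyc i′ c′) h with toℕ-injective (trans (sym (fn-cyc-top c i)) (trans (h (suc n) ≤-refl) (fn-cyc-top c′ i′)))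
  ... | refl = cong (cyc i) (fn-injective c c′ agree)
    where
    agree : ∀ q → q < n → fn c q ≡ fn c′ q
    agree q q< = trans (sym (down-up (toℕ i) (fn c q))) (trans (cong (down (toℕ i)) eq) (down-up (toℕ i) (fn c′ q)))
      where
      p< : up (toℕ i) q < suc n
      p< = s≤s (≤-trans (up-≤ (toℕ i) q) q<)
      val : ∀ (c : Code n) → fn (cyc i c) (up (toℕ i) q) ≡ up (toℕ i) (fn c q)
      val c = trans (fn-cyc-old c i (<⇒≢ p<) (up≢ _ q)) (cong (up (toℕ i) ∘ fn c) (down-up (toℕ i) q))
      eq = trans (sym (val c)) (trans (h _ (m<n⇒m<1+n p<)) (val c′))

  -- Chain f x y m: there are p₁ < ⋯ < pₘ < x with f p₁ < ⋯ < f pₘ < y.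
  data Chain (f : ℕ → ℕ) : ℕ → ℕ → ℕ → Set where
    nil  : ∀ {x y} → Chain f x y 0
    step : ∀ {x y m} p → p < x → f p < y → Chain f p (f p) m → Chain f x y (suc m)

  chain-mono : ∀ {f x x′ y y′ m} → x ≤ x′ → y ≤ y′ → Chain f x y m → Chain f x′ y′ m
  chain-mono a b nil             = nil
  chain-mono a b (step p u v ch) = step p (≤-trans u a) (≤-trans v b) ch

  chain-shorter : ∀ {f x y m m′} → m′ ≤ m → Chain f x y m → Chain f x y m′
  chain-shorter {m′ = zero}   h nil = nil
  chain-shorter {m′ = zero}   h (step p u v ch) = nil
  chain-shorter {m′ = suc m′} (s≤s h) (step p u v ch) = step p u v (chain-shorter h ch)

  chain-at : ∀ {f x x′ y y′ m} → x ≡ x′ → y ≡ y′ → Chain f x y m → Chain f x′ y′ m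
  chain-at refl refl ch = ch

  -- The graph of an involution is symmetric, so positions and values may be exchanged; x ≤ n keeps
  -- all positions where f is its own inverse.
  chain-sym : ∀ {n f} → Involutive n f → ∀ {x y m} → x ≤ n → Chain f x y m → Chain f y x m
  chain-sym inv h nil = nil
  chain-sym {f = f} inv {x} h (step p u v ch) = step (f p) v (subst (_< x) (sym e) u)
      (chain-at refl (sym e) (chain-sym inv (≤-trans (<⇒≤ u) h) ch))
    where e = proj₂ (inv p (≤-trans u h))

  chain-cong : ∀ {f g} {x y m} → (∀ p → p < x → f p ≡ g p) → Chain f x y m → Chain g x y m
  chain-cong h nil = nil
  chain-cong {f} {g} {x} {y} h (step p u v ch) = step p u (subst (_< y) (h p u) v)
    (chain-at refl (h p u) (chain-cong (λ q q< → h q (<-trans q< u)) ch))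

  zeros : ℕ → List ℕ → ℕ
  zeros zero    w           = 0
  zeros (suc y) []          = 0
  zeros (suc y) (zero ∷ w)  = suc (zeros y w)
  zeros (suc y) (suc _ ∷ w) = zeros y w

  zeros-[] : ∀ y → zeros y [] ≡ 0
  zeros-[] zero    = refl
  zeros-[] (suc y) = refl

  zeros-prefix : ∀ y u v → y ≤ length u → zeros y (u ++ v) ≡ zeros y u
  zeros-prefix zero    u           v h       = refl
  zeros-prefix (suc y) (zero ∷ u)  v (s≤s h) = cong suc (zeros-prefix y u v h)
  zeros-prefix (suc y) (suc _ ∷ u) v (s≤s h) = zeros-prefix y u v h

  zeros-beyond : ∀ y w → length w ≤ y → zeros (suc y) w ≡ zeros y w
  zeros-beyond y       []          h       = sym (zeros-[] y)
  zeros-beyond (suc y) (zero ∷ w)  (s≤s h) = cong suc (zeros-beyond y w h)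
  zeros-beyond (suc y) (suc _ ∷ w) (s≤s h) = zeros-beyond y w h

  zeros-∷ʳ0 : ∀ w → zeros (suc (length w)) (w ∷ʳ 0) ≡ suc (zeros (length w) w)
  zeros-∷ʳ0 []          = refl
  zeros-∷ʳ0 (zero ∷ w)  = cong suc (zeros-∷ʳ0 w)
  zeros-∷ʳ0 (suc _ ∷ w) = zeros-∷ʳ0 w

  zeros-bump-suc : ∀ y s v → zeros y (bump (suc s) v) ≡ zeros y v
  zeros-bump-suc zero    s v  = refl
  zeros-bump-suc (suc y) s [] = zeros-[] y
  zeros-bump-suc (suc y) s (a ∷ v) with a ≟ suc s
  ... | yes refl = zeros-bump-suc y (suc s) v
  zeros-bump-suc (suc y) s (zero ∷ v)  | no _ = cong suc (zeros-bump-suc y s v)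
  zeros-bump-suc (suc y) s (suc _ ∷ v) | no _ = zeros-bump-suc y s v

  zeros-bump-zero : ∀ y v → zeros y (bump 0 v) ≡ pred (zeros y v)
  zeros-bump-zero zero    v  = refl
  zeros-bump-zero (suc y) [] = zeros-[] y
  zeros-bump-zero (suc y) (zero ∷ v)  = zeros-bump-suc y 0 v
  zeros-bump-zero (suc y) (suc _ ∷ v) = zeros-bump-zero y v

  -- Schensted's rule for the first row: the inserted 0 replaces the next 0 after it, if any, which
  -- `bump 0` turns into 1. The maximum records whether that next 0 lies within the first y letters.
  zeros-insert : ∀ y u v → length u ≤ y →
    zeros (suc y) (u ++ 0 ∷ bump 0 v) ≡ zeros y (u ++ v) ⊔ suc (zeros (length u) (u ++ v))
  zeros-insert y [] v h = trans (cong suc (zeros-bump-zero y v)) (lem (zeros y v))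
    where
    lem : ∀ z → suc (pred z) ≡ z ⊔ 1
    lem zero    = refl
    lem (suc z) = cong suc (sym (⊔-identityʳ z))
  zeros-insert (suc y) (zero ∷ u)  v (s≤s h) = cong suc (zeros-insert y u v h)
  zeros-insert (suc y) (suc _ ∷ u) v (s≤s h) = zeros-insert y u v h

  Longest : ∀ {n} → Code n → ℕ → Set
  Longest {n} c y = (∀ m → Chain (fn c) n y m → m ≤ zeros y (word c)) × Chain (fn c) n y (zeros y (word c))

  -- Schensted: the zeros of the word mark the first row of the tableau, whose t-th entry is the least
  -- end value of an increasing subsequence of length t. A new two-cycle (i , n + 1) adds the value i
  -- at the end and the largest value at position i; the symmetry of the involution shows
  -- that the latter has no effect on the first row.
  longest : ∀ {n} (c : Code n) y → y ≤ n → Longest c y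
  longest empty zero _ = (λ { zero nil → z≤n ; (suc m) (step p () v ch) }) , nil
  longest (fix {n} c) y y≤ with y ≟ suc n
  ... | no ne = (λ m ch → subst (m ≤_) (sym z≡) (proj₁ ih m (restrict ch)))
              , subst (Chain _ _ y) (sym z≡) (chain-mono (n≤1+n n) ≤-refl (chain-cong (λ p p< → sym (fn-fix-old c (<⇒≢ p<))) (proj₂ ih)))
    where
    y≤n : y ≤ n
    y≤n = ≤-pred (≤∧≢⇒< y≤ ne)
    ih = longest c y y≤n
    z≡ : zeros y (word c ∷ʳ 0) ≡ zeros y (word c)
    z≡ = zeros-prefix y (word c) _ (subst (y ≤_) (sym (length-word c)) y≤n)
    restrict : ∀ {m} → Chain (fn (fix c)) (suc n) y m → Chain (fn c) n y m
    restrict nil = nil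
    restrict (step p u v ch) with p ≟ n
    ... | yes refl = ⊥-elim (<⇒≱ v y≤n)
    ... | no p≢n = step p p< v (chain-cong (λ q q< → fn-fix-old c (<⇒≢ (<-trans q< p<))) ch)
      where p< = ≤∧≢⇒< (≤-pred u) p≢n
  ... | yes refl = (λ m ch → subst (m ≤_) (sym z≡) (bound ch))
                 , subst (Chain _ _ (suc n)) (sym z≡) (step n ≤-refl (≤-reflexive (cong suc (fn-fix-top c)))
                     (chain-at refl (sym (fn-fix-top c)) (chain-cong {fn c} {fn (fix c)} (λ p p< → sym (fn-fix-old c (<⇒≢ p<))) (proj₂ ih))))
    where
    ih = longest c n ≤-refl
    z≡ : zeros (suc n) (word c ∷ʳ 0) ≡ suc (zeros n (word c))
    z≡ = subst (λ k → zeros (suc k) (word c ∷ʳ 0) ≡ suc (zeros k (word c))) (length-word c) (zeros-∷ʳ0 (word c))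
    bound : ∀ {m} → Chain (fn (fix c)) (suc n) (suc n) m → m ≤ suc (zeros n (word c))
    bound nil = z≤n
    bound {suc m} (step p u v ch) with p ≟ n
    ... | yes refl = s≤s (proj₁ ih m (chain-cong (λ q q< → fn-fix-old c (<⇒≢ q<)) ch))
    ... | no p≢n = m≤n⇒m≤1+n (proj₁ ih (suc m) (step p p< (proj₁ (fn-involutive c p p<))
        (chain-cong (λ q q< → fn-fix-old c (<⇒≢ (<-trans q< p<))) ch)))
      where p< = ≤∧≢⇒< (≤-pred u) p≢n
  longest (cyc {n} i c) y y≤ = result (y ≤? j)
    where
    j = toℕ i
    f = fn c
    f′ = fn (cyc i c)
    w = word c
    u = take j w
    v = drop j w
    j≤n = i≤n c i
    len-u : length u ≡ j
    len-u = trans (length-take j w) (m≤n⇒m⊓n≡m (subst (j ≤_) (sym (length-word c)) j≤n))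
    u++v : u ++ v ≡ w
    u++v = take++drop≡id j w
    down-top : down j (suc n) ≡ n
    down-top = down-large j j≤n

    to-old : ∀ {x y m} → x ≤ suc n → y ≤ suc n → Chain f′ x y m → Chain f (down j x) (down j y) m
    to-old hx hy nil = nil
    to-old {x} {y} hx hy (step p p< v ch) = step (down j p) (down-< p≢j p<)
        (up<⇒<down j (f (down j p)) y (subst (_< y) e v))
        (chain-at refl (trans (cong (down j) e) (down-up j _))
          (to-old (≤-trans (<⇒≤ p<) hx) (≤-trans (<⇒≤ v) hy) ch))
      where
      -- Position i carries the value n + 1, which is not below y ≤ n + 1.
      p≢j : p ≢ j
      p≢j refl = <⇒≱ v (≤-trans hy (≤-reflexive (sym (fn-cyc-i c i))))
      e = fn-cyc-old c i (<⇒≢ (≤-trans p< hx)) p≢j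

    to-new : ∀ {x y m} → x ≤ suc n → Chain f (down j x) (down j y) m → Chain f′ x y m
    to-new hx nil = nil
    to-new {x} {y} hx (step q q< v ch) = step (up j q) p< (subst (_< y) (sym e) (<down⇒up< j (f q) y v))
        (to-new (≤-trans (<⇒≤ p<) hx) (chain-at (sym (down-up j q)) (sym (trans (cong (down j) e) (down-up j (f q)))) ch))
      where
      p< = <down⇒up< j q x q<
      e : f′ (up j q) ≡ up j (f q)
      e = trans (fn-cyc-old c i (<⇒≢ (≤-trans p< hx)) (up≢ j q)) (cong (up j ∘ f) (down-up j q))

    below-j : ∀ {m} → Chain f′ (suc n) j m → m ≤ zeros j w
    below-j ch = proj₁ (longest c j j≤n) _ (chain-at down-top (down-small j ≤-refl) (to-old ≤-refl (m≤n⇒m≤1+n j≤n) ch))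

    split : ∀ x y → x ≡ y ⊎ x ≢ y
    split x y with x ≟ y
    ... | yes e = inj₁ e
    ... | no ne = inj₂ ne

    result : _ → Longest (cyc i c) y
    result (yes y≤j) = (λ m ch → subst (m ≤_) (sym z≡) (bound ch))
                     , subst (Chain f′ _ y) (sym z≡) (chain-mono (n≤1+n (suc n)) ≤-refl
                         (to-new ≤-refl (chain-at (sym down-top) (sym (down-small j y≤j)) (proj₂ ih))))
      where
      y≤n = ≤-trans y≤j j≤n
      ih = longest c y y≤n
      z≡ : zeros y (u ++ 0 ∷ bump 0 v) ≡ zeros y w
      z≡ = trans (zeros-prefix y u _ le) (trans (sym (zeros-prefix y u v le)) (cong (zeros y) u++v))
        where le = subst (y ≤_) (sym len-u) y≤j
      bound : ∀ {m} → Chain f′ (suc (suc n)) y m → m ≤ zeros y w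
      bound nil = z≤n
      bound (step p p< v ch) with ≤-pred p< | split p (suc n)
      ... | _  | inj₁ refl = ⊥-elim (<⇒≱ (subst (_< y) (fn-cyc-top c i) v) y≤j)
      ... | p≤ | inj₂ ne = proj₁ ih _ (chain-at down-top (down-small j y≤j)
            (to-old ≤-refl (m≤n⇒m≤1+n y≤n) (step p (≤∧≢⇒< p≤ ne) v ch)))
    result (no y≰j) = above y y≤ (≰⇒> y≰j)
      where
      above : ∀ y → y ≤ suc (suc n) → j < y → Longest (cyc i c) y
      above (suc y) (s≤s y≤) (s≤s j≤y) = (λ m ch → subst (m ≤_) (sym z≡) (bound ch))
                                       , subst (Chain f′ _ (suc y)) (sym z≡) exists
        where
        z≡ : zeros (suc y) (u ++ 0 ∷ bump 0 v) ≡ zeros y w ⊔ suc (zeros j w)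
        z≡ = trans (zeros-insert y u v (subst (_≤ y) (sym len-u) j≤y)) (cong₂ (λ a b → zeros y a ⊔ suc (zeros b a)) u++v len-u)
        top : zeros (suc n) w ≡ zeros n w
        top = zeros-beyond n w (≤-reflexive (length-word c))
        old : ∀ y → j ≤ y → y ≤ suc n → ∃ λ y′ → y′ ≤ n × zeros y w ≡ zeros y′ w × y′ ≤ y
        old y j≤ y≤ with y ≟ suc n
        ... | yes refl = n , ≤-refl , top , n≤1+n n
        ... | no ne    = y , ≤-pred (≤∧≢⇒< y≤ ne) , refl , ≤-refl
        via-j : ∀ {m} → m ≤ suc (zeros j w) → m ≤ zeros y w ⊔ suc (zeros j w)
        via-j h = ≤-trans h (m≤n⊔m (zeros y w) _)
        via-old : ∀ {y₀ m} → y₀ ≤ n → j ≤ y₀ → zeros y₀ w ≤ zeros y w → Chain f′ (suc n) (suc y₀) m → m ≤ zeros y w ⊔ suc (zeros j w)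
        via-old {y₀} y₀≤ j≤ h ch = ≤-trans (≤-trans (proj₁ (longest c y₀ y₀≤) _
          (chain-at down-top (down-large j j≤) (to-old ≤-refl (s≤s y₀≤) ch))) h) (m≤m⊔n (zeros y w) _)
        bound : ∀ {m} → Chain f′ (suc (suc n)) (suc y) m → m ≤ zeros y w ⊔ suc (zeros j w)
        bound nil = z≤n
        bound (step p p< v ch) with ≤-pred p< | split p (suc n) | split p j | split y (suc n)
        ... | _  | inj₁ refl | _         | _         = via-j (s≤s (below-j (chain-at refl (fn-cyc-top c i) ch)))
        ... | p≤ | inj₂ ne   | inj₁ refl | _         = via-j (s≤s (proj₁ (longest c j j≤n) _ (chain-sym (fn-involutive c) j≤n
              (chain-at (down-small j ≤-refl) down-top (to-old (m≤n⇒m≤1+n j≤n) ≤-refl (chain-at refl (fn-cyc-i c i) ch))))))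
        -- The bound n + 2 exceeds what the old code admits. The chain ends neither at position i
        -- nor at n + 1, so its last value is below n + 1, and by `top` the smaller bound has the
        -- same number of zeros.
        ... | p≤ | inj₂ ne   | inj₂ ne′  | inj₁ refl = via-old ≤-refl j≤n (≤-reflexive (sym top)) (step p p<′ value ch)
          where
          p<′ = ≤∧≢⇒< p≤ ne
          value : f′ p < suc n
          value = subst (_< suc n) (sym (fn-cyc-old c i ne ne′)) (s≤s (≤-trans (up-≤ j _)
            (proj₁ (fn-involutive c (down j p) (subst (down j p <_) down-top (down-< ne′ p<′))))))
        ... | p≤ | inj₂ ne   | inj₂ ne′  | inj₂ y≢   = via-old (≤-pred (≤∧≢⇒< y≤ y≢)) j≤y ≤-refl (step p (≤∧≢⇒< p≤ ne) v ch)
        exists : Chain f′ (suc (suc n)) (suc y) (zeros y w ⊔ suc (zeros j w))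
        exists with ⊔-sel (zeros y w) (suc (zeros j w))
        ... | inj₂ e = subst (Chain f′ _ _) (sym e) (step (suc n) ≤-refl (subst (_< suc y) (sym (fn-cyc-top c i)) (s≤s j≤y))
              (chain-at refl (sym (fn-cyc-top c i))
                (to-new ≤-refl (chain-at (sym down-top) (sym (down-small j ≤-refl)) (proj₂ (longest c j j≤n))))))
        ... | inj₁ e with y ≟ suc n
        ...   | yes refl = subst (Chain f′ _ _) (sym (trans e top)) (chain-mono (n≤1+n _) (n≤1+n _)
                (to-new ≤-refl (chain-at (sym down-top) (sym down-top) (proj₂ (longest c n ≤-refl)))))
        ...   | no ne = subst (Chain f′ _ _) (sym e) (chain-mono (n≤1+n _) ≤-refl
                (to-new ≤-refl (chain-at (sym down-top) (sym (down-large j j≤y)) (proj₂ (longest c y (≤-pred (≤∧≢⇒< y≤ ne)))))))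

-- Fixed points as odd columns; from row words to chamber walks

module Conjugation where
  open import Data.Nat using (_<_; _≤_; _+_; _≟_; _<?_; _≤?_)
  open import Data.Nat.Properties
  open import Data.Integer as ℤ using (ℤ; +_; 0ℤ; 1ℤ; -1ℤ)
  import Data.Integer.Properties as ℤ
  open import Data.Bool using (_xor_)
  open import Data.Fin as Fin using (zero; suc; toℕ; fromℕ<; inject₁)
  open import Data.Fin.Properties using (toℕ-fromℕ<; toℕ-injective; toℕ<n; toℕ-inject₁)
  open import Data.List using ([]; _∷_; _++_; take; drop)
  open import Data.List.Properties using (take++drop≡id)
  open import Data.Vec using ([]; _∷_; lookup)
  open import Data.Unit using (tt)
  open import Relation.Nullary using (¬_)
  open ShiftOperators using (inc)
  open ChamberWalks using (dec; ρ; lo<hi⇒dec; dec⇒lo<hi; ∧-true)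
  open Antisymmetry using (lo; hi)
  open ParityClasses using (odd)
  open Equidistribution using (par; pop; odd-+)
  open LatticeWords
  open IncreasingChains

  fixedPoints : ∀ {n} → Code n → ℕ
  fixedPoints empty     = 0
  fixedPoints (fix c)   = suc (fixedPoints c)
  fixedPoints (cyc i c) = fixedPoints c

  countFixed : ℕ → (ℕ → ℕ) → ℕ
  countFixed zero    f = 0
  countFixed (suc n) f with f n ≟ n
  ... | yes _ = suc (countFixed n f)
  ... | no _  = countFixed n f

  _⇆_ : Set → Set → Set
  A ⇆ B = (A → B) × (B → A)

  countFixed-cong : ∀ n {f g} → (∀ p → p < n → (f p ≡ p) ⇆ (g p ≡ p)) → countFixed n f ≡ countFixed n g
  countFixed-cong zero    h = refl
  countFixed-cong (suc n) {f} {g} h with f n ≟ n | g n ≟ n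
  ... | yes _ | yes _ = cong suc (countFixed-cong n λ p p< → h p (m<n⇒m<1+n p<))
  ... | no _  | no _  = countFixed-cong n λ p p< → h p (m<n⇒m<1+n p<)
  ... | yes e | no ne = ⊥-elim (ne (proj₁ (h n ≤-refl) e))
  ... | no ne | yes e = ⊥-elim (ne (proj₂ (h n ≤-refl) e))

  countFixed-no : ∀ n f → f n ≢ n → countFixed (suc n) f ≡ countFixed n f
  countFixed-no n f ne with f n ≟ n
  ... | yes e = ⊥-elim (ne e)
  ... | no _  = refl

  up-small : ∀ {i p} → p < i → up i p ≡ p
  up-small {i} {p} p<i with p <? i
  ... | yes _ = refl
  ... | no ¬p = ⊥-elim (¬p p<i)

  up-large : ∀ {i p} → i ≤ p → up i p ≡ suc p
  up-large {i} {p} i≤p with p <? i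
  ... | yes p<i = ⊥-elim (<⇒≱ p<i i≤p)
  ... | no _    = refl

  countFixed-up : ∀ i n g f → i ≤ n → g i ≢ i → (∀ p → p < n → (g (up i p) ≡ up i p) ⇆ (f p ≡ p)) →
    countFixed (suc n) g ≡ countFixed n f
  countFixed-up zero zero g f i≤n ne h = countFixed-no 0 g ne
  countFixed-up i (suc n) g f i≤n ne h with i ≟ suc n
  ... | yes refl = trans (countFixed-no i g ne) (countFixed-cong (suc n) λ p p< →
          subst (λ q → (g q ≡ q) ⇆ (f p ≡ p)) (up-small p<) (h p p<))
  ... | no i≢n = last
    where
    i≤ : i ≤ n
    i≤ = ≤-pred (≤∧≢⇒< i≤n i≢n)
    rec : countFixed (suc n) g ≡ countFixed n f
    rec = countFixed-up i n g f i≤ ne λ p p< → h p (m<n⇒m<1+n p<)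
    here : (g (suc n) ≡ suc n) ⇆ (f n ≡ n)
    here = subst (λ q → (g q ≡ q) ⇆ (f n ≡ n)) (up-large i≤) (h n ≤-refl)
    last : countFixed (suc (suc n)) g ≡ countFixed (suc n) f
    last with g (suc n) ≟ suc n | f n ≟ n
    ... | yes _ | yes _ = cong suc rec
    ... | no _  | no _  = rec
    ... | yes e | no ¬e = ⊥-elim (¬e (proj₁ here e))
    ... | no ¬e | yes e = ⊥-elim (¬e (proj₂ here e))

  countFixed-fn : ∀ {n} (c : Code n) → countFixed n (fn c) ≡ fixedPoints c
  countFixed-fn empty = refl
  countFixed-fn (fix {n} c) with fn (fix c) n ≟ n
  ... | yes _ = cong suc (trans (countFixed-cong n λ p p< →
          (λ e → trans (sym (fn-fix-old c (<⇒≢ p<))) e) , (λ e → trans (fn-fix-old c (<⇒≢ p<)) e)) (countFixed-fn c))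
  ... | no ne = ⊥-elim (ne (fn-fix-top c))
  countFixed-fn (cyc {n} i c) = trans (countFixed-no (suc n) (fn (cyc i c)) (λ e → <⇒≢ (s≤s (i≤n c i)) (trans (sym (fn-cyc-top c i)) e)))
    (trans (countFixed-up j n (fn (cyc i c)) (fn c) (i≤n c i) (λ e → <⇒≢ (s≤s (i≤n c i)) (sym (trans (sym (fn-cyc-i c i)) e)))
      (λ p p< → let e′ = value p p< in
        (λ e → trans (sym (down-up j (fn c p))) (trans (cong (down j) (trans (sym e′) e)) (down-up j p)))
      , (λ e → trans e′ (cong (up j) e)))) (countFixed-fn c))
    where
    j = toℕ i
    value : ∀ p → p < n → fn (cyc i c) (up j p) ≡ up j (fn c p)
    value p p< = trans (fn-cyc-old c i (<⇒≢ (s≤s (≤-trans (up-≤ j p) p<))) (up≢ j p)) (cong (up j ∘ fn c) (down-up j p))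

  sgn : ℕ → ℤ
  sgn r = if odd r then -1ℤ else 1ℤ

  sgn-suc : ∀ r → sgn (suc r) ≡ ℤ.- sgn r
  sgn-suc r with odd r
  ... | true  = refl
  ... | false = refl

  -- The number of odd columns of a shape is the alternating sum of its row lengths.
  alternating : List ℕ → ℤ
  alternating []      = 0ℤ
  alternating (a ∷ w) = sgn a ℤ.+ alternating w

  alternating-++ : ∀ u v → alternating (u ++ v) ≡ alternating u ℤ.+ alternating v
  alternating-++ []      v = sym (ℤ.+-identityˡ _)
  alternating-++ (a ∷ u) v = trans (cong (ℤ._+_ (sgn a)) (alternating-++ u v)) (sym (ℤ.+-assoc (sgn a) _ _))

  -- With last carry C the letters s, ..., C - 1 become s + 1, ..., C and C + 1 is appended. As the
  -- signs of C and C + 1 cancel, the net change is minus the sign of s; for s = 0 the inserted 0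
  -- restores it, so two-cycles leave the alternating sum unchanged.
  alternating-bump : ∀ s v → alternating (bump s v) ℤ.+ sgn s ≡ alternating v
  alternating-bump s [] = trans (cong (λ x → x ℤ.+ 0ℤ ℤ.+ sgn s) (sgn-suc s)) (lem (sgn s))
    where
    lem : ∀ x → ℤ.- x ℤ.+ 0ℤ ℤ.+ x ≡ 0ℤ
    lem = solve-∀
  alternating-bump s (a ∷ v) with a ≟ s
  ... | yes refl = trans (lem (sgn (suc s)) _ (sgn s)) (cong (ℤ._+_ (sgn s)) (alternating-bump (suc s) v))
    where
    lem : ∀ x y z → x ℤ.+ y ℤ.+ z ≡ z ℤ.+ (y ℤ.+ x)
    lem = solve-∀
  ... | no _ = trans (ℤ.+-assoc (sgn a) _ _) (cong (ℤ._+_ (sgn a)) (alternating-bump s v))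

  alternating-word : ∀ {n} (c : Code n) → alternating (word c) ≡ + fixedPoints c
  alternating-word empty   = refl
  alternating-word (fix c) = trans (alternating-++ (word c) (0 ∷ [])) (trans (ℤ.+-comm (alternating (word c)) 1ℤ) (cong (ℤ._+_ 1ℤ) (alternating-word c)))
  alternating-word (cyc i c) = begin
    alternating (u ++ 0 ∷ bump 0 v)                            ≡⟨ alternating-++ u (0 ∷ bump 0 v) ⟩
    alternating u ℤ.+ (1ℤ ℤ.+ alternating (bump 0 v))          ≡⟨ cong (ℤ._+_ (alternating u)) (trans (ℤ.+-comm 1ℤ (alternating (bump 0 v))) (alternating-bump 0 v)) ⟩
    alternating u ℤ.+ alternating v                            ≡⟨ sym (alternating-++ u v) ⟩
    alternating (u ++ v)                                       ≡⟨ cong alternating (take++drop≡id (toℕ i) (word c)) ⟩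
    alternating (word c)                                       ≡⟨ alternating-word c ⟩
    + fixedPoints c                                            ∎
    where
    open ≡-Reasoning
    u = take (toℕ i) (word c)
    v = drop (toℕ i) (word c)

  ρ-step : ∀ {k} (i : Fin k) → suc (lookup (ρ k) i) ≡ lookup (ρ (suc k)) (inject₁ i)
  ρ-step zero    = refl
  ρ-step (suc i) = ρ-step i

  lookup-inc : ∀ {k} (t : Fin k) l → lookup (inc t l) t ≡ suc (lookup l t)
  lookup-inc zero    (a ∷ l) = refl
  lookup-inc (suc t) (a ∷ l) = lookup-inc t l

  lookup-inc-other : ∀ {k} (t c : Fin k) l → c ≢ t → lookup (inc t l) c ≡ lookup l c
  lookup-inc-other zero    zero    (a ∷ l) ne = ⊥-elim (ne refl)
  lookup-inc-other zero    (suc c) (a ∷ l) ne = refl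
  lookup-inc-other (suc t) zero    (a ∷ l) ne = refl
  lookup-inc-other (suc t) (suc c) (a ∷ l) ne = lookup-inc-other t c l (ne ∘ cong suc)

  hi-lookup : ∀ {n} (i : Fin n) l → hi i l ≡ lookup l (inject₁ i)
  hi-lookup zero    (a ∷ l) = refl
  hi-lookup (suc i) (a ∷ l) = hi-lookup i l

  lo-lookup : ∀ {n} (i : Fin n) l → lo i l ≡ lookup l (suc i)
  lo-lookup zero    (a ∷ b ∷ l) = refl
  lo-lookup (suc i) (a ∷ l)     = lo-lookup i l

  -- m are the row lengths and l − ρ the column lengths of the same diagram with at most k columns.
  record Shape {k} (m : ℕ → ℕ) (l : Vec ℕ k) : Set where
    field
      h     : Fin k → ℕ
      l≡    : ∀ c → lookup l c ≡ lookup (ρ k) c + h c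
      conj  : ∀ r c → (toℕ c < m r) ⇆ (r < h c)
      m≤k   : ∀ r → m r ≤ k

    column-of : ∀ {r} (t : Fin k) → toℕ t ≡ m r → Legal m r → h t ≡ r
    column-of {r} t e leg = ≤-antisym (≮⇒≥ λ r< → <-irrefl e (proj₂ (conj r t) r<)) (lower r e leg)
      where
      lower : ∀ r → toℕ t ≡ m r → Legal m r → r ≤ h t
      lower zero    e leg = z≤n
      lower (suc r) e leg = proj₁ (conj r t) (subst (_< m r) (sym e) leg)

  shape-add : ∀ {k m} {l : Vec ℕ k} r t → (s : Shape m l) → toℕ t ≡ m r → Shape.h s t ≡ r → Shape (add r m) (inc t l)
  shape-add {k} {m} {l} r t s e e′ = record { h = h′ ; l≡ = l≡′ ; conj = conj′ ; m≤k = m≤k′ }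
    where
    open Shape s
    h′ : Fin k → ℕ
    h′ c with c Fin.≟ t
    ... | yes _ = suc (h c)
    ... | no _  = h c
    l≡′ : ∀ c → lookup (inc t l) c ≡ lookup (ρ k) c + h′ c
    l≡′ c with c Fin.≟ t
    ... | yes refl = trans (lookup-inc t l) (trans (cong suc (l≡ t)) (sym (+-suc (lookup (ρ k) t) (h t))))
    ... | no ne    = trans (lookup-inc-other t c l ne) (l≡ c)
    m≤k′ : ∀ x → add r m x ≤ k
    m≤k′ x with x ≟ r
    ... | yes refl = subst (λ z → suc z ≤ k) e (toℕ<n t)
    ... | no _     = m≤k x
    conj′ : ∀ x c → (toℕ c < add r m x) ⇆ (x < h′ c)
    conj′ x c with x ≟ r | c Fin.≟ t
    ... | no _     | no _     = conj x c
    ... | yes refl | yes refl = (λ _ → ≤-reflexive (cong suc (sym e′))) , (λ _ → ≤-reflexive (cong suc e))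
    ... | yes refl | no c≢t   = (λ lt → proj₁ (conj x c) (≤∧≢⇒< (≤-pred lt) λ q → c≢t (toℕ-injective (trans q (sym e))))) , λ lt → m<n⇒m<1+n (proj₂ (conj x c) lt)
    ... | no x≢r   | yes refl = (λ lt → m<n⇒m<1+n (proj₁ (conj x c) lt)) , λ lt → proj₂ (conj x c) (≤∧≢⇒< (≤-pred lt) λ q → x≢r (trans q e′))

  shape-dec : ∀ {k m} (l : Vec ℕ k) → Shape m l → dec nothing l ≡ true
  shape-dec {zero}  [] s = refl
  shape-dec {suc k} {m} l s = lo<hi⇒dec l λ i → begin-strict
    lo i l                                 ≡⟨ trans (lo-lookup i l) (l≡ (suc i)) ⟩
    lookup (ρ (suc k)) (suc i) + h (suc i) ≤⟨ +-monoʳ-≤ _ (mono i) ⟩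
    lookup (ρ (suc k)) (suc i) + h (inject₁ i) <⟨ n<1+n _ ⟩
    suc (lookup (ρ (suc k)) (suc i)) + h (inject₁ i) ≡⟨ cong (_+ h (inject₁ i)) (ρ-step i) ⟩
    lookup (ρ (suc k)) (inject₁ i) + h (inject₁ i) ≡⟨ sym (trans (hi-lookup i l) (l≡ (inject₁ i))) ⟩
    hi i l                                 ∎
    where
    open ≤-Reasoning
    open Shape s
    mono : ∀ i → h (suc i) ≤ h (inject₁ i)
    mono i with h (suc i) ≤? h (inject₁ i)
    ... | yes le = le
    ... | no ¬le = ⊥-elim (<-irrefl refl (proj₁ (conj _ (inject₁ i)) (≤-trans (s≤s (≤-trans (≤-reflexive (toℕ-inject₁ i)) (n≤1+n (toℕ i)))) (proj₂ (conj _ (suc i)) (≰⇒> ¬le)))))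

  -- Converse of `column-of`: strict decrease of the new point means that the column to the left is
  -- longer, so the new cell extends its row.
  row-of : ∀ {k m} {l : Vec ℕ k} t (s : Shape m l) → dec nothing (inc t l) ≡ true → toℕ t ≡ m (Shape.h s t) × Legal m (Shape.h s t)
  row-of {suc k} {m} {l} t s d = ≤-antisym (t≤ t d) (≮⇒≥ λ lt → <-irrefl refl (proj₁ (conj (h t) t) lt)) , legal (h t) refl
    where
    open Shape s
    t≤ : ∀ t → dec nothing (inc t l) ≡ true → toℕ t ≤ m (h t)
    t≤ zero    d = z≤n
    t≤ (suc i) d = subst (_< m (h (suc i))) (toℕ-inject₁ i) (proj₂ (conj (h (suc i)) (inject₁ i)) (+-cancelˡ-< (suc R) _ _ (begin-strict
      suc R + h (suc i)                        ≡⟨ cong suc (sym (l≡ (suc i))) ⟩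
      suc (lookup l (suc i))                   ≡⟨ sym (trans (lo-lookup i (inc (suc i) l)) (lookup-inc (suc i) l)) ⟩
      lo i (inc (suc i) l)                     <⟨ dec⇒lo<hi nothing (inc (suc i) l) d i ⟩
      hi i (inc (suc i) l)                     ≡⟨ trans (hi-lookup i (inc (suc i) l)) (lookup-inc-other (suc i) (inject₁ i) l (neq i)) ⟩
      lookup l (inject₁ i)                     ≡⟨ l≡ (inject₁ i) ⟩
      lookup (ρ (suc k)) (inject₁ i) + h (inject₁ i) ≡⟨ cong (_+ h (inject₁ i)) (sym (ρ-step i)) ⟩
      suc R + h (inject₁ i)                    ∎)))
      where
      open ≤-Reasoning
      R = lookup (ρ (suc k)) (suc i)
      neq : ∀ {n} (i : Fin n) → inject₁ i ≢ suc i
      neq i e = suc≢ (trans (cong toℕ (sym e)) (toℕ-inject₁ i))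
    legal : ∀ r → h t ≡ r → Legal m r
    legal zero    e = tt
    legal (suc r) e = ≤-trans (s≤s (≮⇒≥ λ lt → <-irrefl (sym e) (proj₁ (conj (suc r) t) lt))) (proj₂ (conj r t) (≤-reflexive (sym e)))

  -- The row word and the column word of one standard tableau.
  data Match {k} : ∀ {n} → Vec ℕ k → List ℕ → Vec (Fin k) n → Set where
    []   : ∀ {l} → Match l [] []
    cell : ∀ {n l r t w} {y : Vec (Fin k) n} → lookup l t ≡ lookup (ρ k) t + r → Match (inc t l) w y → Match l (r ∷ w) (t ∷ y)

  good : ∀ {k n} → Vec ℕ k → Vec (Fin k) n → Bool
  good l []      = dec nothing l
  good l (t ∷ y) = dec nothing l ∧ good (inc t l) y

  end : ∀ {k n} → Vec ℕ k → Vec (Fin k) n → Vec ℕ k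
  end l []      = l
  end l (t ∷ y) = end (inc t l) y

  good⇒dec : ∀ {k n} (l : Vec ℕ k) (y : Vec (Fin k) n) → good l y ≡ true → dec nothing l ≡ true
  good⇒dec l []      g = g
  good⇒dec l (t ∷ y) g = proj₁ (∧-true g)

  -- The present length of row 0 plus the zeros still to come is its final length. Keeping this at
  -- most k ensures that every new cell has a column in `Fin k`.
  rows⇒columns : ∀ {k m} {l : Vec ℕ k} w → Shape m l → Yam m w → m 0 + zeros (length w) w ≤ k →
    ∃ λ (y : Vec (Fin k) (length w)) → good l y ≡ true × Match l w y
  rows⇒columns {l = l} [] s _ b = [] , shape-dec l s , []
  rows⇒columns {k} {m} {l} (r ∷ w) s (leg ∷ yam) b =
    let y , g , mt = rows⇒columns w s′ yam (bound r b)
    in t ∷ y , trans (cong (_∧ good (inc t l) y) (shape-dec l s)) g , cell (trans (l≡ t) (cong (_+_ (lookup (ρ k) t)) h≡)) mt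
    where
    open Shape s
    m0< : ∀ {a w} → m 0 + zeros (length (a ∷ w)) (a ∷ w) ≤ k → a ≡ 0 → m 0 < k
    m0< {w = w} b refl = ≤-trans (s≤s (m≤m+n (m 0) (zeros (length w) w))) (≤-trans (≤-reflexive (sym (+-suc (m 0) _))) b)
    mr< : ∀ r → Legal m r → m 0 + zeros (length (r ∷ w)) (r ∷ w) ≤ k → m r < k
    mr< zero    leg b = m0< {0} {w} b refl
    mr< (suc r) leg b = ≤-trans leg (m≤k r)
    t< = mr< r leg b
    t : Fin k
    t = fromℕ< t<
    h≡ : h t ≡ r
    h≡ = column-of t (toℕ-fromℕ< t<) leg
    s′ = shape-add r t s (toℕ-fromℕ< t<) h≡
    bound : ∀ r → m 0 + zeros (length (r ∷ w)) (r ∷ w) ≤ k → add r m 0 + zeros (length w) w ≤ k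
    bound zero    b = ≤-trans (≤-reflexive (sym (+-suc (m 0) _))) b
    bound (suc r) b = b

  columns⇒rows : ∀ {k m n} {l : Vec ℕ k} (y : Vec (Fin k) n) → Shape m l → good l y ≡ true →
    ∃ λ w → length w ≡ n × Yam m w × m 0 + zeros n w ≤ k × Match l w y
  columns⇒rows {k} {m} [] s g = [] , refl , [] , ≤-trans (≤-reflexive (+-identityʳ (m 0))) (Shape.m≤k s 0) , []
  columns⇒rows {k} {m} {suc n} {l} (t ∷ y) s g =
    let g′ = proj₂ (∧-true {dec nothing l} g)
        e , leg = row-of t s (good⇒dec (inc t l) y g′)
        w , len , yam , b , mt = columns⇒rows y (shape-add (h t) t s e refl) g′
    in h t ∷ w , cong suc len , leg ∷ yam , bound (h t) w b , cell (l≡ t) mt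
    where
    open Shape s
    bound : ∀ r w → add r m 0 + zeros n w ≤ k → m 0 + zeros (suc n) (r ∷ w) ≤ k
    bound zero    w b = ≤-trans (≤-reflexive (+-suc (m 0) (zeros n w))) b
    bound (suc r) w b = b

  match-functional : ∀ {k n} {l : Vec ℕ k} {w w′} {y : Vec (Fin k) n} → Match l w y → Match l w′ y → w ≡ w′
  match-functional [] [] = refl
  match-functional (cell e mt) (cell e′ mt′) = cong₂ _∷_ (+-cancelˡ-≡ _ _ _ (trans (sym e) e′)) (match-functional mt mt′)

  match-injective : ∀ {k m n} {l : Vec ℕ k} {w} {y y′ : Vec (Fin k) n} → Shape m l → good l y ≡ true → good l y′ ≡ true →
    Match l w y → Match l w y′ → y ≡ y′
  match-injective s g g′ [] [] = refl
  match-injective {k} {m} {l = l} s g g′ (cell {r = r} {t = t} {y = y} e mt) (cell {t = t′} {y = y′} e′ mt′)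
    with toℕ-injective {i = t} {j = t′} (trans (row t y e g) (sym (row t′ y′ e′ g′)))
    where
    open Shape s
    row : ∀ {n} t (y : Vec (Fin k) n) → lookup l t ≡ lookup (ρ k) t + r → good l (t ∷ y) ≡ true → toℕ t ≡ m r
    row t y e g = trans (proj₁ (row-of t s (good⇒dec (inc t l) y (proj₂ (∧-true {dec nothing l} g))))) (cong m (+-cancelˡ-≡ _ _ _ (trans (sym (l≡ t)) e)))
  ... | refl = cong (t ∷_) (match-injective (shape-add (h t) t s (proj₁ row) refl) (gt y g) (gt y′ g′) mt mt′)
    where
    open Shape s
    gt : ∀ {n} (y : Vec (Fin k) n) → good l (t ∷ y) ≡ true → good (inc t l) y ≡ true
    gt y g = proj₂ (∧-true {dec nothing l} g)
    row = row-of t s (good⇒dec (inc t l) y (gt y g))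

  -- A new cell makes a column of even height odd and one of odd height even; adding ρ to l gives
  -- the parity of the height without subtraction.
  pop-inc : ∀ {k} (t : Fin k) l → + pop (par (inc t l)) ≡ + pop (par l) ℤ.+ sgn (lookup l t + lookup (ρ k) t)
  pop-inc {suc k} zero (a ∷ l) with odd (a + k)
  ... | true  = sym (lem (+ pop (par l)))
    where
    lem : ∀ x → 1ℤ ℤ.+ x ℤ.+ -1ℤ ≡ x
    lem = solve-∀
  ... | false = ℤ.+-comm 1ℤ (+ pop (par l))
  pop-inc {suc k} (suc t) (a ∷ l) with odd (a + k)
  ... | true  = trans (cong (ℤ._+_ 1ℤ) (pop-inc t l)) (sym (ℤ.+-assoc 1ℤ (+ pop (par l)) (sgn (lookup l t + lookup (ρ k) t))))
  ... | false = pop-inc t l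

  match-odd : ∀ {k n} {l : Vec ℕ k} {w} {y : Vec (Fin k) n} → Match l w y → + pop (par (end l y)) ≡ + pop (par l) ℤ.+ alternating w
  match-odd [] = sym (ℤ.+-identityʳ _)
  match-odd {k} {l = l} (cell {r = r} {t = t} {w = w} e mt) = trans (match-odd mt) (trans (cong (ℤ._+ alternating w)
    (trans (pop-inc t l) (cong (λ b → + pop (par l) ℤ.+ (if b then -1ℤ else 1ℤ)) same))) (ℤ.+-assoc (+ pop (par l)) (sgn r) _))
    where
    R = lookup (ρ k) t
    cancel : ∀ x y → (x xor y) xor x ≡ y
    cancel true  true  = refl
    cancel true  false = refl
    cancel false true  = refl
    cancel false false = refl
    same : odd (lookup l t + R) ≡ odd r
    same = trans (cong (λ x → odd (x + R)) e) (trans (odd-+ (R + r) R) (trans (cong (_xor odd R) (odd-+ R r)) (cancel (odd R) (odd r))))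

-- Pattern containment and fixed points in terms of functions on ℕ

module AvoidanceAsChains where
  open import Data.Nat using (_<_; _≤_; _+_; _≟_; _<?_; _<ᵇ_)
  open import Data.Nat.Properties
  open import Data.Bool using (T)
  open import Data.Bool.Properties using (T-∧)
  open import Data.Fin as Fin using (zero; suc; toℕ; fromℕ<)
  open import Data.Fin.Properties using (toℕ-fromℕ<; toℕ-injective; toℕ<n; fromℕ<-toℕ)
  open import Data.List using ([]; _∷_; _++_; map; filter; allFin; tabulate)
  open import Data.List.Membership.Propositional using (_∈_; find; lose)
  open import Data.List.Membership.Propositional.Properties using (∈-map⁺; ∈-map⁻; ∈-++⁺ˡ; ∈-++⁺ʳ; ∈-++⁻; ∈-allFin)
  open import Data.List.Relation.Unary.Any using (here)
  open import Data.List.Relation.Unary.Any.Properties using (any⁺; any⁻)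
  open import Data.List.Relation.Unary.All as All using (All)
  open import Data.List.Relation.Unary.All.Properties using (all⁺; all⁻)
  open import Data.Vec using ([]; _∷_; lookup; toList)
  open import Data.Unit using (tt; ⊤)
  open import Relation.Nullary using (¬_)
  open import Relation.Nullary.Decidable using (⌊_⌋; toWitness; fromWitness)
  open import Defs
  open IncreasingChains
  open Conjugation using (countFixed)

  val : ∀ {n} → Map n → ℕ → ℕ
  val {n} v p with p <? n
  ... | yes p< = toℕ (lookup v (fromℕ< p<))
  ... | no _   = p

  val-toℕ : ∀ {n} (v : Map n) i → val v (toℕ i) ≡ toℕ (lookup v i)
  val-toℕ {n} v i with toℕ i <? n
  ... | yes p< = cong (toℕ ∘ lookup v) (fromℕ<-toℕ i p<)
  ... | no ¬p  = ⊥-elim (¬p (toℕ<n i))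

  involution⇒ : ∀ {n} (v : Map n) → T (isInvolution v) → Involutive n (val v)
  involution⇒ {n} v t p p< = subst (λ q → val v q < n × val v (val v q) ≡ q) (toℕ-fromℕ< p<)
      (subst (_< n) (sym (val-toℕ v i)) (toℕ<n (lookup v i))
      , trans (cong (val v) (val-toℕ v i)) (trans (val-toℕ v (lookup v i)) (cong toℕ e)))
    where
    i = fromℕ< p<
    e : lookup v (lookup v i) ≡ i
    e = toWitness (All.lookup (all⁺ (λ i → ⌊ lookup v (lookup v i) Fin.≟ i ⌋) (allFin n) t) (∈-allFin i))

  ⇒involution : ∀ {n} (v : Map n) → Involutive n (val v) → T (isInvolution v)
  ⇒involution {n} v inv = all⁻ (λ i → ⌊ lookup v (lookup v i) Fin.≟ i ⌋) (All.universal (λ i → fromWitness (toℕ-injective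
    (trans (sym (val-toℕ v (lookup v i))) (trans (cong (val v) (sym (val-toℕ v i))) (proj₂ (inv (toℕ i) (toℕ<n i))))))) (allFin n))

  -- Increasing subsequences read from the first element with lower bounds, as sublists are; `Chain`
  -- reads them from the last element with upper bounds.
  data Rise (f : ℕ → ℕ) (n : ℕ) : ℕ → ℕ → ℕ → Set where
    nil  : ∀ {a b} → Rise f n a b 0
    step : ∀ {a b m} p → a ≤ p → p < n → b ≤ f p → Rise f n (suc p) (suc (f p)) m → Rise f n a b (suc m)

  -- List reversal with an accumulator: the chain is the part already read, and its bounds are the
  -- start of the part that remains.
  rise⇒chain : ∀ {f n N} → (∀ p → p < n → f p < N) → ∀ {a b m j} → a ≤ n → b ≤ N → Chain f a b j → Rise f n a b m → Chain f n N (m + j)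
  rise⇒chain h a≤ b≤ ch nil = chain-mono a≤ b≤ ch
  rise⇒chain {f} {n} {N} h {j = j} a≤ b≤ ch (step {m = m} p a≤p p<n b≤fp r) = subst (Chain f n N) (+-suc m j)
    (rise⇒chain h p<n (h p p<n) (step p ≤-refl ≤-refl (chain-mono a≤p b≤fp ch)) r)

  chain⇒rise : ∀ {f n x y m j} → x ≤ n → Chain f x y m → Rise f n x y j → Rise f n 0 0 (m + j)
  chain⇒rise h nil r = weaken r
    where
    weaken : ∀ {f n a b m} → Rise f n a b m → Rise f n 0 0 m
    weaken nil                  = nil
    weaken (step p _ p<n _ r) = step p z≤n p<n z≤n r
  chain⇒rise {f} {n} {j = j} h (step {m = m} p p<x fp<y ch) r = subst (Rise f n 0 0) (+-suc m j)
    (chain⇒rise (≤-trans (<⇒≤ p<x) h) ch (step p ≤-refl (≤-trans p<x h) ≤-refl (raise p<x fp<y r)))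
    where
    raise : ∀ {f n a b a′ b′ m} → a < a′ → b < b′ → Rise f n a′ b′ m → Rise f n (suc a) (suc b) m
    raise u v nil                 = nil
    raise u v (step q q≥ q< b≤ r) = step q (≤-trans u q≥) q< (≤-trans v b≤) r

  data IncSub : ℕ → List ℕ → ℕ → Set where
    nil  : ∀ {b l} → IncSub b l 0
    skip : ∀ {b x l m} → IncSub b l m → IncSub b (x ∷ l) m
    keep : ∀ {b x l m} → b ≤ x → IncSub (suc x) l m → IncSub b (x ∷ l) (suc m)

  data Values (f : ℕ → ℕ) (n : ℕ) : ℕ → List ℕ → Set where
    []  : Values f n n []
    _∷_ : ∀ {a x l} → x ≡ f a → Values f n (suc a) l → Values f n a (x ∷ l)

  values-≤ : ∀ {f n a l} → Values f n a l → a ≤ n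
  values-≤ []      = ≤-refl
  values-≤ (_ ∷ t) = <⇒≤ (values-≤ t)

  rise-later : ∀ {f n a a′ b m} → a ≤ a′ → Rise f n a′ b m → Rise f n a b m
  rise-later h nil                 = nil
  rise-later h (step p a≤ p< b≤ r) = step p (≤-trans h a≤) p< b≤ r

  inc⇒rise : ∀ {f n a b l m} → Values f n a l → IncSub b l m → Rise f n a b m
  inc⇒rise t            nil        = nil
  inc⇒rise (e ∷ t)      (skip s)   = rise-later (n≤1+n _) (inc⇒rise t s)
  inc⇒rise {a = a} (refl ∷ t) (keep b≤ s) = step a ≤-refl (values-≤ t) b≤ (inc⇒rise t s)

  rise⇒inc : ∀ {f n a b l m} → Values f n a l → Rise f n a b m → IncSub b l m
  rise⇒inc t nil = nil
  rise⇒inc [] (step p a≤ p< b≤ r) = ⊥-elim (<⇒≱ p< a≤)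
  rise⇒inc {a = a} (refl ∷ t) (step p a≤ p< b≤ r) with a ≟ p
  ... | yes refl = keep b≤ (rise⇒inc t r)
  ... | no ne    = skip (rise⇒inc t (step p (≤∧≢⇒< a≤ ne) p< b≤ r))

  values-toList : ∀ {f n N m a} (u : Vec (Fin N) m) → a + m ≡ n → (∀ j → toℕ (lookup u j) ≡ f (a + toℕ j)) → Values f n a (map toℕ (toList u))
  values-toList {f} {n} {a = a} [] e h = subst (λ k → Values f k a []) (trans (sym (+-identityʳ a)) e) []
  values-toList {f} {a = a} (x ∷ u) e h = trans (h zero) (cong f (+-identityʳ a))
    ∷ values-toList u (trans (sym (+-suc a _)) e) λ j → trans (h (suc j)) (cong f (+-suc a (toℕ j)))

  values-oneLine : ∀ {n} (v : Map n) → Values (val v) n 0 (oneLine v)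
  values-oneLine v = values-toList v refl λ j → sym (val-toℕ v j)

  HeadAtLeast : ℕ → List ℕ → Set
  HeadAtLeast b []      = ⊤
  HeadAtLeast b (x ∷ s) = b ≤ x

  subseq⇒inc : ∀ l s b → s ∈ subseqs l → T (strictlyIncreasing s) → HeadAtLeast b s → IncSub b l (length s)
  subseq⇒inc [] .[] b (here refl) t h = nil
  subseq⇒inc (x ∷ l) s b s∈ t h with ∈-++⁻ (map (x ∷_) (subseqs l)) s∈
  ... | inj₂ q = skip (subseq⇒inc l s b q t h)
  ... | inj₁ q with ∈-map⁻ (x ∷_) q
  ...   | s′ , s′∈ , refl = keep h (subseq⇒inc l s′ (suc x) s′∈ (tail s′ t) (head s′ t))
    where
    tail : ∀ s → T (strictlyIncreasing (x ∷ s)) → T (strictlyIncreasing s)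
    tail []      t = tt
    tail (y ∷ s) t = proj₂ (Equivalence.to (T-∧ {x <ᵇ y}) t)
    head : ∀ s → T (strictlyIncreasing (x ∷ s)) → HeadAtLeast (suc x) s
    head []      t = tt
    head (y ∷ s) t = <ᵇ⇒< x y (proj₁ (Equivalence.to (T-∧ {x <ᵇ y}) t))

  []∈subseqs : ∀ (l : List ℕ) → [] ∈ subseqs l
  []∈subseqs []      = here refl
  []∈subseqs (x ∷ l) = ∈-++⁺ʳ (map (x ∷_) (subseqs l)) ([]∈subseqs l)

  inc⇒subseq : ∀ {b l m} → IncSub b l m → ∃ λ s → s ∈ subseqs l × length s ≡ m × T (strictlyIncreasing s) × HeadAtLeast b s
  inc⇒subseq {l = l} nil = [] , []∈subseqs l , refl , tt , tt
  inc⇒subseq {l = x ∷ l} (skip i) with inc⇒subseq i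
  ... | s , s∈ , e , t , h = s , ∈-++⁺ʳ (map (x ∷_) (subseqs l)) s∈ , e , t , h
  inc⇒subseq {l = x ∷ l} (keep b≤ i) with inc⇒subseq i
  ... | s , s∈ , e , t , h = x ∷ s , ∈-++⁺ˡ (∈-map⁺ (x ∷_) s∈) , cong suc e , cons s t h , b≤
    where
    cons : ∀ s → T (strictlyIncreasing s) → HeadAtLeast (suc x) s → T (strictlyIncreasing (x ∷ s))
    cons []      t h = tt
    cons (y ∷ s) t h = Equivalence.from T-∧ (<⇒<ᵇ h , t)

  module _ {n} (v : Map n) (inv : Involutive n (val v)) (m : ℕ) where
    private
      test : List ℕ → Bool
      test s = ⌊ length s ≟ m ⌋ ∧ strictlyIncreasing s

    contains⇒chain : T (containsIncreasing m v) → Chain (val v) n n m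
    contains⇒chain t with find (any⁻ test (subseqs (oneLine v)) t)
    ... | s , s∈ , ts with Equivalence.to (T-∧ {⌊ length s ≟ m ⌋}) ts
    ...   | e , inc = subst (Chain (val v) n n) (trans (+-identityʳ (length s)) (toWitness e))
        (rise⇒chain (λ p p< → proj₁ (inv p p<)) z≤n z≤n nil
          (inc⇒rise (values-oneLine v) (subseq⇒inc (oneLine v) s 0 s∈ inc (head s))))
      where
      head : ∀ s → HeadAtLeast 0 s
      head []      = tt
      head (x ∷ s) = z≤n

    chain⇒contains : Chain (val v) n n m → T (containsIncreasing m v)
    chain⇒contains ch with inc⇒subseq (rise⇒inc (values-oneLine v) (chain⇒rise ≤-refl ch nil))
    ... | s , s∈ , e , t , _ = any⁺ test (lose s∈ (Equivalence.from T-∧ (fromWitness (trans e (+-identityʳ m)) , t)))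

  -- countFixed counts from the top, fp from the bottom.
  fixedFrom : ℕ → ℕ → (ℕ → ℕ) → ℕ
  fixedFrom a zero    f = 0
  fixedFrom a (suc m) f with f a ≟ a
  ... | yes _ = suc (fixedFrom (suc a) m f)
  ... | no _  = fixedFrom (suc a) m f

  fixedFrom-last : ∀ a m f → fixedFrom a (suc m) f ≡ fixedFrom a m f + fixedFrom (a + m) 1 f
  fixedFrom-last a zero    f = cong (λ b → fixedFrom b 1 f) (sym (+-identityʳ a))
  fixedFrom-last a (suc m) f with f a ≟ a | trans (fixedFrom-last (suc a) m f) (cong (λ b → fixedFrom (suc a) m f + fixedFrom b 1 f) (sym (+-suc a m)))
  ... | yes _ | e = cong suc e
  ... | no _  | e = e

  fixedFrom-zero : ∀ n f → fixedFrom 0 n f ≡ countFixed n f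
  fixedFrom-zero zero    f = refl
  fixedFrom-zero (suc n) f = trans (fixedFrom-last 0 n f) (trans (cong (_+ fixedFrom n 1 f) (fixedFrom-zero n f)) last)
    where
    last : countFixed n f + fixedFrom n 1 f ≡ countFixed (suc n) f
    last with f n ≟ n
    ... | yes _ = +-comm (countFixed n f) 1
    ... | no _  = +-identityʳ _

  fp-countFixed : ∀ {n} (v : Map n) → fp v ≡ countFixed n (val v)
  fp-countFixed {n} v = trans (go n 0 (λ i → i) (λ _ → refl)) (fixedFrom-zero n (val v))
    where
    go : ∀ m a (g : Fin m → Fin n) → (∀ j → toℕ (g j) ≡ a + toℕ j) →
      length (filter (λ i → lookup v i Fin.≟ i) (tabulate g)) ≡ fixedFrom a m (val v)
    go zero    a g h = refl
    go (suc m) a g h with lookup v (g zero) Fin.≟ g zero | val v a ≟ a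
      | go m (suc a) (g ∘ suc) (λ j → trans (h (suc j)) (+-suc a (toℕ j)))
    ... | yes _ | yes _ | e = cong suc e
    ... | no _  | no _  | e = e
    ... | yes e | no ne | _ = ⊥-elim (ne (trans (sym (cong (val v) a≡)) (trans (val-toℕ v (g zero)) (trans (cong toℕ e) a≡))))
      where a≡ = trans (h zero) (+-identityʳ a)
    ... | no ne | yes e | _ = ⊥-elim (ne (toℕ-injective (trans (sym (val-toℕ v (g zero))) (trans (cong (val v) a≡) (trans e (sym a≡))))))
      where a≡ = trans (h zero) (+-identityʳ a)

-- Bijection between avoiding involutions and walks

module Enumeration where
  open import Data.Nat using (_<_; _≤_; _+_; _≟_; _≤?_; _≡ᵇ_)
  open import Data.Nat.Properties
  open import Data.Integer as ℤ using (ℤ; +_; 0ℤ; 1ℤ)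
  import Data.Integer.Properties as ℤ
  open import Data.Bool using (_xor_; T)
  open import Data.Bool.Properties using (T?; T-≡; T-∧; T-not-≡)
  open import Data.Fin using (zero; suc; toℕ; fromℕ<)
  open import Data.Fin.Properties using (toℕ-fromℕ<; toℕ-injective; toℕ<n)
  open import Data.List using ([]; _∷_; _++_; map; filter; allFin; tabulate; concatMap; cartesianProductWith)
  open import Data.List.Properties using (length-++; filter-++; filter-≐)
  open import Data.List.Membership.Propositional using (_∈_)
  open import Data.List.Membership.Propositional.Properties using (∈-++⁺ˡ; ∈-++⁺ʳ; ∈-++⁻; ∈-allFin; ∈-∃++; ∈-filter⁺; ∈-filter⁻; ∈-cartesianProductWith⁺)
  open import Data.List.Relation.Unary.Any using (here; there)
  open import Data.List.Relation.Unary.All as All using (All; []; _∷_)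
  open import Data.List.Relation.Unary.AllPairs using ([]; _∷_)
  open import Data.List.Relation.Unary.Unique.Propositional using (Unique)
  open import Data.List.Relation.Unary.Unique.Propositional.Properties using (cartesianProductWith⁺; allFin⁺; filter⁺)
  import Data.Vec as Vec
  open import Data.Vec using ([]; _∷_; lookup)
  open import Data.Vec.Properties using (lookup∘tabulate; tabulate∘lookup; tabulate-cong) renaming (∷-injective to ∷-injectiveV)
  open import Relation.Nullary using (¬_)
  open import Defs
  open ShiftOperators using (inc; sum; sum-cong-≗)
  open ChamberWalks using (dec; ρ; V; one; sum-zero)
  open CharacterBound using (walks; V-nonneg)
  open ParityClasses using (odd)
  open Equidistribution using (par; pop; odd-count; odd-+)
  open LatticeWords
  open IncreasingChains
  open Conjugation
  open AvoidanceAsChains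

  allVecs-product : ∀ n m → allVecs (suc n) m ≡ cartesianProductWith _∷_ (allFin m) (allVecs n m)
  allVecs-product n m = go (allFin m)
    where
    go : ∀ xs → concatMap (λ x → map (x ∷_) (allVecs n m)) xs ≡ cartesianProductWith _∷_ xs (allVecs n m)
    go []       = refl
    go (x ∷ xs) = cong (map (x ∷_) (allVecs n m) ++_) (go xs)

  allVecs-unique : ∀ n m → Unique (allVecs n m)
  allVecs-unique zero    m = [] ∷ []
  allVecs-unique (suc n) m = subst Unique (sym (allVecs-product n m))
    (cartesianProductWith⁺ _∷_ ∷-injectiveV (allFin⁺ m) (allVecs-unique n m))

  allVecs-complete : ∀ {n m} (v : Vec (Fin m) n) → v ∈ allVecs n m
  allVecs-complete [] = here refl
  allVecs-complete {suc n} {m} (x ∷ v) = subst (x ∷ v ∈_) (sym (allVecs-product n m))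
    (∈-cartesianProductWith⁺ _∷_ (∈-allFin x) (allVecs-complete v))

  -- Pigeonhole along a relation: the partner of x is struck from ys, and injectivity keeps the
  -- partners of the other elements in what remains.
  length-≤ : ∀ {A B : Set} (R : A → B → Set) (xs : List A) (ys : List B) → Unique xs →
    (∀ {x} → x ∈ xs → ∃ λ y → y ∈ ys × R x y) →
    (∀ {x x′ y} → x ∈ xs → x′ ∈ xs → R x y → R x′ y → x ≡ x′) → length xs ≤ length ys
  length-≤ R [] ys u total inj = z≤n
  length-≤ R (x ∷ xs) ys (x∉ ∷ u) total inj with total (here refl)
  ... | y , y∈ , r with ∈-∃++ y∈
  ...   | as , bs , refl = ≤-trans (s≤s (length-≤ R xs (as ++ bs) u total′ λ p q → inj (there p) (there q)))
          (≤-reflexive (trans (cong suc (length-++ as)) (sym (trans (length-++ as) (+-suc (length as) _)))))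
    where
    remove : ∀ {z} → z ≢ y → z ∈ as ++ (y ∷ bs) → z ∈ as ++ bs
    remove ne m with ∈-++⁻ as m
    ... | inj₁ p         = ∈-++⁺ˡ p
    ... | inj₂ (here e)  = ⊥-elim (ne e)
    ... | inj₂ (there p) = ∈-++⁺ʳ as p
    total′ : ∀ {x′} → x′ ∈ xs → ∃ λ y → y ∈ as ++ bs × R x′ y
    total′ {x′} m with total (there m)
    ... | y′ , y′∈ , r′ = y′ , remove (λ { refl → All.lookup x∉ m (inj (here refl) (there m) r r′) }) y′∈ , r′

  length-≡ : ∀ {A B : Set} (R : A → B → Set) (xs : List A) (ys : List B) → Unique xs → Unique ys →
    (∀ {x} → x ∈ xs → ∃ λ y → y ∈ ys × R x y) → (∀ {y} → y ∈ ys → ∃ λ x → x ∈ xs × R x y) →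
    (∀ {x x′ y} → x ∈ xs → x′ ∈ xs → R x y → R x′ y → x ≡ x′) →
    (∀ {x y y′} → y ∈ ys → y′ ∈ ys → R x y → R x y′ → y ≡ y′) → length xs ≡ length ys
  length-≡ R xs ys ux uy tx ty ix iy = ≤-antisym (length-≤ R xs ys ux tx ix) (length-≤ (λ y x → R x y) ys xs uy ty iy)

  empty-shape : ∀ k → Shape none (ρ k)
  empty-shape k = record { h = λ _ → 0 ; l≡ = λ c → sym (+-identityʳ _) ; conj = λ r c → (λ ()) , (λ ()) ; m≤k = λ _ → z≤n }

  odd-double : ∀ k → odd (k + k) ≡ false
  odd-double k = trans (odd-+ k k) (self (odd k))
    where
    self : ∀ x → x xor x ≡ false
    self true  = refl
    self false = refl

  pop-ρ : ∀ k → pop (par (ρ k)) ≡ 0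
  pop-ρ zero    = refl
  pop-ρ (suc k) rewrite odd-double k = pop-ρ k

  module _ (k n : ℕ) where

    -- The code is the common origin of both sides; a relation through it spares the explicit
    -- inversion of either construction.
    Corresponds : Map n → Vec (Fin k) n → Set
    Corresponds v y = ∃ λ (c : Code n) → (∀ p → p < n → fn c p ≡ val v p) × Match (ρ k) (word c) y

    Avoiding : Map n → Set
    Avoiding v = T (isInvolution v ∧ not (containsIncreasing (suc k) v))

    to-walk : ∀ v → Avoiding v → ∃ λ y → good (ρ k) y ≡ true × Corresponds v y
    to-walk v t = let y , g , mt = columns (length-word c) (Yam-word c) few in y , g , c , agree , mt
      where
      inv : Involutive n (val v)
      inv = involution⇒ v (proj₁ (Equivalence.to (T-∧ {isInvolution v}) t))
      c = proj₁ (fn-surjective n (val v) inv)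
      agree = proj₂ (fn-surjective n (val v) inv)
      few : zeros n (word c) ≤ k
      few with zeros n (word c) ≤? k
      ... | yes le = le
      ... | no ¬le = ⊥-elim (subst T (Equivalence.to T-not-≡ (proj₂ (Equivalence.to (T-∧ {isInvolution v}) t)))
            (chain⇒contains v inv (suc k) (chain-cong agree (chain-shorter (≰⇒> ¬le) (proj₂ (longest c n ≤-refl))))))
      columns : ∀ {w} → length w ≡ n → Yam none w → zeros n w ≤ k → ∃ λ (y : Vec (Fin k) n) → good (ρ k) y ≡ true × Match (ρ k) w y
      columns {w} refl yam le = rows⇒columns w (empty-shape k) yam le

    from-walk : ∀ y → good (ρ k) y ≡ true → ∃ λ v → Avoiding v × Corresponds v y
    from-walk y g with columns⇒rows y (empty-shape k) g
    ... | w , len , yam , few , mt with word-surjective n w len yam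
    ...   | c , refl = v , Equivalence.from T-∧ (⇒involution v inv , avoids) , c , agree , mt
      where
      v : Map n
      v = Vec.tabulate λ i → fromℕ< (proj₁ (fn-involutive c (toℕ i) (toℕ<n i)))
      agree : ∀ p → p < n → fn c p ≡ val v p
      agree p p< = subst (λ q → fn c q ≡ val v q) (toℕ-fromℕ< p<) (sym (trans (val-toℕ v i)
        (trans (cong toℕ (lookup∘tabulate _ i)) (toℕ-fromℕ< _))))
        where i = fromℕ< p<
      inv : Involutive n (val v)
      inv p p< = subst (_< n) (agree p p<) b , trans (sym (agree (val v p) (subst (_< n) (agree p p<) b))) (trans (cong (fn c) (sym (agree p p<))) e)
        where
        b = proj₁ (fn-involutive c p p<)
        e = proj₂ (fn-involutive c p p<)
      avoids : T (not (containsIncreasing (suc k) v))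
      avoids with containsIncreasing (suc k) v in eq
      ... | false = _
      ... | true  = <⇒≱ (proj₁ (longest c n ≤-refl) (suc k) (chain-cong (λ p p< → sym (agree p p<))
            (contains⇒chain v inv (suc k) (Equivalence.from T-≡ eq)))) few

    corresponds-fp : ∀ {v y} → Corresponds v y → pop (par (end (ρ k) y)) ≡ fp v
    corresponds-fp {v} {y} (c , agree , mt) = ℤ.+-injective (begin
      + pop (par (end (ρ k) y))                    ≡⟨ match-odd mt ⟩
      + pop (par (ρ k)) ℤ.+ alternating (word c)   ≡⟨ cong₂ (λ a b → + a ℤ.+ b) (pop-ρ k) (alternating-word c) ⟩
      + fixedPoints c                              ≡⟨ cong +_ (sym (countFixed-fn c)) ⟩
      + countFixed n (fn c)                        ≡⟨ cong +_ (countFixed-cong n λ p p< → (λ e → trans (sym (agree p p<)) e) , trans (agree p p<)) ⟩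
      + countFixed n (val v)                       ≡⟨ cong +_ (sym (fp-countFixed v)) ⟩
      + fp v                                       ∎)
      where open ≡-Reasoning

    val-injective : ∀ {v v′ : Map n} → (∀ p → p < n → val v p ≡ val v′ p) → v ≡ v′
    val-injective {v} {v′} h = trans (sym (tabulate∘lookup v)) (trans (tabulate-cong λ i → toℕ-injective
      (trans (sym (val-toℕ v i)) (trans (h (toℕ i) (toℕ<n i)) (val-toℕ v′ i)))) (tabulate∘lookup v′))

    -- With an arbitrary test χ on the number of fixed points, one bijection yields both the total
    -- and the number with exactly i fixed points.
    avoiding-walks : ∀ (χ : ℕ → Bool) → length (filter (λ v → T? (χ (fp v))) (Iv k n))
      ≡ length (filter (λ y → T? (good (ρ k) y ∧ χ (pop (par (end (ρ k) y))))) (allVecs n k))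
    avoiding-walks χ = length-≡ Corresponds xs ys (filter⁺ _ (filter⁺ _ (allVecs-unique n n))) (filter⁺ _ (allVecs-unique n k)) there′ back inj fun
      where
      xs = filter (λ v → T? (χ (fp v))) (Iv k n)
      ys = filter (λ y → T? (good (ρ k) y ∧ χ (pop (par (end (ρ k) y))))) (allVecs n k)
      isGood : ∀ {y} → y ∈ ys → good (ρ k) y ≡ true
      isGood m = Equivalence.to T-≡ (proj₁ (Equivalence.to T-∧ (proj₂ (∈-filter⁻ _ {xs = allVecs n k} m))))
      there′ : ∀ {v} → v ∈ xs → ∃ λ y → y ∈ ys × Corresponds v y
      there′ {v} m with ∈-filter⁻ _ {xs = Iv k n} m
      ... | m′ , t with to-walk v (proj₂ (∈-filter⁻ _ {xs = allVecs n n} m′))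
      ...   | y , g , r = y , ∈-filter⁺ _ (allVecs-complete y) (Equivalence.from T-∧ (Equivalence.from T-≡ g , subst (T ∘ χ) (sym (corresponds-fp r)) t)) , r
      back : ∀ {y} → y ∈ ys → ∃ λ v → v ∈ xs × Corresponds v y
      back {y} m with from-walk y (isGood m)
      ... | v , a , r = v , ∈-filter⁺ _ (∈-filter⁺ _ (allVecs-complete v) a)
          (subst (T ∘ χ) (corresponds-fp r) (proj₂ (Equivalence.to (T-∧ {good (ρ k) y}) (proj₂ (∈-filter⁻ _ {xs = allVecs n k} m))))) , r
      inj : ∀ {v v′ y} → v ∈ xs → v′ ∈ xs → Corresponds v y → Corresponds v′ y → v ≡ v′
      inj _ _ (c , a , mt) (c′ , a′ , mt′) with word-injective c c′ (match-functional mt mt′)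
      ... | refl = val-injective λ p p< → trans (sym (a p p<)) (a′ p p<)
      fun : ∀ {v y y′} → y ∈ ys → y′ ∈ ys → Corresponds v y → Corresponds v y′ → y ≡ y′
      fun m m′ (c , a , mt) (c′ , a′ , mt′) with fn-injective c c′ (λ p p< → trans (a p p<) (sym (a′ p p<)))
      ... | refl = match-injective (empty-shape k) (isGood m) (isGood m′) mt mt′

  countT : ∀ {A : Set} → (A → Bool) → List A → ℕ
  countT χ = length ∘ filter (T? ∘ χ)

  countT-++ : ∀ {A : Set} (χ : A → Bool) xs ys → countT χ (xs ++ ys) ≡ countT χ xs + countT χ ys
  countT-++ χ xs ys = trans (cong length (filter-++ (T? ∘ χ) xs ys)) (length-++ (filter (T? ∘ χ) xs))

  countT-map : ∀ {A B : Set} (f : A → B) (χ : B → Bool) xs → countT χ (map f xs) ≡ countT (χ ∘ f) xs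
  countT-map f χ [] = refl
  countT-map f χ (x ∷ xs) with χ (f x)
  ... | true  = cong suc (countT-map f χ xs)
  ... | false = countT-map f χ xs

  countT-false : ∀ {A : Set} (χ : A → Bool) xs → (∀ x → χ x ≡ false) → countT χ xs ≡ 0
  countT-false χ []       h = refl
  countT-false χ (x ∷ xs) h rewrite h x = countT-false χ xs h

  countT-cong : ∀ {A : Set} {χ ψ : A → Bool} xs → (∀ x → χ x ≡ ψ x) → countT χ xs ≡ countT ψ xs
  countT-cong []       h = refl
  countT-cong {χ = χ} {ψ} (x ∷ xs) h with χ x | ψ x | h x
  ... | true  | .true  | refl = cong suc (countT-cong xs h)
  ... | false | .false | refl = countT-cong xs h

  countT-concatMap : ∀ {A : Set} {k} (χ : A → Bool) {B : Set} (f : B → List A) (g : Fin k → B) →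
    + countT χ (concatMap f (tabulate g)) ≡ sum (λ t → + countT χ (f (g t)))
  countT-concatMap {k = zero}  χ f g = refl
  countT-concatMap {k = suc k} χ f g = trans (cong +_ (countT-++ χ (f (g zero)) _))
    (trans (ℤ.pos-+ (countT χ (f (g zero))) _) (cong (ℤ._+_ (+ countT χ (f (g zero)))) (countT-concatMap χ f (g ∘ suc))))

  countT-walks : ∀ {k} n (ψ : Vec ℕ k → Bool) l →
    + countT (λ y → good l y ∧ ψ (end l y)) (allVecs n k) ≡ V n (λ l → if ψ l then 1ℤ else 0ℤ) l
  countT-walks zero ψ l with dec nothing l | ψ l
  ... | true  | true  = refl
  ... | true  | false = refl
  ... | false | _     = refl
  countT-walks {k} (suc n) ψ l = trans (countT-concatMap χ (λ t → map (t ∷_) (allVecs n k)) (λ t → t)) step′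
    where
    χ : Vec (Fin k) (suc n) → Bool
    χ y = good l y ∧ ψ (end l y)
    step′ : sum (λ t → + countT χ (map (t ∷_) (allVecs n k))) ≡ V (suc n) (λ l → if ψ l then 1ℤ else 0ℤ) l
    step′ with dec nothing l in d
    ... | true  = sum-cong-≗ λ t → trans (cong +_ (trans (countT-map (t ∷_) χ (allVecs n k))
          (countT-cong (allVecs n k) λ y → cong (λ b → (b ∧ good (inc t l) y) ∧ ψ (end (inc t l) y)) d)))
          (countT-walks n ψ (inc t l))
    ... | false = sum-zero _ λ t → cong +_ (trans (countT-map (t ∷_) χ (allVecs n k))
          (countT-false (χ ∘ (t ∷_)) (allVecs n k) λ y → cong (λ b → (b ∧ good (inc t l) y) ∧ ψ (end (inc t l) y)) d))

  length-Iv : ∀ k n → length (Iv k n) ≡ walks k n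
  length-Iv k n = ℤ.+-injective (begin
    + length (Iv k n)                                              ≡⟨ cong (λ xs → + length xs) (sym (filter-true (Iv k n))) ⟩
    + countT (λ v → true) (Iv k n)                                 ≡⟨ cong +_ (avoiding-walks k n (λ _ → true)) ⟩
    + countT (λ y → good (ρ k) y ∧ true) (allVecs n k)             ≡⟨ countT-walks n (λ _ → true) (ρ k) ⟩
    V n one (ρ k)                                                  ≡⟨ sym (ℤ.0≤i⇒+∣i∣≡i (V-nonneg n (ρ k))) ⟩
    + walks k n                                                    ∎)
    where
    open ≡-Reasoning
    filter-true : ∀ {A : Set} (xs : List A) → filter (λ _ → T? true) xs ≡ xs
    filter-true []       = refl
    filter-true (x ∷ xs) = cong (x ∷_) (filter-true xs)

  length-fp : ∀ k n i → + length (filter (λ v → fp v ≟ i) (Iv k n)) ≡ odd-count {k} n i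
  length-fp k n i = begin
    + length (filter (λ v → fp v ≟ i) (Iv k n))                    ≡⟨ cong (λ xs → + length xs) (filter-≐ (λ v → fp v ≟ i) (λ v → T? (fp v ≡ᵇ i)) ((λ {v} → ≡⇒≡ᵇ (fp v) i) , (λ {v} → ≡ᵇ⇒≡ (fp v) i)) (Iv k n)) ⟩
    + countT (λ v → fp v ≡ᵇ i) (Iv k n)                            ≡⟨ cong +_ (avoiding-walks k n (_≡ᵇ i)) ⟩
    + countT (λ y → good (ρ k) y ∧ (pop (par (end (ρ k) y)) ≡ᵇ i)) (allVecs n k) ≡⟨ countT-walks n (λ l → pop (par l) ≡ᵇ i) (ρ k) ⟩
    odd-count {k} n i                                              ∎
    where open ≡-Reasoning

-- Rational estimates and convergence along each parity

module Convergence where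
  open import Data.Nat as ℕ using (_≤_; _<_)
  import Data.Nat.Properties as ℕ
  open import Data.Nat.Combinatorics using (_C_)
  open import Data.Integer as ℤ using (ℤ; +_)
  import Data.Integer.Properties as ℤ
  open import Data.Rational as ℚ using (ℚ; mkℚ; 0ℚ; toℚᵘ; fromℚᵘ)
  import Data.Rational.Properties as ℚ
  open import Data.Rational.Unnormalised as ℚᵘ using (ℚᵘ; mkℚᵘ; *<*)
  import Data.Rational.Unnormalised.Properties as ℚᵘ
  open import Data.Bool.Properties using (not-involutive)
  open import Data.List using (filter)
  open import Defs
  open ParityClasses using (odd)
  open Equidistribution using (odd-count-concentrates; odd-count-wrong-parity; walks>0)
  open Enumeration using (length-Iv; length-fp)

  -- The distance is x/(T Q) with x = |Q a - b T|, and ε is at least 1/δ for its denominator δ. The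
  -- factor δ + 1 in the hypothesis yields the strict inequality x δ < T.
  frac-close : ∀ a T b Q (ε : ℚ) → 0ℚ ℚ.< ε → 0 < T → 0 < Q →
    suc (ℚ.↧ₙ ε) ℕ.* ℤ.∣ + Q ℤ.* + a ℤ.- + b ℤ.* + T ∣ ≤ T → ℚ.∣ frac a T ℚ.- frac b Q ∣ ℚ.< ε
  frac-close a (suc T) b (suc Q) ε@(mkℚ (ℤ.+[1+ e ]) d _) ε>0 _ _ h = ℚ.toℚᵘ-cancel-< (ℚᵘ.<-respˡ-≃ (ℚᵘ.≃-sym lhs) (*<* small))
    where
    p q : ℚᵘ
    p = mkℚᵘ (+ a) T
    q = mkℚᵘ (+ b) Q
    x : ℕ
    x = ℤ.∣ + suc Q ℤ.* + a ℤ.- + b ℤ.* + suc T ∣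
    lhs : toℚᵘ ℚ.∣ fromℚᵘ p ℚ.- fromℚᵘ q ∣ ℚᵘ.≃ ℚᵘ.∣ p ℚᵘ.- q ∣
    lhs = ℚᵘ.≃-trans (ℚ.toℚᵘ-homo-∣-∣ (fromℚᵘ p ℚ.- fromℚᵘ q)) (ℚᵘ.∣-∣-cong
      (ℚᵘ.≃-trans (ℚ.toℚᵘ-homo-+ (fromℚᵘ p) (ℚ.- fromℚᵘ q))
        (ℚᵘ.+-cong (ℚ.toℚᵘ-fromℚᵘ p) (ℚᵘ.≃-trans (ℚ.toℚᵘ-homo‿- (fromℚᵘ q)) (ℚᵘ.-‿cong (ℚ.toℚᵘ-fromℚᵘ q))))))
    x< : x ℕ.* suc d < suc T
    x< = go x h
      where
      go : ∀ x → suc (suc d) ℕ.* x ≤ suc T → x ℕ.* suc d < suc T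
      go zero     h = s≤s z≤n
      go (suc x′) h = ℕ.≤-trans (ℕ.≤-trans (s≤s (ℕ.m≤n+m (suc x′ ℕ.* suc d) x′)) (ℕ.≤-reflexive (lem x′ d))) h
        where
        lem : ∀ x d → 1 ℕ.+ (x ℕ.+ (1 ℕ.+ x) ℕ.* (1 ℕ.+ d)) ≡ (1 ℕ.+ (1 ℕ.+ d)) ℕ.* (1 ℕ.+ x)
        lem = NatSolver.solve-∀
    num≡ : + a ℤ.* + suc Q ℤ.+ (ℤ.- + b) ℤ.* + suc T ≡ + suc Q ℤ.* + a ℤ.- + b ℤ.* + suc T
    num≡ = cong₂ ℤ._+_ (ℤ.*-comm (+ a) (+ suc Q)) (sym (ℤ.neg-distribˡ-* (+ b) (+ suc T)))
    small : + ℤ.∣ + a ℤ.* + suc Q ℤ.+ (ℤ.- + b) ℤ.* + suc T ∣ ℤ.* + suc d ℤ.< + suc e ℤ.* + (suc T ℕ.* suc Q)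
    small rewrite num≡ = subst₂ ℤ._<_ (ℤ.pos-* x (suc d)) (ℤ.pos-* (suc e) (suc T ℕ.* suc Q)) (ℤ.+<+
      (ℕ.≤-trans x< (ℕ.≤-trans (ℕ.m≤m*n (suc T) (suc Q)) (ℕ.m≤n*m (suc T ℕ.* suc Q) (suc e)))))
  frac-close a T b Q (mkℚ (+ zero) d _) (ℚ.*<* (ℤ.+<+ ())) _ _ h
  frac-close a T b Q (mkℚ (ℤ.-[1+ n ]) d _) (ℚ.*<* ()) _ _ h

  even≡not-odd : ∀ n → even n ≡ not (odd n)
  even≡not-odd zero    = refl
  even≡not-odd (suc n) = cong not (even≡not-odd n)

  odd-2* : ∀ n → odd (2 ℕ.* n) ≡ false
  odd-2* zero    = refl
  odd-2* (suc n) = trans (cong odd (lem n)) (trans (not-involutive _) (odd-2* n))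
    where
    lem : ∀ n → 2 ℕ.* (1 ℕ.+ n) ≡ 2 ℕ.+ 2 ℕ.* n
    lem = NatSolver.solve-∀

  odd-2*+1 : ∀ n → odd (2 ℕ.* n ℕ.+ 1) ≡ true
  odd-2*+1 n = trans (cong odd (ℕ.+-comm (2 ℕ.* n) 1)) (cong not (odd-2* n))

  limit : ℕ → ℕ → ℚ
  limit k i = frac (suc k C i) (2 ℕ.^ k)

  prob-converges : ∀ k i (s : ℕ → ℕ) → (∀ n → n ≤ s n) → (∀ n → odd i ≡ odd (s n)) → ConvergesTo (λ n → probFp (suc k) (s n) i) (limit k i)
  prob-converges k i s n≤s par ε ε>0 = proj₁ conc , λ n n≥ → frac-close (fpCount n) (total n) (suc k C i) (2 ℕ.^ k) ε ε>0
      (subst (0 <_) (sym (length-Iv (suc k) (s n))) (walks>0 k (s n))) (ℕ.m^n>0 2 k)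
      (subst₂ (λ x t → suc (ℚ.↧ₙ ε) ℕ.* ℤ.∣ + (2 ℕ.^ k) ℤ.* x ℤ.- + (suc k C i) ℤ.* + t ∣ ≤ t)
        (sym (length-fp (suc k) (s n) i)) (sym (length-Iv (suc k) (s n))) (proj₂ conc (s n) (ℕ.≤-trans n≥ (n≤s n)) (par n)))
    where
    conc = odd-count-concentrates k i (suc (ℚ.↧ₙ ε))
    fpCount total : ℕ → ℕ
    fpCount n = length (filter (λ v → fp v ℕ.≟ i) (Iv (suc k) (s n)))
    total n = length (Iv (suc k) (s n))

  frac-zero : ∀ t → frac 0 t ≡ 0ℚ
  frac-zero zero    = refl
  frac-zero (suc t) = ℚ.0/n≡0 (suc t)

  prob-vanishes : ∀ k i (s : ℕ → ℕ) → (∀ n → odd i ≢ odd (s n)) → ConvergesTo (λ n → probFp (suc k) (s n) i) 0ℚ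
  prob-vanishes k i s par ε ε>0 = 0 , λ n _ → subst (λ p → ℚ.∣ p ℚ.- 0ℚ ∣ ℚ.< ε) (sym (zero-prob n)) ε>0
    where
    zero-prob : ∀ n → probFp (suc k) (s n) i ≡ 0ℚ
    zero-prob n = trans (cong (λ a → frac a (length (Iv (suc k) (s n))))
        (ℤ.+-injective (trans (length-fp (suc k) (s n) i) (odd-count-wrong-parity {k} (s n) i (par n)))))
      (frac-zero (length (Iv (suc k) (s n))))

-- Assembly of the even and odd cases

open import Defs
open import Data.Nat using (ℕ; suc; _+_; _*_; _≤_)
open import Data.Nat.Properties using (≤-trans; m≤n*m; m≤m+n)
open ParityClasses using (odd)
open Convergence using (even≡not-odd; odd-2*; odd-2*+1; prob-converges; prob-vanishes)

-- The odd sizes 2n + 1 are the sizes 2n - 1 with the index shifted by one, which does not affect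
-- limits.
theorem2 : (k : ℕ) → 1 ≤ k →
    ConvergesInDist (λ n i → probFp k (2 * n) i) (pEven k)
    × ConvergesInDist (λ n i → probFp k (2 * n + 1) i) (pOdd k)
theorem2 (suc k) _ = at-even , at-odd
  where
  n≤2n : ∀ n → n ≤ 2 * n
  n≤2n n = m≤n*m n 2
  true≢false : true ≢ false
  true≢false ()
  at-even : ConvergesInDist (λ n i → probFp (suc k) (2 * n) i) (pEven (suc k))
  at-even i rewrite even≡not-odd i with odd i in eq
  ... | false = prob-converges k i (2 *_) n≤2n λ n → trans eq (sym (odd-2* n))
  ... | true  = prob-vanishes k i (2 *_) λ n e → true≢false (trans (sym eq) (trans e (odd-2* n)))
  at-odd : ConvergesInDist (λ n i → probFp (suc k) (2 * n + 1) i) (pOdd (suc k))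
  at-odd i rewrite even≡not-odd i with odd i in eq
  ... | true  = prob-converges k i (λ n → 2 * n + 1) (λ n → ≤-trans (n≤2n n) (m≤m+n (2 * n) 1))
                  λ n → trans eq (sym (odd-2*+1 n))
  ... | false = prob-vanishes k i (λ n → 2 * n + 1)
                  λ n e → true≢false (trans (sym (odd-2*+1 n)) (trans (sym e) eq))
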